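{- Let $\mathcal{D}$ be a definite quaternion algebra over $\mathbb{Q}$ and let $G$ be an imprimitive absolutely irreducible maximal finite subgroup of $GL_2(\mathcal{D})$. Then either $\mathcal{D}=D_{2,\infty}$ and $G\cong (SL_2(\mathbb{F}_3))^2\rtimes\mathrm{Sym}_2$, or $\mathcal{D}=D_{3,\infty}$ and $G\cong(\mathrm{Dic}_{12})^2\rtimes\mathrm{Sym}_2$.
   Context: $D_{p,\infty}$ denotes the quaternion algebra over $\mathbb{Q}$ ramified exactly at $p$ and $\infty$. A finite subgroup $G\le GL_2(\mathcal{D})$ is absolutely irreducible if its $\mathbb{Q}$-span in $M_2(\mathcal{D})$ equals $M_2(\mathcal{D})$; it is a maximal finite subgroup if it is not properly contained in a finite subgroup of $GL_2(\mathcal{D})$. Writing $V=\mathcal{D}^{1\times 2}$ as a $\mathcal{D}$-$G$-bimodule (with $\mathcal{D}$ acting on the left, $G$ on the right), an irreducible $G$ is imprimitive if $V=V_1\oplus\cdots\oplus V_s$ nontrivially as left $\mathcal{D}$-modules with $G$ permuting the $V_i$. $\mathrm{Dic}_{12}=\langle a,b\mid a^6=1,b^2=a^3,bab^{ -1}=a^{ -1}\rangle$; the semidirect products are the wreath products with $\mathrm{Sym}_2$ permuting the two factors. -}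

module Defs where

open import Level using (Level; 0ℓ)
open import Data.Nat as ℕ using (ℕ; zero; suc; _%_)
open import Data.Bool using (Bool; true; false; _xor_)
open import Data.Fin using (Fin)
open import Data.Integer using (+_)
open import Data.Rational as Q using (ℚ; 0ℚ; 1ℚ; _/_)
open import Data.List using (List; []; _∷_)
open import Data.List.Membership.Propositional using (_∈_)
open import Data.List.Relation.Unary.All using (All)
open import Data.Product using (Σ; ∃; _×_; _,_; proj₁; proj₂)
open import Relation.Binary.PropositionalEquality using (_≡_)
open import Relation.Nullary using (¬_)

-- Quaternion algebras (a,b)_ℚ with basis 1,i,j,k ; i²=a, j²=b, k=ij=-ji.
-- ℚ is the normalised rationals, so _≡_ is the correct equality.

record Quat : Set where
  constructor quat
  field q0 q1 q2 q3 : ℚ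
open Quat public

module QA (a b : ℚ) where
  infixl 6 _⊕_
  infixl 7 _⊗_ _·ₛ_

  zeroQ oneQ : Quat
  zeroQ = quat 0ℚ 0ℚ 0ℚ 0ℚ
  oneQ  = quat 1ℚ 0ℚ 0ℚ 0ℚ

  _⊕_ : Quat → Quat → Quat
  quat x0 x1 x2 x3 ⊕ quat y0 y1 y2 y3 =
    quat (x0 Q.+ y0) (x1 Q.+ y1) (x2 Q.+ y2) (x3 Q.+ y3)

  _·ₛ_ : ℚ → Quat → Quat
  c ·ₛ quat x0 x1 x2 x3 = quat (c Q.* x0) (c Q.* x1) (c Q.* x2) (c Q.* x3)

  -- multiplication: i²=a, j²=b, k²=-ab, ij=k, ji=-k,
  -- jk=-b i, kj=b i, ki=-a j, ik=a j
  _⊗_ : Quat → Quat → Quat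
  quat x0 x1 x2 x3 ⊗ quat y0 y1 y2 y3 =
    quat (x0 Q.* y0 Q.+ a Q.* (x1 Q.* y1) Q.+ b Q.* (x2 Q.* y2)
            Q.- (a Q.* b) Q.* (x3 Q.* y3))
         (x0 Q.* y1 Q.+ x1 Q.* y0 Q.- b Q.* (x2 Q.* y3) Q.+ b Q.* (x3 Q.* y2))
         (x0 Q.* y2 Q.+ x2 Q.* y0 Q.+ a Q.* (x1 Q.* y3) Q.- a Q.* (x3 Q.* y1))
         (x0 Q.* y3 Q.+ x3 Q.* y0 Q.+ x1 Q.* y2 Q.- x2 Q.* y1)

  record Mat : Set where
    constructor mat
    field m11 m12 m21 m22 : Quat
  open Mat public

  _⊗ₘ_ : Mat → Mat → Mat
  mat x11 x12 x21 x22 ⊗ₘ mat y11 y12 y21 y22 =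
    mat (x11 ⊗ y11 ⊕ x12 ⊗ y21) (x11 ⊗ y12 ⊕ x12 ⊗ y22)
        (x21 ⊗ y11 ⊕ x22 ⊗ y21) (x21 ⊗ y12 ⊕ x22 ⊗ y22)

  _⊕ₘ_ : Mat → Mat → Mat
  mat x11 x12 x21 x22 ⊕ₘ mat y11 y12 y21 y22 =
    mat (x11 ⊕ y11) (x12 ⊕ y12) (x21 ⊕ y21) (x22 ⊕ y22)

  _·ₘ_ : ℚ → Mat → Mat
  c ·ₘ mat x11 x12 x21 x22 = mat (c ·ₛ x11) (c ·ₛ x12) (c ·ₛ x21) (c ·ₛ x22)

  zeroM oneM : Mat
  zeroM = mat zeroQ zeroQ zeroQ zeroQ
  oneM  = mat oneQ zeroQ zeroQ oneQ

  record IsFiniteSubgroup (G : List Mat) : Set where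
    field
      one∈   : oneM ∈ G
      mul∈   : ∀ {g h} → g ∈ G → h ∈ G → (g ⊗ₘ h) ∈ G
      inv∈   : ∀ {g} → g ∈ G → Σ Mat λ h → h ∈ G × (g ⊗ₘ h ≡ oneM) × (h ⊗ₘ g ≡ oneM)

  IsMaximalFinite : List Mat → Set
  IsMaximalFinite G = ∀ (H : List Mat) → IsFiniteSubgroup H →
    (∀ {g} → g ∈ G → g ∈ H) → ∀ {g} → g ∈ H → g ∈ G

  linComb : List (ℚ × Mat) → Mat
  linComb [] = zeroM
  linComb ((c , g) ∷ cs) = (c ·ₘ g) ⊕ₘ linComb cs

  IsAbsolutelyIrreducible : List Mat → Set
  IsAbsolutelyIrreducible G = ∀ (M : Mat) →
    Σ (List (ℚ × Mat)) λ cs → All (λ p → proj₂ p ∈ G) cs × (M ≡ linComb cs)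

  Row : Set
  Row = Quat × Quat

  zeroR : Row
  zeroR = zeroQ , zeroQ

  _⊕ᵣ_ : Row → Row → Row
  (x , y) ⊕ᵣ (x' , y') = (x ⊕ x') , (y ⊕ y')

  _·ₗ_ : Quat → Row → Row
  d ·ₗ (x , y) = (d ⊗ x) , (d ⊗ y)

  _·ᵣ_ : Row → Mat → Row
  (x , y) ·ᵣ mat g11 g12 g21 g22 = (x ⊗ g11 ⊕ y ⊗ g21) , (x ⊗ g12 ⊕ y ⊗ g22)

  sumR : (s : ℕ) → (Fin s → Row) → Row
  sumR zero    w = zeroR
  sumR (suc s) w = w Fin.zero ⊕ᵣ sumR s (λ i → w (Fin.suc i))
    where import Data.Fin as Fin

  record IsLeftSubmodule (W : Row → Set) : Set where
    field
      zero∈  : W zeroR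
      add∈   : ∀ {v w} → W v → W w → W (v ⊕ᵣ w)
      smul∈  : ∀ (d : Quat) {v} → W v → W (d ·ₗ v)

  IsDirectSumDecomposition : (s : ℕ) → (Fin s → Row → Set) → Set
  IsDirectSumDecomposition s V =
    (∀ i → IsLeftSubmodule (V i)) ×
    (∀ (v : Row) → Σ (Fin s → Row) λ w → (∀ i → V i (w i)) × (v ≡ sumR s w)) ×
    (∀ (w w' : Fin s → Row) → (∀ i → V i (w i)) → (∀ i → V i (w' i)) →
       sumR s w ≡ sumR s w' → ∀ i → w i ≡ w' i)

  MapsOnto : Mat → (Row → Set) → (Row → Set) → Set
  MapsOnto g Vi Vj = (∀ {v} → Vi v → Vj (v ·ᵣ g)) ×
                     (∀ {w} → Vj w → Σ Row λ v → Vi v × (w ≡ v ·ᵣ g))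

  IsImprimitive : List Mat → Set₁
  IsImprimitive G = Σ ℕ λ s → Σ (Fin (suc (suc s)) → Row → Set) λ V →
    IsDirectSumDecomposition (suc (suc s)) V ×
    (∀ i → Σ Row λ v → V i v × ¬ (v ≡ zeroR)) ×
    (∀ {g} → g ∈ G → ∀ i → Σ (Fin (suc (suc s))) λ j → MapsOnto g (V i) (V j))

open QA public

record QAlgIso (a b a' b' : ℚ) : Set where
  field
    f        : Quat → Quat
    f-add    : ∀ x y → f (QA._⊕_ a b x y) ≡ QA._⊕_ a' b' (f x) (f y)
    f-scal   : ∀ c x → f (QA._·ₛ_ a b c x) ≡ QA._·ₛ_ a' b' c (f x)
    f-mul    : ∀ x y → f (QA._⊗_ a b x y) ≡ QA._⊗_ a' b' (f x) (f y)
    f-one    : f (QA.oneQ a b) ≡ QA.oneQ a' b'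
    f-inj    : ∀ x y → f x ≡ f y → x ≡ y
    f-surj   : ∀ y → Σ Quat λ x → f x ≡ y

D2∞-a D2∞-b D3∞-a D3∞-b : ℚ
D2∞-a = Q.- 1ℚ
D2∞-b = Q.- 1ℚ
D3∞-a = Q.- 1ℚ
D3∞-b = Q.- (+ 3 / 1)

record FinGrp : Set₁ where
  field
    Car  : Set
    Elem : Car → Set
    _∙_  : Car → Car → Car

-- SL₂(𝔽₃): entries (p,q,r,t) = [[p,q],[r,t]] in {0,1,2}, det ≡ 1 mod 3
SL2F3 : FinGrp
SL2F3 = record
  { Car  = ℕ × ℕ × ℕ × ℕ
  ; Elem = λ { (p , q , r , t) →
      (p ℕ.< 3) × (q ℕ.< 3) × (r ℕ.< 3) × (t ℕ.< 3) ×
      ((p ℕ.* t ℕ.+ 2 ℕ.* (q ℕ.* r)) % 3 ≡ 1) }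
  ; _∙_  = λ { (p , q , r , t) (p' , q' , r' , t') →
      ((p ℕ.* p' ℕ.+ q ℕ.* r') % 3) , ((p ℕ.* q' ℕ.+ q ℕ.* t') % 3) ,
      ((r ℕ.* p' ℕ.+ t ℕ.* r') % 3) , ((r ℕ.* q' ℕ.+ t ℕ.* t') % 3) }
  }

-- Dic₁₂ = ⟨a,b | a⁶=1, b²=a³, bab⁻¹=a⁻¹⟩; (i , e) stands for aⁱ bᵉ
Dic12 : FinGrp
Dic12 = record
  { Car  = ℕ × Bool
  ; Elem = λ { (i , e) → i ℕ.< 6 }
  ; _∙_  = mul
  }
  where
  mul : ℕ × Bool → ℕ × Bool → ℕ × Bool
  mul (i , false) (j , f)     = ((i ℕ.+ j) % 6) , f
  mul (i , true)  (j , false) = ((i ℕ.+ 5 ℕ.* j) % 6) , true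
  mul (i , true)  (j , true)  = ((i ℕ.+ 5 ℕ.* j ℕ.+ 3) % 6) , false

-- wreath product H ≀ Sym₂ = (H × H) ⋊ Sym₂ ; flag true = the swap
Wr2 : FinGrp → FinGrp
Wr2 H = record
  { Car  = Car × Car × Bool
  ; Elem = λ { (x , y , _) → Elem x × Elem y }
  ; _∙_  = mul
  }
  where
  open FinGrp H
  mul : Car × Car × Bool → Car × Car × Bool → Car × Car × Bool
  mul (x , y , false) (x' , y' , t) = (x ∙ x') , (y ∙ y') , t
  mul (x , y , true)  (x' , y' , t) = (x ∙ y') , (y ∙ x') , (true xor t)

record GrpIso (a b : ℚ) (H : FinGrp) (G : List (Mat a b)) : Set where
  open FinGrp H
  field
    φ      : Car → Mat a b
    φ-into : ∀ {x} → Elem x → φ x ∈ G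
    φ-inj  : ∀ {x y} → Elem x → Elem y → φ x ≡ φ y → x ≡ y
    φ-onto : ∀ {g} → g ∈ G → Σ Car λ x → Elem x × (φ x ≡ g)
    φ-hom  : ∀ {x y} → Elem x → Elem y → φ (x ∙ y) ≡ QA._⊗ₘ_ a b (φ x) (φ y)

{-# OPTIONS --safe #-}

-- A nonzero row from each of two summands gives a basis (v₀ , v₁) of 𝒟², so there are exactly two
-- summands, and absolute irreducibility yields τ ∈ G moving the line of v₀ to that of v₁.  In the
-- basis u₀ = v₀, u₁ = v₀ τ every element of G is monomial with entries in the finite group
-- H = { d | u₀ g = d u₀ for some g ∈ G }, which spans 𝒟 over ℚ.
-- Elements of H have norm 1 and reduced trace t with |t| ≤ 2; since t(h²) = t(h)² - 2, the trace of
-- maximal denominator is an integer, so all traces lie in {0, ±1, ±2}.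
-- Integrality of the traces t(gh) on H leaves two cases.  Either H contains i, j with
-- i² = j² = -1 and ij = -ji; then the elements of H have half-integral coordinates and norm 1,
-- which leaves the 24 Hurwitz units of (-1,-1).  Or H contains b, ω with b² = -1, ω² + ω + 1 = 0
-- and bω = ω̄b; then the same coordinate count leaves the 12 units of Dic₁₂ in (-1,-3).
-- In both cases G lies in the finite wreath product of that unit group with Sym₂, and equals it by
-- maximality.
module Submission where

open import Defs using (Quat; quat; q0; q1; q2; q3; module QA; FinGrp; SL2F3; Dic12; Wr2;
  D2∞-a; D2∞-b; D3∞-a; D3∞-b; QAlgIso; GrpIso;
  Mat; IsFiniteSubgroup; IsAbsolutelyIrreducible; IsMaximalFinite; IsImprimitive)
open import Algebra.Bundles using (Ring)
import Algebra.Properties.CommutativeSemigroup as CommutativeSemigroupProperties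
import Algebra.Properties.Group as Group
import Algebra.Properties.Ring as RingProperties
open import Data.Bool using (Bool; true; false; _xor_; not)
import Data.Bool.Properties as BoolP
open import Data.Empty using (⊥; ⊥-elim)
open import Data.Fin using (Fin; zero; suc; #_)
open import Data.Fin.Patterns
open import Data.Integer as ℤ using (ℤ; -[1+_]; ∣_∣)
import Data.Integer.Properties as ℤP
open import Data.List using (List; []; _∷_; map; filter; cartesianProduct; upTo; allFin)
open import Data.List.Extrema using (argmax; argmax-sel; f[xs]≤f[argmax])
import Data.List.Membership.DecPropositional as DecMembership
open import Data.List.Membership.Propositional using (_∈_; find)
open import Data.List.Membership.Propositional.Properties using (∈-map⁺; ∈-map⁻; ∈-filter⁺; ∈-filter⁻;
  ∈-cartesianProduct⁺; ∈-cartesianProduct⁻; ∈-upTo⁺; ∈-upTo⁻; ∈-allFin)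
open import Data.List.Relation.Unary.All as All using (All; []; _∷_; all?)
open import Data.List.Relation.Unary.Any using (Any; any?; here; there)
open import Data.Nat as ℕ using (ℕ; zero; suc; s≤s; z≤n; _%_)
open import Data.Nat.Coprimality as Coprimality using (Coprime; coprime-divisor)
open import Data.Nat.Divisibility using (_∣_; divides; ∣⇒≤)
import Data.Nat.Properties as ℕP
open import Data.Product using (Σ; _×_; _,_; proj₁; proj₂; swap)
open import Data.Product.Properties using (≡-dec)
open import Data.Rational as Q using (ℚ; mkℚ; 0ℚ; 1ℚ; ½; _+_; _*_; _-_; -_; _/_; _<_; _≤_; ↧ₙ_; toℚᵘ)
import Data.Rational.Properties as QP
import Data.Rational.Unnormalised as ℚᵘ
import Data.Rational.Unnormalised.Properties as ℚᵘP
open import Data.Sum as Sum using (_⊎_; inj₁; inj₂)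
open import Data.Vec using (Vec; []; _∷_)
open import Level using (0ℓ)
open import Relation.Binary.Bundles using (TotalOrder; DecTotalOrder)
open import Relation.Binary.Definitions using (DecidableEquality)
open import Relation.Binary.PropositionalEquality hiding (J)
open import Relation.Nullary using (¬_; Dec; yes; no)
open import Relation.Nullary.Decidable using (dec⇒maybe; map′; from-yes; _×-dec_; _→-dec_)
open import Tactic.RingSolver.Core.AlmostCommutativeRing using (AlmostCommutativeRing; fromCommutativeRing)
import Tactic.RingSolver.Core.Polynomial.Base as Polynomial
import Tactic.RingSolver.Core.Polynomial.Parameters as Parameters
import Tactic.RingSolver.Core.Polynomial.Semantics as Semantics
import Tactic.RingSolver.NonReflective as RingSolver

-- Identities in quaternion algebras

-- The algebra is given as (a,b) with arbitrary negative rationals, so no order and no ramification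
-- data are at hand: the isomorphism types of both 𝒟 and H must be read off from traces of elements
-- of H. Traces suffice because the trace form is nondegenerate. In an orthogonal basis 1, I, J, IJ
-- the coordinates of h are, up to fixed rational factors, the traces of h, hI, hJ and hIJ; when I
-- and J are built from elements of H, these depend on four traces with five possible values each,
-- and finding H becomes a search through 625 quadruples. Rationality of the traces is what excludes
-- the binary octahedral and icosahedral groups, whose elements of order eight and five have
-- irrational trace. An element of order three does not by itself separate the two remaining cases,
-- since the binary tetrahedral group contains such elements too; the trace of bω, for a traceless b
-- not commuting with ω, tells them apart.

quat-cong : ∀ {x y : Quat} → q0 x ≡ q0 y → q1 x ≡ q1 y → q2 x ≡ q2 y → q3 x ≡ q3 y → x ≡ y
quat-cong refl refl refl refl = refl

-- A quaternion variable is a quadruple of variables of the ring solver over ℚ; the other variables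
-- are the parameters a, b of the algebra and two scalars.
module QuaternionSolver where
  ℚ-ring : AlmostCommutativeRing 0ℓ 0ℓ
  ℚ-ring = fromCommutativeRing QP.+-*-commutativeRing (λ x → dec⇒maybe (0ℚ QP.≟ x))

  open RingSolver ℚ-ring using (Expr; Κ; Ι; module Ops) renaming (_⊕_ to _+ᴱ_; _⊗_ to _*ᴱ_; ⊝_ to -ᴱ_) public
  open Polynomial (Parameters.Homomorphism.from Ops.homo) using (Poly)

  Scalar : Set
  Scalar = Expr ℚ 16

  infixl 6 _-ᴱ_
  _-ᴱ_ : Scalar → Scalar → Scalar
  e -ᴱ f = e +ᴱ (-ᴱ f)

  value : Scalar → Vec ℚ 16 → ℚ
  value = Ops.⟦_⟧

  -- The equality of normal forms is an argument, so that each identity below is discharged by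
  -- `refl` on closed polynomials while the rationals in `ρ` stay variables.
  scalar-solve : (e f : Scalar) → Ops.norm e ≡ Ops.norm f → ∀ ρ → value e ρ ≡ value f ρ
  scalar-solve e f eq ρ = trans (sym (Ops.correct e ρ))
    (trans (cong (λ p → Semantics.⟦_⟧ Ops.homo p ρ) eq) (Ops.correct f ρ))

  record QuatE : Set where
    constructor quatE
    field e0 e1 e2 e3 : Scalar
  open QuatE

  A B S R : Scalar
  A = Ι (# 0)
  B = Ι (# 1)
  S = Ι (# 2)
  R = Ι (# 3)

  X Y Z : QuatE
  X = quatE (Ι (# 4)) (Ι (# 5)) (Ι (# 6)) (Ι (# 7))
  Y = quatE (Ι (# 8)) (Ι (# 9)) (Ι (# 10)) (Ι (# 11))
  Z = quatE (Ι (# 12)) (Ι (# 13)) (Ι (# 14)) (Ι (# 15))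

  env : ℚ → ℚ → ℚ → ℚ → Quat → Quat → Quat → Vec ℚ 16
  env a b s t (quat x0 x1 x2 x3) (quat y0 y1 y2 y3) (quat z0 z1 z2 z3) =
    a ∷ b ∷ s ∷ t ∷ x0 ∷ x1 ∷ x2 ∷ x3 ∷ y0 ∷ y1 ∷ y2 ∷ y3 ∷ z0 ∷ z1 ∷ z2 ∷ z3 ∷ []

  infixl 6 _⊕ᴱ_
  infixl 7 _⊗ᴱ_ _·ᴱ_
  _⊕ᴱ_ _⊗ᴱ_ : QuatE → QuatE → QuatE
  quatE x0 x1 x2 x3 ⊕ᴱ quatE y0 y1 y2 y3 =
      quatE (x0 +ᴱ y0) (x1 +ᴱ y1) (x2 +ᴱ y2) (x3 +ᴱ y3)
  quatE x0 x1 x2 x3 ⊗ᴱ quatE y0 y1 y2 y3 =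
      quatE (x0 *ᴱ y0 +ᴱ A *ᴱ (x1 *ᴱ y1) +ᴱ B *ᴱ (x2 *ᴱ y2)
              -ᴱ (A *ᴱ B) *ᴱ (x3 *ᴱ y3))
           (x0 *ᴱ y1 +ᴱ x1 *ᴱ y0 -ᴱ B *ᴱ (x2 *ᴱ y3) +ᴱ B *ᴱ (x3 *ᴱ y2))
           (x0 *ᴱ y2 +ᴱ x2 *ᴱ y0 +ᴱ A *ᴱ (x1 *ᴱ y3) -ᴱ A *ᴱ (x3 *ᴱ y1))
           (x0 *ᴱ y3 +ᴱ x3 *ᴱ y0 +ᴱ x1 *ᴱ y2 -ᴱ x2 *ᴱ y1)
  _·ᴱ_ : Scalar → QuatE → QuatE
  c ·ᴱ quatE x0 x1 x2 x3 = quatE (c *ᴱ x0) (c *ᴱ x1) (c *ᴱ x2) (c *ᴱ x3)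

  normQ : QuatE → Poly 16 × Poly 16 × Poly 16 × Poly 16
  normQ (quatE x0 x1 x2 x3) = Ops.norm x0 , Ops.norm x1 , Ops.norm x2 , Ops.norm x3

  valueQ : QuatE → Vec ℚ 16 → Quat
  valueQ (quatE x0 x1 x2 x3) ρ = quat (value x0 ρ) (value x1 ρ) (value x2 ρ) (value x3 ρ)

  solve : ∀ (e f : QuatE) → normQ e ≡ normQ f → ∀ ρ → valueQ e ρ ≡ valueQ f ρ
  solve e f eq ρ = quat-cong
    (scalar-solve (e0 e) (e0 f) (cong (λ { (p , _) → p }) eq) ρ)
    (scalar-solve (e1 e) (e1 f) (cong (λ { (_ , p , _) → p }) eq) ρ)
    (scalar-solve (e2 e) (e2 f) (cong (λ { (_ , _ , p , _) → p }) eq) ρ)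
    (scalar-solve (e3 e) (e3 f) (cong (λ { (_ , _ , _ , p) → p }) eq) ρ)

  oneᴱ zeroᴱ : QuatE
  oneᴱ  = quatE (Κ 1ℚ) (Κ 0ℚ) (Κ 0ℚ) (Κ 0ℚ)
  zeroᴱ = quatE (Κ 0ℚ) (Κ 0ℚ) (Κ 0ℚ) (Κ 0ℚ)

  conjᴱ : QuatE → QuatE
  conjᴱ (quatE x0 x1 x2 x3) = quatE x0 (-ᴱ x1) (-ᴱ x2) (-ᴱ x3)

  Tᴱ Nᴱ : QuatE → Scalar
  Tᴱ (quatE x0 _ _ _) = x0 +ᴱ x0
  Nᴱ (quatE x0 x1 x2 x3) =
    x0 *ᴱ x0 +ᴱ (-ᴱ A) *ᴱ (x1 *ᴱ x1) +ᴱ (-ᴱ B) *ᴱ (x2 *ᴱ x2) +ᴱ (A *ᴱ B) *ᴱ (x3 *ᴱ x3)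

conjugate : Quat → Quat
conjugate (quat x0 x1 x2 x3) = quat x0 (- x1) (- x2) (- x3)

trace : Quat → ℚ
trace x = q0 x + q0 x

_≟ᵠ_ : (x y : Quat) → Dec (x ≡ y)
quat x0 x1 x2 x3 ≟ᵠ quat y0 y1 y2 y3 =
  map′ (λ { (p , q , r , s) → quat-cong p q r s })
       (λ { refl → refl , refl , refl , refl })
       ((x0 QP.≟ y0) ×-dec (x1 QP.≟ y1) ×-dec (x2 QP.≟ y2) ×-dec (x3 QP.≟ y3))

module Laws (a b : ℚ) where
  open QA a b
  open QuaternionSolver

  N : Quat → ℚ
  N (quat x0 x1 x2 x3) =
    x0 * x0 + (- a) * (x1 * x1) + (- b) * (x2 * x2) + (a * b) * (x3 * x3)

  ⊝_ : Quat → Quat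
  ⊝ x = (- 1ℚ) ·ₛ x

  infixl 6 _⊖_
  _⊖_ : Quat → Quat → Quat
  x ⊖ y = x ⊕ ⊝ y

  private
    e₀ : Quat
    e₀ = zeroQ
    ⊝ᴱ_ : QuatE → QuatE
    ⊝ᴱ x = Κ (- 1ℚ) ·ᴱ x

  ⊕-assoc : ∀ x y z → (x ⊕ y) ⊕ z ≡ x ⊕ (y ⊕ z)
  ⊕-assoc x y z = solve ((X ⊕ᴱ Y) ⊕ᴱ Z) (X ⊕ᴱ (Y ⊕ᴱ Z)) refl (env a b 0ℚ 0ℚ x y z)

  ⊕-comm : ∀ x y → x ⊕ y ≡ y ⊕ x
  ⊕-comm x y = solve (X ⊕ᴱ Y) (Y ⊕ᴱ X) refl (env a b 0ℚ 0ℚ x y e₀)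

  ⊕-identityˡ : ∀ x → zeroQ ⊕ x ≡ x
  ⊕-identityˡ x = solve (zeroᴱ ⊕ᴱ X) X refl (env a b 0ℚ 0ℚ x e₀ e₀)

  ⊕-identityʳ : ∀ x → x ⊕ zeroQ ≡ x
  ⊕-identityʳ x = solve (X ⊕ᴱ zeroᴱ) X refl (env a b 0ℚ 0ℚ x e₀ e₀)

  ⊖-inverse : ∀ x → x ⊖ x ≡ zeroQ
  ⊖-inverse x = solve (X ⊕ᴱ (⊝ᴱ X)) zeroᴱ refl (env a b 0ℚ 0ℚ x e₀ e₀)

  ⊗-assoc : ∀ x y z → (x ⊗ y) ⊗ z ≡ x ⊗ (y ⊗ z)
  ⊗-assoc x y z = solve ((X ⊗ᴱ Y) ⊗ᴱ Z) (X ⊗ᴱ (Y ⊗ᴱ Z)) refl (env a b 0ℚ 0ℚ x y z)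

  ⊗-distribˡ : ∀ x y z → x ⊗ (y ⊕ z) ≡ x ⊗ y ⊕ x ⊗ z
  ⊗-distribˡ x y z = solve (X ⊗ᴱ (Y ⊕ᴱ Z)) (X ⊗ᴱ Y ⊕ᴱ X ⊗ᴱ Z) refl (env a b 0ℚ 0ℚ x y z)

  ⊗-distribʳ : ∀ x y z → (y ⊕ z) ⊗ x ≡ y ⊗ x ⊕ z ⊗ x
  ⊗-distribʳ x y z = solve ((Y ⊕ᴱ Z) ⊗ᴱ X) (Y ⊗ᴱ X ⊕ᴱ Z ⊗ᴱ X) refl (env a b 0ℚ 0ℚ x y z)

  ⊗-identityˡ : ∀ x → oneQ ⊗ x ≡ x
  ⊗-identityˡ x = solve (oneᴱ ⊗ᴱ X) X refl (env a b 0ℚ 0ℚ x e₀ e₀)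

  ⊗-identityʳ : ∀ x → x ⊗ oneQ ≡ x
  ⊗-identityʳ x = solve (X ⊗ᴱ oneᴱ) X refl (env a b 0ℚ 0ℚ x e₀ e₀)

  ⊗-zeroˡ : ∀ x → zeroQ ⊗ x ≡ zeroQ
  ⊗-zeroˡ x = solve (zeroᴱ ⊗ᴱ X) zeroᴱ refl (env a b 0ℚ 0ℚ x e₀ e₀)

  ⊗-zeroʳ : ∀ x → x ⊗ zeroQ ≡ zeroQ
  ⊗-zeroʳ x = solve (X ⊗ᴱ zeroᴱ) zeroᴱ refl (env a b 0ℚ 0ℚ x e₀ e₀)

  ·-identity : ∀ x → 1ℚ ·ₛ x ≡ x
  ·-identity x = solve (Κ 1ℚ ·ᴱ X) X refl (env a b 0ℚ 0ℚ x e₀ e₀)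

  ·-zeroˡ : ∀ x → 0ℚ ·ₛ x ≡ zeroQ
  ·-zeroˡ x = solve (Κ 0ℚ ·ᴱ X) zeroᴱ refl (env a b 0ℚ 0ℚ x e₀ e₀)

  ·-zeroʳ : ∀ s → s ·ₛ zeroQ ≡ zeroQ
  ·-zeroʳ s = solve (S ·ᴱ zeroᴱ) zeroᴱ refl (env a b s 0ℚ e₀ e₀ e₀)

  ·-distribˡ : ∀ s x y → s ·ₛ (x ⊕ y) ≡ s ·ₛ x ⊕ s ·ₛ y
  ·-distribˡ s x y = solve (S ·ᴱ (X ⊕ᴱ Y)) (S ·ᴱ X ⊕ᴱ S ·ᴱ Y) refl (env a b s 0ℚ x y e₀)

  ·-assoc : ∀ s t x → s ·ₛ (t ·ₛ x) ≡ (s * t) ·ₛ x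
  ·-assoc s t x = solve (S ·ᴱ (R ·ᴱ X)) ((S *ᴱ R) ·ᴱ X) refl (env a b s t x e₀ e₀)

  ·-⊗-assoc : ∀ s x y → (s ·ₛ x) ⊗ y ≡ s ·ₛ (x ⊗ y)
  ·-⊗-assoc s x y = solve ((S ·ᴱ X) ⊗ᴱ Y) (S ·ᴱ (X ⊗ᴱ Y)) refl (env a b s 0ℚ x y e₀)

  ·-⊗-comm : ∀ s x y → x ⊗ (s ·ₛ y) ≡ s ·ₛ (x ⊗ y)
  ·-⊗-comm s x y = solve (X ⊗ᴱ (S ·ᴱ Y)) (S ·ᴱ (X ⊗ᴱ Y)) refl (env a b s 0ℚ x y e₀)

  conj-inverseʳ : ∀ x → x ⊗ conjugate x ≡ N x ·ₛ oneQ
  conj-inverseʳ x = solve (X ⊗ᴱ conjᴱ X) (Nᴱ X ·ᴱ oneᴱ) refl (env a b 0ℚ 0ℚ x e₀ e₀)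

  conj-inverseˡ : ∀ x → conjugate x ⊗ x ≡ N x ·ₛ oneQ
  conj-inverseˡ x = solve (conjᴱ X ⊗ᴱ X) (Nᴱ X ·ᴱ oneᴱ) refl (env a b 0ℚ 0ℚ x e₀ e₀)

  N-mul : ∀ x y → N (x ⊗ y) ≡ N x * N y
  N-mul x y = scalar-solve (Nᴱ (X ⊗ᴱ Y)) (Nᴱ X *ᴱ Nᴱ Y) refl (env a b 0ℚ 0ℚ x y e₀)

  N-one : N oneQ ≡ 1ℚ
  N-one = scalar-solve (Nᴱ oneᴱ) (Κ 1ℚ) refl (env a b 0ℚ 0ℚ e₀ e₀ e₀)

  T-comm : ∀ x y → trace (x ⊗ y) ≡ trace (y ⊗ x)
  T-comm x y = scalar-solve (Tᴱ (X ⊗ᴱ Y)) (Tᴱ (Y ⊗ᴱ X)) refl (env a b 0ℚ 0ℚ x y e₀)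

  T-square : ∀ x → trace (x ⊗ x) ≡ trace x * trace x - (N x + N x)
  T-square x = scalar-solve (Tᴱ (X ⊗ᴱ X)) (Tᴱ X *ᴱ Tᴱ X -ᴱ (Nᴱ X +ᴱ Nᴱ X)) refl (env a b 0ℚ 0ℚ x e₀ e₀)

  T-⊕ : ∀ x y → trace (x ⊕ y) ≡ trace x + trace y
  T-⊕ x y = scalar-solve (Tᴱ (X ⊕ᴱ Y)) (Tᴱ X +ᴱ Tᴱ Y) refl (env a b 0ℚ 0ℚ x y e₀)

  T-· : ∀ s x → trace (s ·ₛ x) ≡ s * trace x
  T-· s x = scalar-solve (Tᴱ (S ·ᴱ X)) (S *ᴱ Tᴱ X) refl (env a b s 0ℚ x e₀ e₀)

  conj-T : ∀ x → x ⊕ conjugate x ≡ trace x ·ₛ oneQ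
  conj-T x = solve (X ⊕ᴱ conjᴱ X) (Tᴱ X ·ᴱ oneᴱ) refl (env a b 0ℚ 0ℚ x e₀ e₀)

  ·-distribʳ : ∀ s t x → (s + t) ·ₛ x ≡ s ·ₛ x ⊕ t ·ₛ x
  ·-distribʳ s t x = solve ((S +ᴱ R) ·ᴱ X) (S ·ᴱ X ⊕ᴱ R ·ᴱ X) refl (env a b s t x e₀ e₀)

  -- Bracketing with i leaves only the j- and k-coordinates of x, and bracketing with j only the i-
  -- and k-coordinates. A central element therefore has no pure part.
  commutator-i : ∀ x → x ⊗ quat 0ℚ 1ℚ 0ℚ 0ℚ ⊖ quat 0ℚ 1ℚ 0ℚ 0ℚ ⊗ x ≡ quat 0ℚ 0ℚ (- ((a + a) * q3 x)) (- (q2 x + q2 x))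
  commutator-i x = solve (X ⊗ᴱ iᴱ ⊕ᴱ (⊝ᴱ (iᴱ ⊗ᴱ X)))
    (quatE (Κ 0ℚ) (Κ 0ℚ) (-ᴱ ((A +ᴱ A) *ᴱ QuatE.e3 X)) (-ᴱ (QuatE.e2 X +ᴱ QuatE.e2 X))) refl (env a b 0ℚ 0ℚ x e₀ e₀)
    where iᴱ = quatE (Κ 0ℚ) (Κ 1ℚ) (Κ 0ℚ) (Κ 0ℚ)

  commutator-j : ∀ x → x ⊗ quat 0ℚ 0ℚ 1ℚ 0ℚ ⊖ quat 0ℚ 0ℚ 1ℚ 0ℚ ⊗ x ≡ quat 0ℚ ((b + b) * q3 x) 0ℚ (q1 x + q1 x)
  commutator-j x = solve (X ⊗ᴱ jᴱ ⊕ᴱ (⊝ᴱ (jᴱ ⊗ᴱ X)))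
    (quatE (Κ 0ℚ) ((B +ᴱ B) *ᴱ QuatE.e3 X) (Κ 0ℚ) (QuatE.e1 X +ᴱ QuatE.e1 X)) refl (env a b 0ℚ 0ℚ x e₀ e₀)
    where jᴱ = quatE (Κ 0ℚ) (Κ 0ℚ) (Κ 1ℚ) (Κ 0ℚ)

  -- Polarisation of x² - T(x) x + N(x) = 0, the bilinear form of N being T(x) T(y) - T(xy). Its use
  -- is that traceless elements with traceless product anticommute.
  polar : ∀ x y → x ⊗ y ⊕ y ⊗ x ≡ trace x ·ₛ y ⊕ trace y ·ₛ x ⊕ (trace (x ⊗ y) - trace x * trace y) ·ₛ oneQ
  polar x y = solve (X ⊗ᴱ Y ⊕ᴱ Y ⊗ᴱ X)
    (Tᴱ X ·ᴱ Y ⊕ᴱ Tᴱ Y ·ᴱ X ⊕ᴱ (Tᴱ (X ⊗ᴱ Y) -ᴱ Tᴱ X *ᴱ Tᴱ Y) ·ᴱ oneᴱ) refl (env a b 0ℚ 0ℚ x y e₀)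

-- Positivity in ℚ and definite quaternion algebras

sq-nonneg : ∀ x → 0ℚ ≤ x * x
sq-nonneg x with QP.≤-total 0ℚ x
... | inj₁ p = QP.nonNegative⁻¹ (x * x) {{QP.nonNeg*nonNeg⇒nonNeg x {{Q.nonNegative p}} x {{Q.nonNegative p}}}}
... | inj₂ p = QP.nonNegative⁻¹ (x * x) {{QP.nonPos*nonPos⇒nonPos x {{Q.nonPositive p}} x {{Q.nonPositive p}}}}

*-nonneg : ∀ x y → 0ℚ ≤ x → 0ℚ ≤ y → 0ℚ ≤ x * y
*-nonneg x y p q = QP.nonNegative⁻¹ (x * y) {{QP.nonNeg*nonNeg⇒nonNeg x {{Q.nonNegative p}} y {{Q.nonNegative q}}}}

+-nonneg : ∀ x y → 0ℚ ≤ x → 0ℚ ≤ y → 0ℚ ≤ x + y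
+-nonneg x y p q = QP.nonNegative⁻¹ (x + y) {{QP.nonNeg+nonNeg⇒nonNeg x {{Q.nonNegative p}} y {{Q.nonNegative q}}}}

x≤x+y : ∀ x y → 0ℚ ≤ y → x ≤ x + y
x≤x+y x y p = subst (_≤ x + y) (QP.+-identityʳ x) (QP.+-monoʳ-≤ x p)

nonneg-sum-zero : ∀ x y → 0ℚ ≤ x → 0ℚ ≤ y → x + y ≡ 0ℚ → x ≡ 0ℚ × y ≡ 0ℚ
nonneg-sum-zero x y p q e = x≡0 , trans (sym (QP.+-identityˡ y)) (trans (cong (_+ y) (sym x≡0)) e)
  where
  x≡0 : x ≡ 0ℚ
  x≡0 = QP.≤-antisym (subst (x ≤_) e (x≤x+y x y q)) p

abstract
  reciprocal : ∀ x → ¬ (x ≡ 0ℚ) → Σ ℚ λ y → y * x ≡ 1ℚ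
  reciprocal x x≢0 = (Q.1/ x) {{Q.≢-nonZero x≢0}} , QP.*-inverseˡ x {{Q.≢-nonZero x≢0}}

*-cancelˡ : ∀ r x y → ¬ (r ≡ 0ℚ) → r * x ≡ r * y → x ≡ y
*-cancelˡ r x y r≢0 e with reciprocal r r≢0
... | s , sr = trans (sym (undo x)) (trans (cong (s *_) e) (undo y))
  where
  undo : ∀ z → s * (r * z) ≡ z
  undo z = trans (sym (QP.*-assoc s r z)) (trans (cong (_* z) sr) (QP.*-identityˡ z))

+-cancelˡ : ∀ r x y → r + x ≡ r + y → x ≡ y
+-cancelˡ = Group.∙-cancelˡ QP.+-0-group

*-zero⇒ : ∀ x y → ¬ (x ≡ 0ℚ) → x * y ≡ 0ℚ → y ≡ 0ℚ
*-zero⇒ x y x≢0 e = *-cancelˡ x y 0ℚ x≢0 (trans e (sym (QP.*-zeroʳ x)))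

sq-zero⇒ : ∀ x → x * x ≡ 0ℚ → x ≡ 0ℚ
sq-zero⇒ x e with x QP.≟ 0ℚ
... | yes p = p
... | no  p = *-zero⇒ x x p e

pos⇒≢0 : ∀ x → 0ℚ < x → ¬ (x ≡ 0ℚ)
pos⇒≢0 x p refl = QP.<-irrefl refl p

scaled-sq-nonneg : ∀ c x → 0ℚ < c → 0ℚ ≤ c * (x * x)
scaled-sq-nonneg c x p = *-nonneg c (x * x) (QP.<⇒≤ p) (sq-nonneg x)

scaled-sq-zero⇒ : ∀ c x → 0ℚ < c → c * (x * x) ≡ 0ℚ → x ≡ 0ℚ
scaled-sq-zero⇒ c x p e = sq-zero⇒ x (*-zero⇒ c (x * x) (pos⇒≢0 c p) e)

double-zero⇒ : ∀ x → x + x ≡ 0ℚ → x ≡ 0ℚ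
double-zero⇒ x e = *-zero⇒ (1ℚ + 1ℚ) x (λ ())
  (trans (QP.*-distribʳ-+ x 1ℚ 1ℚ) (trans (cong₂ _+_ (QP.*-identityˡ x) (QP.*-identityˡ x)) e))

module _ (c d e : ℚ) (c>0 : 0ℚ < c) (d>0 : 0ℚ < d) (e>0 : 0ℚ < e) (x y z : ℚ) where

  diagonal-nonneg : 0ℚ ≤ c * (x * x) + d * (y * y) + e * (z * z)
  diagonal-nonneg = +-nonneg (c * (x * x) + d * (y * y)) (e * (z * z))
    (+-nonneg (c * (x * x)) (d * (y * y)) (scaled-sq-nonneg c x c>0) (scaled-sq-nonneg d y d>0))
    (scaled-sq-nonneg e z e>0)

  diagonal-zero⇒ : c * (x * x) + d * (y * y) + e * (z * z) ≡ 0ℚ → x ≡ 0ℚ × y ≡ 0ℚ × z ≡ 0ℚ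
  diagonal-zero⇒ eq with nonneg-sum-zero (c * (x * x) + d * (y * y)) (e * (z * z))
    (+-nonneg (c * (x * x)) (d * (y * y)) (scaled-sq-nonneg c x c>0) (scaled-sq-nonneg d y d>0))
    (scaled-sq-nonneg e z e>0) eq
  ... | p , q with nonneg-sum-zero (c * (x * x)) (d * (y * y))
                     (scaled-sq-nonneg c x c>0) (scaled-sq-nonneg d y d>0) p
  ... | r , s = scaled-sq-zero⇒ c x c>0 r , scaled-sq-zero⇒ d y d>0 s , scaled-sq-zero⇒ e z e>0 q

4ℚ : ℚ
4ℚ = 1ℚ + 1ℚ + (1ℚ + 1ℚ)

-- Rational arithmetic unfolds on open terms, so concrete quaternions are costly to compute with;
-- the argument is therefore carried out over this interface, where the operations stay neutral.
record DefiniteAlgebra : Set₁ where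
  infixl 6 _⊕_ _⊖_
  infixl 7 _⊗_ _·_
  field
    Carrier      : Set
    0# 1#        : Carrier
    _⊕_ _⊗_      : Carrier → Carrier → Carrier
    _·_          : ℚ → Carrier → Carrier
    conj         : Carrier → Carrier
    T N          : Carrier → ℚ
    _≟_          : (x y : Carrier) → Dec (x ≡ y)

  ⊝_ : Carrier → Carrier
  ⊝ x = (- 1ℚ) · x

  _⊖_ : Carrier → Carrier → Carrier
  x ⊖ y = x ⊕ ⊝ y

  field
    ⊕-assoc       : ∀ x y z → (x ⊕ y) ⊕ z ≡ x ⊕ (y ⊕ z)
    ⊕-comm        : ∀ x y → x ⊕ y ≡ y ⊕ x
    ⊕-identityˡ   : ∀ x → 0# ⊕ x ≡ x
    ⊕-identityʳ   : ∀ x → x ⊕ 0# ≡ x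
    ⊖-inverse     : ∀ x → x ⊖ x ≡ 0#
    ⊗-assoc       : ∀ x y z → (x ⊗ y) ⊗ z ≡ x ⊗ (y ⊗ z)
    ⊗-distribˡ    : ∀ x y z → x ⊗ (y ⊕ z) ≡ x ⊗ y ⊕ x ⊗ z
    ⊗-distribʳ    : ∀ x y z → (y ⊕ z) ⊗ x ≡ y ⊗ x ⊕ z ⊗ x
    ⊗-identityˡ   : ∀ x → 1# ⊗ x ≡ x
    ⊗-identityʳ   : ∀ x → x ⊗ 1# ≡ x
    ⊗-zeroˡ       : ∀ x → 0# ⊗ x ≡ 0#
    ⊗-zeroʳ       : ∀ x → x ⊗ 0# ≡ 0#
    ·-identity    : ∀ x → 1ℚ · x ≡ x
    ·-zeroˡ       : ∀ x → 0ℚ · x ≡ 0#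
    ·-zeroʳ       : ∀ s → s · 0# ≡ 0#
    ·-distribˡ    : ∀ s x y → s · (x ⊕ y) ≡ s · x ⊕ s · y
    ·-distribʳ    : ∀ s t x → (s + t) · x ≡ s · x ⊕ t · x
    ·-assoc       : ∀ s t x → s · (t · x) ≡ (s * t) · x
    ·-⊗-assoc     : ∀ s x y → (s · x) ⊗ y ≡ s · (x ⊗ y)
    ·-⊗-comm      : ∀ s x y → x ⊗ (s · y) ≡ s · (x ⊗ y)
    conj-inverseʳ : ∀ x → x ⊗ conj x ≡ N x · 1#
    conj-inverseˡ : ∀ x → conj x ⊗ x ≡ N x · 1#
    conj-T        : ∀ x → x ⊕ conj x ≡ T x · 1#
    N-mul         : ∀ x y → N (x ⊗ y) ≡ N x * N y
    N-one         : N 1# ≡ 1ℚ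
    T-⊕           : ∀ x y → T (x ⊕ y) ≡ T x + T y
    T-·           : ∀ s x → T (s · x) ≡ s * T x
    T-one         : T 1# ≡ 1ℚ + 1ℚ
    T-comm        : ∀ x y → T (x ⊗ y) ≡ T (y ⊗ x)
    T-square      : ∀ x → T (x ⊗ x) ≡ T x * T x - (N x + N x)
    polar         : ∀ x y → x ⊗ y ⊕ y ⊗ x ≡ T x · y ⊕ T y · x ⊕ (T (x ⊗ y) - T x * T y) · 1#
    -- The fields from here to `T-extreme⇒` express that the norm form is positive definite: nonzero
    -- elements are invertible, and the discriminant T² - 4N of the characteristic polynomial is
    -- negative except on scalars, where it vanishes.
    N≥0           : ∀ x → 0ℚ ≤ N x
    N-zero⇒       : ∀ x → N x ≡ 0ℚ → x ≡ 0#
    T-bound       : ∀ x → T x * T x ≤ 4ℚ * N x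
    T-extreme⇒    : ∀ x → T x * T x ≡ 4ℚ * N x → Σ ℚ λ c → x ≡ c · 1#
    noncommutative : ¬ (∀ x y → x ⊗ y ≡ y ⊗ x)
    central⇒      : ∀ x → (∀ y → x ⊗ y ≡ y ⊗ x) → Σ ℚ λ c → x ≡ c · 1#

module Definite (a b : ℚ) (a<0 : a < 0ℚ) (b<0 : b < 0ℚ) where
  open QA a b
  open QuaternionSolver using (scalar-solve; env; Tᴱ; _*ᴱ_; Κ; X; module QuatE)
  open Laws a b

  -a>0 : 0ℚ < - a
  -a>0 = QP.neg-antimono-< a<0

  -b>0 : 0ℚ < - b
  -b>0 = QP.neg-antimono-< b<0

  ab>0 : 0ℚ < a * b
  ab>0 = QP.positive⁻¹ (a * b) {{QP.neg*neg⇒pos a {{Q.negative a<0}} b {{Q.negative b<0}}}}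

  pure-N : Quat → ℚ
  pure-N (quat _ x1 x2 x3) = (- a) * (x1 * x1) + (- b) * (x2 * x2) + (a * b) * (x3 * x3)

  N-split : ∀ x → N x ≡ q0 x * q0 x + pure-N x
  N-split (quat x0 x1 x2 x3) = regroup (x0 * x0) ((- a) * (x1 * x1)) ((- b) * (x2 * x2)) ((a * b) * (x3 * x3))
    where
    regroup : ∀ w x y z → w + x + y + z ≡ w + (x + y + z)
    regroup w x y z = trans (cong (_+ z) (QP.+-assoc w x y)) (QP.+-assoc w (x + y) z)

  pure-N≥0 : ∀ x → 0ℚ ≤ pure-N x
  pure-N≥0 (quat _ x1 x2 x3) = diagonal-nonneg (- a) (- b) (a * b) -a>0 -b>0 ab>0 x1 x2 x3

  pure-N-zero⇒ : ∀ x → pure-N x ≡ 0ℚ → x ≡ q0 x ·ₛ oneQ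
  pure-N-zero⇒ (quat x0 x1 x2 x3) e with diagonal-zero⇒ (- a) (- b) (a * b) -a>0 -b>0 ab>0 x1 x2 x3 e
  ... | refl , refl , refl = quat-cong (sym (QP.*-identityʳ x0))
          (sym (QP.*-zeroʳ x0)) (sym (QP.*-zeroʳ x0)) (sym (QP.*-zeroʳ x0))

  N≥0 : ∀ x → 0ℚ ≤ N x
  N≥0 x = subst (0ℚ ≤_) (sym (N-split x)) (+-nonneg (q0 x * q0 x) (pure-N x) (sq-nonneg (q0 x)) (pure-N≥0 x))

  N-zero⇒ : ∀ x → N x ≡ 0ℚ → x ≡ zeroQ
  N-zero⇒ x e with nonneg-sum-zero (q0 x * q0 x) (pure-N x) (sq-nonneg (q0 x)) (pure-N≥0 x) (trans (sym (N-split x)) e)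
  ... | e0 , e' = trans (pure-N-zero⇒ x e') (trans (cong (_·ₛ oneQ) (sq-zero⇒ (q0 x) e0)) (·-zeroˡ oneQ))

  four-q0² : ∀ x → trace x * trace x ≡ 4ℚ * (q0 x * q0 x)
  four-q0² x = scalar-solve (Tᴱ X *ᴱ Tᴱ X) (Κ 4ℚ *ᴱ (QuatE.e0 X *ᴱ QuatE.e0 X)) refl (env a b 0ℚ 0ℚ x zeroQ zeroQ)

  -- As T² is four times the square of the real coordinate, the defect 4N - T² is four times the
  -- norm of the pure part.
  T-bound : ∀ x → trace x * trace x ≤ 4ℚ * N x
  T-bound x = subst₂ _≤_ (sym (four-q0² x)) (cong (4ℚ *_) (sym (N-split x)))
    (QP.*-monoˡ-≤-nonNeg 4ℚ (x≤x+y (q0 x * q0 x) (pure-N x) (pure-N≥0 x)))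

  T-extreme⇒ : ∀ x → trace x * trace x ≡ 4ℚ * N x → Σ ℚ λ c → x ≡ c ·ₛ oneQ
  T-extreme⇒ x e = q0 x , pure-N-zero⇒ x (+-cancelˡ (q0 x * q0 x) (pure-N x) 0ℚ
    (trans (sym (N-split x)) (trans (sym q0²) (sym (QP.+-identityʳ (q0 x * q0 x))))))
    where
    q0² : q0 x * q0 x ≡ N x
    q0² = *-cancelˡ 4ℚ (q0 x * q0 x) (N x) (λ ()) (trans (sym (four-q0² x)) e)

  central⇒ : ∀ x → (∀ y → x ⊗ y ≡ y ⊗ x) → Σ ℚ λ c → x ≡ c ·ₛ oneQ
  central⇒ x comm = q0 x , quat-cong
    (sym (QP.*-identityʳ (q0 x)))
    (trans (double-zero⇒ (q1 x) (cong q3 vanish-j)) (sym (QP.*-zeroʳ (q0 x))))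
    (trans (double-zero⇒ (q2 x) (neg-zero⇒ (q2 x + q2 x) (cong q3 vanish-i))) (sym (QP.*-zeroʳ (q0 x))))
    (trans (*-zero⇒ (b + b) (q3 x) 2b≢0 (cong q1 vanish-j)) (sym (QP.*-zeroʳ (q0 x))))
    where
    vanish : ∀ y → x ⊗ y ⊖ y ⊗ x ≡ zeroQ
    vanish y = trans (cong (_⊖ (y ⊗ x)) (comm y)) (⊖-inverse (y ⊗ x))
    vanish-i = trans (sym (commutator-i x)) (vanish (quat 0ℚ 1ℚ 0ℚ 0ℚ))
    vanish-j = trans (sym (commutator-j x)) (vanish (quat 0ℚ 0ℚ 1ℚ 0ℚ))
    neg-zero⇒ : ∀ s → - s ≡ 0ℚ → s ≡ 0ℚ
    neg-zero⇒ s e = QP.neg-injective e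
    2b≢0 : ¬ (b + b ≡ 0ℚ)
    2b≢0 e = QP.<-irrefl (double-zero⇒ b e) b<0

  noncommutative : ¬ (∀ x y → x ⊗ y ≡ y ⊗ x)
  -- The k-coordinates of ij and ji evaluate to 1 and -1, whatever a and b are.
  noncommutative comm with cong q3 (comm (quat 0ℚ 1ℚ 0ℚ 0ℚ) (quat 0ℚ 0ℚ 1ℚ 0ℚ))
  ... | ()

quaternions : (a b : ℚ) → a < 0ℚ → b < 0ℚ → DefiniteAlgebra
quaternions a b a<0 b<0 = record
  { QA a b using (_⊕_; _⊗_)
  ; Laws a b
  ; Definite a b a<0 b<0
  ; Carrier = Quat
  ; 0# = QA.zeroQ a b
  ; 1# = QA.oneQ a b
  ; _·_ = QA._·ₛ_ a b
  ; conj = conjugate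
  ; T = trace
  ; _≟_ = _≟ᵠ_
  ; T-one = refl
  }

-- Linear algebra over a definite quaternion algebra

module Division (𝔻 : DefiniteAlgebra) where
  open DefiniteAlgebra 𝔻

  ring : Ring 0ℓ 0ℓ
  ring = record
    { Carrier = Carrier ; _≈_ = _≡_ ; _+_ = _⊕_ ; _*_ = _⊗_ ; -_ = ⊝_ ; 0# = 0# ; 1# = 1#
    ; isRing = record
      { +-isAbelianGroup = record
        { isGroup = record
          { isMonoid = record
            { isSemigroup = record
              { isMagma = record { isEquivalence = isEquivalence ; ∙-cong = cong₂ _⊕_ }
              ; assoc = ⊕-assoc }
            ; identity = ⊕-identityˡ , ⊕-identityʳ }
          ; inverse = (λ x → trans (⊕-comm (⊝ x) x) (⊖-inverse x)) , ⊖-inverse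
          ; ⁻¹-cong = cong ⊝_ }
        ; comm = ⊕-comm }
      ; *-cong = cong₂ _⊗_
      ; *-assoc = ⊗-assoc
      ; *-identity = ⊗-identityˡ , ⊗-identityʳ
      ; distrib = ⊗-distribˡ , ⊗-distribʳ } }

  open RingProperties ring public using (-‿involutive; -‿distribˡ-*; -‿distribʳ-*)
    renaming (x∙y⁻¹≈ε⇒x≈y to ⊖≡0⇒≡; +-cancelʳ to ⊕-cancelʳ; +-cancelˡ to ⊕-cancelˡ)
  open CommutativeSemigroupProperties (Ring.+-commutativeSemigroup ring) public using (interchange)

  1≢0 : ¬ (1# ≡ 0#)
  1≢0 e with trans (sym T-one) (trans (cong T (trans e (sym (·-zeroˡ 1#)))) (trans (T-· 0ℚ 1#) (QP.*-zeroˡ (T 1#))))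
  ... | ()

  abstract
    inverse : ∀ {x} → ¬ (x ≡ 0#) → Σ Carrier λ y → (x ⊗ y ≡ 1#) × (y ⊗ x ≡ 1#)
    inverse {x} x≢0 with reciprocal (N x) (λ e → x≢0 (N-zero⇒ x e))
    ... | n , e = n · conj x ,
      trans (·-⊗-comm n x (conj x)) (trans (cong (n ·_) (conj-inverseʳ x)) scale) ,
      trans (·-⊗-assoc n (conj x) x) (trans (cong (n ·_) (conj-inverseˡ x)) scale)
      where
      scale : n · (N x · 1#) ≡ 1#
      scale = trans (·-assoc n (N x) 1#) (trans (cong (_· 1#) e) (·-identity 1#))

  ⊗-inverse-cancelˡ : ∀ {x y} z → x ⊗ y ≡ 1# → x ⊗ (y ⊗ z) ≡ z
  ⊗-inverse-cancelˡ {x} {y} z xy = trans (sym (⊗-assoc x y z)) (trans (cong (_⊗ z) xy) (⊗-identityˡ z))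

  ⊗-inverse-cancelʳ : ∀ {x y} z → x ⊗ y ≡ 1# → (z ⊗ x) ⊗ y ≡ z
  ⊗-inverse-cancelʳ {x} {y} z xy = trans (⊗-assoc z x y) (trans (cong (z ⊗_) xy) (⊗-identityʳ z))

  ⊗-cancelˡ : ∀ {x y z} → ¬ (x ≡ 0#) → x ⊗ y ≡ x ⊗ z → y ≡ z
  ⊗-cancelˡ {x} {y} {z} x≢0 e with inverse x≢0
  ... | w , _ , wx = trans (sym (⊗-inverse-cancelˡ y wx)) (trans (cong (w ⊗_) e) (⊗-inverse-cancelˡ z wx))

  ⊗-cancelʳ : ∀ {x y z} → ¬ (x ≡ 0#) → y ⊗ x ≡ z ⊗ x → y ≡ z
  ⊗-cancelʳ {x} {y} {z} x≢0 e with inverse x≢0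
  ... | w , xw , _ = trans (sym (⊗-inverse-cancelʳ y xw)) (trans (cong (_⊗ w) e) (⊗-inverse-cancelʳ z xw))

  ⊗-zero⇒ˡ : ∀ {x y} → ¬ (y ≡ 0#) → x ⊗ y ≡ 0# → x ≡ 0#
  ⊗-zero⇒ˡ {x} {y} y≢0 e = ⊗-cancelʳ y≢0 (trans e (sym (⊗-zeroˡ y)))

  ⊗-zero⇒ʳ : ∀ {x y} → ¬ (x ≡ 0#) → x ⊗ y ≡ 0# → y ≡ 0#
  ⊗-zero⇒ʳ {x} {y} x≢0 e = ⊗-cancelˡ x≢0 (trans e (sym (⊗-zeroʳ x)))

  ⊕-zero⇒ : ∀ {x y} → x ⊕ y ≡ 0# → y ≡ ⊝ x
  ⊕-zero⇒ {x} {y} e = ⊕-cancelˡ x y (⊝ x) (trans e (sym (⊖-inverse x)))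

  ⊖-cancel : ∀ x y → x ⊖ y ⊕ y ≡ x
  ⊖-cancel x y = trans (⊕-assoc x (⊝ y) y)
    (trans (cong (x ⊕_) (trans (⊕-comm (⊝ y) y) (⊖-inverse y))) (⊕-identityʳ x))

  ⊗-distribʳ-⊖ : ∀ x y z → (y ⊖ z) ⊗ x ≡ y ⊗ x ⊖ z ⊗ x
  ⊗-distribʳ-⊖ x y z = trans (⊗-distribʳ x y (⊝ z)) (cong (y ⊗ x ⊕_) (sym (-‿distribˡ-* z x)))

  ⊗-distribˡ-⊖ : ∀ x y z → x ⊗ (y ⊖ z) ≡ x ⊗ y ⊖ x ⊗ z
  ⊗-distribˡ-⊖ x y z = trans (⊗-distribˡ x y (⊝ z)) (cong (x ⊗ y ⊕_) (sym (-‿distribʳ-* x z)))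

  Row : Set
  Row = Carrier × Carrier

  0ᵣ : Row
  0ᵣ = 0# , 0#

  infixl 6 _⊕ᵣ_
  infixr 7 _·ₗ_
  _⊕ᵣ_ : Row → Row → Row
  (x , y) ⊕ᵣ (x' , y') = (x ⊕ x') , (y ⊕ y')

  _·ₗ_ : Carrier → Row → Row
  d ·ₗ (x , y) = (d ⊗ x) , (d ⊗ y)

  ⊕ᵣ-identityˡ : ∀ v → 0ᵣ ⊕ᵣ v ≡ v
  ⊕ᵣ-identityˡ (x , y) = cong₂ _,_ (⊕-identityˡ x) (⊕-identityˡ y)

  ⊕ᵣ-identityʳ : ∀ v → v ⊕ᵣ 0ᵣ ≡ v
  ⊕ᵣ-identityʳ (x , y) = cong₂ _,_ (⊕-identityʳ x) (⊕-identityʳ y)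

  ⊕ᵣ-interchange : ∀ t u v w → (t ⊕ᵣ u) ⊕ᵣ (v ⊕ᵣ w) ≡ (t ⊕ᵣ v) ⊕ᵣ (u ⊕ᵣ w)
  ⊕ᵣ-interchange (t , t') (u , u') (v , v') (w , w') = cong₂ _,_ (interchange t u v w) (interchange t' u' v' w')

  ·ₗ-zeroˡ : ∀ v → 0# ·ₗ v ≡ 0ᵣ
  ·ₗ-zeroˡ (x , y) = cong₂ _,_ (⊗-zeroˡ x) (⊗-zeroˡ y)

  ·ₗ-identity : ∀ v → 1# ·ₗ v ≡ v
  ·ₗ-identity (x , y) = cong₂ _,_ (⊗-identityˡ x) (⊗-identityˡ y)

  ·ₗ-assoc : ∀ d e v → (d ⊗ e) ·ₗ v ≡ d ·ₗ e ·ₗ v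
  ·ₗ-assoc d e (x , y) = cong₂ _,_ (⊗-assoc d e x) (⊗-assoc d e y)

  ·ₗ-distribʳ : ∀ v d e → (d ⊕ e) ·ₗ v ≡ d ·ₗ v ⊕ᵣ e ·ₗ v
  ·ₗ-distribʳ (x , y) d e = cong₂ _,_ (⊗-distribʳ x d e) (⊗-distribʳ y d e)

  ·ₗ-distribˡ : ∀ d v w → d ·ₗ (v ⊕ᵣ w) ≡ d ·ₗ v ⊕ᵣ d ·ₗ w
  ·ₗ-distribˡ d (x , y) (x' , y') = cong₂ _,_ (⊗-distribˡ d x x') (⊗-distribˡ d y y')

  comb : Row → Row → Carrier → Carrier → Row
  comb u₀ u₁ x y = x ·ₗ u₀ ⊕ᵣ y ·ₗ u₁

  comb-⊕ : ∀ u₀ u₁ x y x' y' → comb u₀ u₁ x y ⊕ᵣ comb u₀ u₁ x' y' ≡ comb u₀ u₁ (x ⊕ x') (y ⊕ y')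
  comb-⊕ u₀ u₁ x y x' y' = trans (⊕ᵣ-interchange (x ·ₗ u₀) (y ·ₗ u₁) (x' ·ₗ u₀) (y' ·ₗ u₁))
    (sym (cong₂ _⊕ᵣ_ (·ₗ-distribʳ u₀ x x') (·ₗ-distribʳ u₁ y y')))

  comb-· : ∀ u₀ u₁ d x y → d ·ₗ comb u₀ u₁ x y ≡ comb u₀ u₁ (d ⊗ x) (d ⊗ y)
  comb-· u₀ u₁ d x y = trans (·ₗ-distribˡ d (x ·ₗ u₀) (y ·ₗ u₁))
    (sym (cong₂ _⊕ᵣ_ (·ₗ-assoc d x u₀) (·ₗ-assoc d y u₁)))

  comb-fst : ∀ u₀ u₁ x → comb u₀ u₁ x 0# ≡ x ·ₗ u₀
  comb-fst u₀ u₁ x = trans (cong (x ·ₗ u₀ ⊕ᵣ_) (·ₗ-zeroˡ u₁)) (⊕ᵣ-identityʳ (x ·ₗ u₀))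

  comb-snd : ∀ u₀ u₁ y → comb u₀ u₁ 0# y ≡ y ·ₗ u₁
  comb-snd u₀ u₁ y = trans (cong (_⊕ᵣ y ·ₗ u₁) (·ₗ-zeroˡ u₀)) (⊕ᵣ-identityˡ (y ·ₗ u₁))

  Independent : Row → Row → Set
  Independent u₀ u₁ = ∀ x y → comb u₀ u₁ x y ≡ 0ᵣ → x ≡ 0# × y ≡ 0#

  Spanning : Row → Row → Set
  Spanning u₀ u₁ = ∀ v → Σ Carrier λ x → Σ Carrier λ y → v ≡ comb u₀ u₁ x y

  scaled : ∀ {u₀ u₁ d} → ¬ (d ≡ 0#) → Independent u₀ u₁ → Independent u₀ (d ·ₗ u₁)
  scaled {u₀} {u₁} {d} d≢0 ind x y e with ind x (y ⊗ d) (trans (cong (x ·ₗ u₀ ⊕ᵣ_) (·ₗ-assoc y d u₁)) e)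
  ... | x≡0 , yd≡0 = x≡0 , ⊗-zero⇒ˡ d≢0 yd≡0

  module Pivot (p q r s P : Carrier) (Pp : P ⊗ p ≡ 1#) where
    -- Schur complement of the pivot p. Scalars act on rows from the left, so p⁻¹ must stand between
    -- r and q.
    schur : Carrier
    schur = s ⊖ (r ⊗ P) ⊗ q

    -- The left combination of the two rows with coefficients -rP and 1 is (0, `schur`); if `schur`
    -- vanished this would be a dependence with second coefficient 1.
    schur≢0 : Independent (p , q) (r , s) → ¬ (schur ≡ 0#)
    schur≢0 ind e = 1≢0 (proj₂ (ind (⊝ (r ⊗ P)) 1# (cong₂ _,_ first second)))
      where
      first : ⊝ (r ⊗ P) ⊗ p ⊕ 1# ⊗ r ≡ 0#
      first = trans (cong₂ _⊕_ (trans (sym (-‿distribˡ-* (r ⊗ P) p)) (cong ⊝_ (⊗-inverse-cancelʳ r Pp))) (⊗-identityˡ r))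
        (trans (⊕-comm (⊝ r) r) (⊖-inverse r))
      second : ⊝ (r ⊗ P) ⊗ q ⊕ 1# ⊗ s ≡ 0#
      second = trans (cong₂ _⊕_ (sym (-‿distribˡ-* (r ⊗ P) q)) (⊗-identityˡ s))
        (trans (⊕-comm (⊝ ((r ⊗ P) ⊗ q)) s) e)

    -- Back substitution: the first column forces x = (X - e r) P, and inserting this in the second
    -- leaves e times `schur` equal to Y - X P q.
    solution : ∀ t → t ⊗ schur ≡ 1# → Spanning (p , q) (r , s)
    solution t t-inv (X , Y) = (X ⊖ e ⊗ r) ⊗ P , e , cong₂ _,_ (sym first) (sym second)
      where
      XPq = (X ⊗ P) ⊗ q
      e = (Y ⊖ XPq) ⊗ t
      first : (X ⊖ e ⊗ r) ⊗ P ⊗ p ⊕ e ⊗ r ≡ X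
      first = trans (cong (_⊕ e ⊗ r) (⊗-inverse-cancelʳ (X ⊖ e ⊗ r) Pp)) (⊖-cancel X (e ⊗ r))
      expand : (X ⊖ e ⊗ r) ⊗ P ⊗ q ≡ XPq ⊖ e ⊗ ((r ⊗ P) ⊗ q)
      expand = trans (cong (_⊗ q) (⊗-distribʳ-⊖ P X (e ⊗ r)))
        (trans (⊗-distribʳ-⊖ q (X ⊗ P) ((e ⊗ r) ⊗ P))
          (cong (XPq ⊖_) (trans (cong (_⊗ q) (⊗-assoc e r P)) (⊗-assoc e (r ⊗ P) q))))
      second : (X ⊖ e ⊗ r) ⊗ P ⊗ q ⊕ e ⊗ s ≡ Y
      second =
        trans (cong (_⊕ e ⊗ s) expand)
        (trans (⊕-assoc XPq (⊝ (e ⊗ ((r ⊗ P) ⊗ q))) (e ⊗ s))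
        (trans (cong (XPq ⊕_) (trans (⊕-comm (⊝ (e ⊗ ((r ⊗ P) ⊗ q))) (e ⊗ s)) (sym (⊗-distribˡ-⊖ e s ((r ⊗ P) ⊗ q)))))
        (trans (cong (XPq ⊕_) (⊗-inverse-cancelʳ {t} {schur} (Y ⊖ XPq) t-inv))
        (trans (⊕-comm XPq (Y ⊖ XPq)) (⊖-cancel Y XPq)))))

  abstract
    spanning-pivot : ∀ p q r s → ¬ (p ≡ 0#) → Independent (p , q) (r , s) → Spanning (p , q) (r , s)
    spanning-pivot p q r s p≢0 ind = solve-with (inverse p≢0)
      where
      solve-with : (Σ Carrier λ P → (p ⊗ P ≡ 1#) × (P ⊗ p ≡ 1#)) → Spanning (p , q) (r , s)
      solve-with (P , _ , Pp) = let t , _ , t-inv = inverse (schur≢0 ind) in solution t t-inv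
        where open Pivot p q r s P Pp

  Independent-swap : ∀ {p q r s} → Independent (p , q) (r , s) → Independent (q , p) (s , r)
  Independent-swap ind x y e = ind x y (cong swap e)

  Spanning-swap : ∀ {p q r s} → Spanning (q , p) (s , r) → Spanning (p , q) (r , s)
  Spanning-swap span (x , y) with span (y , x)
  ... | c , d , e = c , d , cong swap e

  abstract
    -- Independence makes the first row nonzero, so one of its entries can serve as pivot;
    -- exchanging the columns moves it to the front if necessary.
    independent⇒spanning : ∀ u₀ u₁ → Independent u₀ u₁ → Spanning u₀ u₁
    independent⇒spanning (p , q) (r , s) ind with p ≟ 0#
    ... | no p≢0 = spanning-pivot p q r s p≢0 ind
    ... | yes p≡0 = Spanning-swap (spanning-pivot q p s r q≢0 (Independent-swap ind))
      where
      q≢0 : ¬ (q ≡ 0#)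
      q≢0 q≡0 = 1≢0 (proj₁ (ind 1# 0# (trans (comb-fst (p , q) (r , s) 1#)
        (trans (·ₗ-identity (p , q)) (cong₂ _,_ p≡0 q≡0)))))

  nonzero-row : ∀ {d v} → ¬ (v ≡ 0ᵣ) → d ·ₗ v ≡ 0ᵣ → d ≡ 0#
  nonzero-row {d} {x , y} v≢0 e with x ≟ 0# | y ≟ 0#
  ... | no x≢0  | _        = ⊗-zero⇒ˡ x≢0 (cong proj₁ e)
  ... | yes _   | no y≢0   = ⊗-zero⇒ˡ y≢0 (cong proj₂ e)
  ... | yes x≡0 | yes y≡0  = ⊥-elim (v≢0 (cong₂ _,_ x≡0 y≡0))

-- Takes the place of excluded middle: G and H are lists, so a failed search yields the negative
-- alternative for all their elements.
search : {X : Set} {A B : X → Set} (xs : List X) → (∀ x → x ∈ xs → A x ⊎ B x) →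
  (Σ X λ x → x ∈ xs × A x) ⊎ (∀ x → x ∈ xs → B x)
search [] _ = inj₂ λ _ ()
search (x ∷ xs) dec with dec x (here refl) | search xs (λ y y∈ → dec y (there y∈))
... | inj₁ a | _                  = inj₁ (x , here refl , a)
... | inj₂ _ | inj₁ (y , y∈ , a)  = inj₁ (y , there y∈ , a)
... | inj₂ b | inj₂ all           = inj₂ λ { _ (here refl) → b ; y (there y∈) → all y y∈ }

module _ (𝔻 : DefiniteAlgebra) where
  open DefiniteAlgebra 𝔻
  open Division 𝔻

  module Basis (u₀ u₁ : Row) (ind : Independent u₀ u₁) where

    span : Spanning u₀ u₁
    span = independent⇒spanning u₀ u₁ ind

    comb-zero : comb u₀ u₁ 0# 0# ≡ 0ᵣ
    comb-zero = trans (comb-fst u₀ u₁ 0#) (·ₗ-zeroˡ u₀)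

    unique : ∀ {x y x' y'} → comb u₀ u₁ x y ≡ comb u₀ u₁ x' y' → x ≡ x' × y ≡ y'
    unique {x} {y} {x'} {y'} e = ⊖≡0⇒≡ x x' (proj₁ zeros) , ⊖≡0⇒≡ y y' (proj₂ zeros)
      where
      zeros = ind (x ⊖ x') (y ⊖ y')
        (trans (sym (comb-⊕ u₀ u₁ x y (⊝ x') (⊝ y')))
        (trans (cong (_⊕ᵣ comb u₀ u₁ (⊝ x') (⊝ y')) e)
        (trans (comb-⊕ u₀ u₁ x' y' (⊝ x') (⊝ y'))
        (trans (cong₂ (comb u₀ u₁) (⊖-inverse x') (⊖-inverse y')) comb-zero))))

    u₁≢·u₀ : ∀ d → ¬ (u₁ ≡ d ·ₗ u₀)
    u₁≢·u₀ d e = 1≢0 (proj₂ (unique (trans (trans (comb-snd u₀ u₁ 1#) (·ₗ-identity u₁)) (trans e (sym (comb-fst u₀ u₁ d))))))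

-- Matrices are visible only through their right action on rows. Faithfulness (`act-ext`) reduces
-- equations between matrices to two rows, and `act-rows` supplies a matrix with any prescribed
-- rows.
record MatrixAlgebra (𝔻 : DefiniteAlgebra) : Set₁ where
  open DefiniteAlgebra 𝔻
  open Division 𝔻
  infixl 7 _∘_ _·ᵣ_
  field
    M        : Set
    1ₘ       : M
    _∘_      : M → M → M
    _·ᵣ_     : Row → M → Row
    act-⊕    : ∀ v w m → (v ⊕ᵣ w) ·ᵣ m ≡ v ·ᵣ m ⊕ᵣ w ·ᵣ m
    act-·    : ∀ d v m → (d ·ₗ v) ·ᵣ m ≡ d ·ₗ (v ·ᵣ m)
    act-∘    : ∀ v m n → v ·ᵣ (m ∘ n) ≡ v ·ᵣ m ·ᵣ n
    act-1    : ∀ v → v ·ᵣ 1ₘ ≡ v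
    act-ext  : ∀ m n → (∀ v → v ·ᵣ m ≡ v ·ᵣ n) → m ≡ n
    act-rows : ∀ r₁ r₂ → Σ M λ m → ∀ x y → (x , y) ·ᵣ m ≡ comb r₁ r₂ x y

  comb-act : ∀ u₀ u₁ x y m → comb u₀ u₁ x y ·ᵣ m ≡ comb (u₀ ·ᵣ m) (u₁ ·ᵣ m) x y
  comb-act u₀ u₁ x y m = trans (act-⊕ (x ·ₗ u₀) (y ·ₗ u₁) m) (cong₂ _⊕ᵣ_ (act-· x u₀ m) (act-· y u₁ m))

module _ (𝔻 : DefiniteAlgebra) (𝕄 : MatrixAlgebra 𝔻) where
  open DefiniteAlgebra 𝔻
  open Division 𝔻
  open MatrixAlgebra 𝕄

  module Transform (u₀ u₁ : Row) (ind : Independent u₀ u₁) where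
    open Basis 𝔻 u₀ u₁ ind

    matrix-ext : ∀ {m n} → u₀ ·ᵣ m ≡ u₀ ·ᵣ n → u₁ ·ᵣ m ≡ u₁ ·ᵣ n → m ≡ n
    matrix-ext {m} {n} e₀ e₁ = act-ext m n λ v → via v (span v)
      where
      via : ∀ v → (Σ Carrier λ x → Σ Carrier λ y → v ≡ comb u₀ u₁ x y) → v ·ᵣ m ≡ v ·ᵣ n
      via _ (x , y , refl) = trans (comb-act u₀ u₁ x y m)
        (trans (cong₂ (λ a b → comb a b x y) e₀ e₁) (sym (comb-act u₀ u₁ x y n)))

    abstract
      -- The standard rows have coordinates (α₁, β₁) and (α₂, β₂) in the basis u₀, u₁. The matrix
      -- whose rows have the same coordinates with respect to w₀, w₁ takes each uᵢ to wᵢ, since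
      -- coordinates in a basis are unique.
      images : ∀ w₀ w₁ → Σ M λ m → u₀ ·ᵣ m ≡ w₀ × u₁ ·ᵣ m ≡ w₁
      images w₀ w₁ = m ,
        trans (act-comb u₀ 1# 0# (sym (trans (comb-fst u₀ u₁ 1#) (·ₗ-identity u₀)))) (trans (comb-fst w₀ w₁ 1#) (·ₗ-identity w₀)) ,
        trans (act-comb u₁ 0# 1# (sym (trans (comb-snd u₀ u₁ 1#) (·ₗ-identity u₁)))) (trans (comb-snd w₀ w₁ 1#) (·ₗ-identity w₁))
        where
        α₁ β₁ α₂ β₂ : Carrier
        α₁ = proj₁ (span (1# , 0#))
        β₁ = proj₁ (proj₂ (span (1# , 0#)))
        α₂ = proj₁ (span (0# , 1#))
        β₂ = proj₁ (proj₂ (span (0# , 1#)))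
        m : M
        m = proj₁ (act-rows (comb w₀ w₁ α₁ β₁) (comb w₀ w₁ α₂ β₂))
        combine : ∀ v₀ v₁ x y → comb (comb v₀ v₁ α₁ β₁) (comb v₀ v₁ α₂ β₂) x y
          ≡ comb v₀ v₁ (x ⊗ α₁ ⊕ y ⊗ α₂) (x ⊗ β₁ ⊕ y ⊗ β₂)
        combine v₀ v₁ x y = trans (cong₂ _⊕ᵣ_ (comb-· v₀ v₁ x α₁ β₁) (comb-· v₀ v₁ y α₂ β₂))
          (comb-⊕ v₀ v₁ (x ⊗ α₁) (x ⊗ β₁) (y ⊗ α₂) (y ⊗ β₂))
        standard : ∀ x y → (x , y) ≡ comb (1# , 0#) (0# , 1#) x y
        standard x y = cong₂ _,_
          (sym (trans (cong₂ _⊕_ (⊗-identityʳ x) (⊗-zeroʳ y)) (⊕-identityʳ x)))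
          (sym (trans (cong₂ _⊕_ (⊗-zeroʳ x) (⊗-identityʳ y)) (⊕-identityˡ y)))
        act-comb : ∀ v x y → v ≡ comb u₀ u₁ x y → v ·ᵣ m ≡ comb w₀ w₁ x y
        act-comb (X , Y) x y e =
          trans (proj₂ (act-rows (comb w₀ w₁ α₁ β₁) (comb w₀ w₁ α₂ β₂)) X Y)
          (trans (combine w₀ w₁ X Y) (cong₂ (comb w₀ w₁) (sym (proj₁ coords)) (sym (proj₂ coords))))
          where
          coords : x ≡ X ⊗ α₁ ⊕ Y ⊗ α₂ × y ≡ X ⊗ β₁ ⊕ Y ⊗ β₂
          coords = unique (trans (sym e) (trans (standard X Y) (trans
            (cong₂ (λ a b → comb a b X Y) (proj₂ (proj₂ (span (1# , 0#)))) (proj₂ (proj₂ (span (0# , 1#)))))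
            (combine u₀ u₁ X Y))))

-- Monomial matrix groups

record IsGroup {X : Set} (_∙_ : X → X → X) (e : X) (G : List X) : Set where
  field
    one∈ : e ∈ G
    mul∈ : ∀ {g h} → g ∈ G → h ∈ G → (g ∙ h) ∈ G
    inv∈ : ∀ {g} → g ∈ G → Σ X λ h → h ∈ G × (g ∙ h ≡ e) × (h ∙ g ≡ e)

module _ (𝔻 : DefiniteAlgebra) where
  open DefiniteAlgebra 𝔻

  record IsRationalSubspace (W : Carrier → Set) : Set where
    field
      zero∈  : W 0#
      add∈   : ∀ {x y} → W x → W y → W (x ⊕ y)
      scale∈ : ∀ c {x} → W x → W (c · x)

  -- The span is encoded by its universal property. Every application is an induction over the span,
  -- so coefficient lists never appear.
  Spans : List Carrier → Set₁
  Spans H = ∀ (W : Carrier → Set) → IsRationalSubspace W → (∀ {h} → h ∈ H → W h) → ∀ x → W x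

  open Division 𝔻

  _·ᵠ_ : ℚ → Row → Row
  c ·ᵠ (x , y) = (c · x) , (c · y)

  ·ᵠ-·ₗ : ∀ c x v → c ·ᵠ (x ·ₗ v) ≡ (c · x) ·ₗ v
  ·ᵠ-·ₗ c x (v , w) = sym (cong₂ _,_ (·-⊗-assoc c x v) (·-⊗-assoc c x w))

  ·ᵠ-⊕ : ∀ c v w → c ·ᵠ (v ⊕ᵣ w) ≡ (c ·ᵠ v) ⊕ᵣ (c ·ᵠ w)
  ·ᵠ-⊕ c (x , y) (x' , y') = cong₂ _,_ (·-distribˡ c x x') (·-distribˡ c y y')

  record IsRowSubspace (W : Row → Set) : Set where
    field
      zero∈  : W 0ᵣ
      add∈   : ∀ {v w} → W v → W w → W (v ⊕ᵣ w)
      scale∈ : ∀ c {v} → W v → W (c ·ᵠ v)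

module _ (𝔻 : DefiniteAlgebra) (𝕄 : MatrixAlgebra 𝔻) where
  open DefiniteAlgebra 𝔻
  open Division 𝔻
  open MatrixAlgebra 𝕄

  module Monomial
    (G : List M) (isGroup : IsGroup _∘_ 1ₘ G)
    (irreducible : ∀ W → IsRowSubspace 𝔻 W → ∀ v → (∀ {g} → g ∈ G → W (v ·ᵣ g)) → ∀ m → W (v ·ᵣ m)) where
    open IsGroup isGroup

    -- If no element of G moved the line through v₀, that line would be invariant under all matrices.
    abstract
      moving : ∀ v₀ v₁ → Independent v₀ v₁ →
        (∀ g → g ∈ G → (Σ Carrier λ d → v₀ ·ᵣ g ≡ d ·ₗ v₁) ⊎ (Σ Carrier λ d → v₀ ·ᵣ g ≡ d ·ₗ v₀)) →
        Σ M λ τ → τ ∈ G × Σ Carrier λ d → v₀ ·ᵣ τ ≡ d ·ₗ v₁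
      moving v₀ v₁ ind lines with search G lines
      ... | inj₁ found = found
      ... | inj₂ fixed = ⊥-elim (Basis.u₁≢·u₀ 𝔻 v₀ v₁ ind (proj₁ line) (trans (sym (proj₁ (proj₂ τ))) (proj₂ line)))
        where
        Line : Row → Set
        Line w = Σ Carrier λ d → w ≡ d ·ₗ v₀
        subspace : IsRowSubspace 𝔻 Line
        subspace = record
          { zero∈  = 0# , sym (·ₗ-zeroˡ v₀)
          ; add∈   = λ { (d , refl) (e , refl) → d ⊕ e , sym (·ₗ-distribʳ v₀ d e) }
          ; scale∈ = λ { c (d , refl) → c · d , ·ᵠ-·ₗ 𝔻 c d v₀ }
          }
        τ : Σ M λ m → v₀ ·ᵣ m ≡ v₁ × v₁ ·ᵣ m ≡ v₀
        τ = Transform.images 𝔻 𝕄 v₀ v₁ ind v₁ v₀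
        line : Line (v₀ ·ᵣ proj₁ τ)
        line = irreducible Line subspace v₀ (λ {g} g∈ → fixed g g∈) (proj₁ τ)

    module Coefficients (u₀ u₁ : Row) (ind : Independent u₀ u₁) (τ : M) (τ∈ : τ ∈ G) (u₁≡ : u₁ ≡ u₀ ·ᵣ τ)
      (lines : ∀ {g} → g ∈ G → (Σ Carrier λ d → u₀ ·ᵣ g ≡ d ·ₗ u₀) ⊎ (Σ Carrier λ d → u₀ ·ᵣ g ≡ d ·ₗ u₁))
      where
      open Basis 𝔻 u₀ u₁ ind

      -- One of the two coordinates of u₀ g vanishes, so the sum is the other one.
      coefficient : M → Carrier
      coefficient g = proj₁ (span (u₀ ·ᵣ g)) ⊕ proj₁ (proj₂ (span (u₀ ·ᵣ g)))

      coefficient-fst : ∀ {g d} → u₀ ·ᵣ g ≡ d ·ₗ u₀ → coefficient g ≡ d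
      coefficient-fst {g} {d} e = trans (cong₂ _⊕_ (proj₁ coords) (proj₂ coords)) (⊕-identityʳ d)
        where
        coords = unique (trans (sym (proj₂ (proj₂ (span (u₀ ·ᵣ g))))) (trans e (sym (comb-fst u₀ u₁ d))))

      coefficient-snd : ∀ {g d} → u₀ ·ᵣ g ≡ d ·ₗ u₁ → coefficient g ≡ d
      coefficient-snd {g} {d} e = trans (cong₂ _⊕_ (proj₁ coords) (proj₂ coords)) (⊕-identityˡ d)
        where
        coords = unique (trans (sym (proj₂ (proj₂ (span (u₀ ·ᵣ g))))) (trans e (sym (comb-snd u₀ u₁ d))))

      -- Coefficients are collected from all of G, including the elements that move the line of u₀;
      -- by `untwist` these contribute no scalar beyond those of the stabiliser of the line.
      H : List Carrier
      H = map coefficient G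

      InH : Carrier → Set
      InH d = Σ M λ g → g ∈ G × u₀ ·ᵣ g ≡ d ·ₗ u₀

      InH⇒∈ : ∀ {d} → InH d → d ∈ H
      InH⇒∈ (g , g∈ , e) = subst (_∈ H) (coefficient-fst e) (∈-map⁺ coefficient g∈)

      inverse-act : ∀ v g h w d → g ∘ h ≡ 1ₘ → v ·ᵣ g ≡ d ·ₗ w → v ≡ d ·ₗ (w ·ᵣ h)
      inverse-act v g h w d gh e = trans (sym (act-1 v)) (trans (cong (v ·ᵣ_) (sym gh))
        (trans (act-∘ v g h) (trans (cong (_·ᵣ h) e) (act-· d w h))))

      act-σ : ∀ {σ w g d} → τ ∘ σ ≡ 1ₘ → w ·ᵣ g ≡ d ·ₗ u₁ → w ·ᵣ (g ∘ σ) ≡ d ·ₗ u₀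
      act-σ {σ} {w} {g} {d} τσ e = trans (act-∘ w g σ) (trans (cong (_·ᵣ σ) e) (trans (act-· d u₁ σ)
        (cong (d ·ₗ_) (trans (cong (_·ᵣ σ) u₁≡) (trans (sym (act-∘ u₀ τ σ)) (trans (cong (u₀ ·ᵣ_) τσ) (act-1 u₀)))))))

      -- Multiplication by τ⁻¹ carries u₁ = u₀ τ back to u₀ and leaves the coefficient unchanged.
      -- This is the reason for choosing u₁ as an image of u₀.
      untwist : ∀ {g d} → g ∈ G → u₀ ·ᵣ g ≡ d ·ₗ u₁ → InH d
      untwist {g} g∈ e with inv∈ τ∈
      ... | σ , σ∈ , τσ , _ = g ∘ σ , mul∈ g∈ σ∈ , act-σ τσ e

      ∈⇒InH : ∀ {d} → d ∈ H → InH d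
      ∈⇒InH d∈ with ∈-map⁻ coefficient d∈
      ... | g , g∈ , refl with lines g∈
      ... | inj₁ (d , e) = g , g∈ , trans e (cong (_·ₗ u₀) (sym (coefficient-fst e)))
      ... | inj₂ (d , e) = subst InH (sym (coefficient-snd e)) (untwist g∈ e)

      one-InH : InH 1#
      one-InH = 1ₘ , one∈ , trans (act-1 u₀) (sym (·ₗ-identity u₀))

      mul-InH : ∀ {x y} → InH x → InH y → InH (x ⊗ y)
      mul-InH {x} {y} (g , g∈ , eg) (h , h∈ , eh) = g ∘ h , mul∈ g∈ h∈ ,
        trans (act-∘ u₀ g h) (trans (cong (_·ᵣ h) eg) (trans (act-· x u₀ h)
          (trans (cong (x ·ₗ_) eh) (sym (·ₗ-assoc x y u₀)))))

      inverse-line : ∀ {g h x z} → g ∘ h ≡ 1ₘ → z ⊗ x ≡ 1# → u₀ ·ᵣ g ≡ x ·ₗ u₀ → u₀ ·ᵣ h ≡ z ·ₗ u₀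
      inverse-line {g} {h} {x} {z} gh zx e = trans (sym (·ₗ-identity (u₀ ·ᵣ h))) (trans (cong (_·ₗ (u₀ ·ᵣ h)) (sym zx))
        (trans (·ₗ-assoc z x (u₀ ·ᵣ h)) (cong (z ·ₗ_) (sym (inverse-act u₀ g h u₀ x gh e)))))

      ·u₀-injective : ∀ {x y} → x ·ₗ u₀ ≡ y ·ₗ u₀ → x ≡ y
      ·u₀-injective {x} {y} e = proj₁ (unique (trans (comb-fst u₀ u₁ x) (trans e (sym (comb-fst u₀ u₁ y)))))

      inv-InH : ∀ {x} → InH x → Σ Carrier λ y → InH y × (x ⊗ y ≡ 1#) × (y ⊗ x ≡ 1#)
      inv-InH {x} (g , g∈ , eg) with inverse x≢0 | inv∈ g∈
        where
        x≢0 : ¬ (x ≡ 0#)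
        x≢0 refl with inv∈ g∈
        ... | h , _ , gh , _ = 1≢0 (·u₀-injective (trans (·ₗ-identity u₀)
          (trans (inverse-act u₀ g h u₀ 0# gh eg) (trans (·ₗ-zeroˡ (u₀ ·ᵣ h)) (sym (·ₗ-zeroˡ u₀))))))
      ... | y , xy , yx | h , h∈ , gh , _ = y , (h , h∈ , inverse-line gh yx eg) , xy , yx

      H-isGroup : IsGroup _⊗_ 1# H
      H-isGroup = record
        { one∈ = InH⇒∈ one-InH
        ; mul∈ = λ x∈ y∈ → InH⇒∈ (mul-InH (∈⇒InH x∈) (∈⇒InH y∈))
        ; inv∈ = λ x∈ → let y , y∈ , e = inv-InH (∈⇒InH x∈) in y , InH⇒∈ y∈ , e
        }

      -- The row u₁ g is u₀ (τ g), so the hypothesis on u₀ also controls u₁.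
      lines₁ : ∀ {g} → g ∈ G → (Σ Carrier λ d → u₁ ·ᵣ g ≡ d ·ₗ u₀) ⊎ (Σ Carrier λ d → u₁ ·ᵣ g ≡ d ·ₗ u₁)
      lines₁ {g} g∈ = subst (λ w → (Σ Carrier λ d → w ≡ d ·ₗ u₀) ⊎ (Σ Carrier λ d → w ≡ d ·ₗ u₁)) u₁g (lines (mul∈ τ∈ g∈))
        where
        u₁g : u₀ ·ᵣ (τ ∘ g) ≡ u₁ ·ᵣ g
        u₁g = trans (act-∘ u₀ τ g) (cong (_·ᵣ g) (sym u₁≡))

      -- If g took both basis rows to the line of u₀, then g⁻¹, which preserves that line, would
      -- show u₁ to be a multiple of u₀.
      not-both : ∀ {g x y} → g ∈ G → u₀ ·ᵣ g ≡ x ·ₗ u₀ → ¬ (u₁ ·ᵣ g ≡ y ·ₗ u₀)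
      not-both {g} {x} {y} g∈ e₀ e₁ with inv∈ g∈ | inv-InH (g , g∈ , e₀)
      ... | h , _ , gh , _ | z , _ , _ , zx = u₁≢·u₀ (y ⊗ z) (trans (inverse-act u₁ g h u₀ y gh e₁)
        (trans (cong (y ·ₗ_) (inverse-line gh zx e₀)) (sym (·ₗ-assoc y z u₀))))

      twist : M → Row → Row → Set
      twist g w₀ w₁ = Σ Carrier λ x → Σ Carrier λ y → x ∈ H × y ∈ H × u₀ ·ᵣ g ≡ x ·ₗ w₀ × u₁ ·ᵣ g ≡ y ·ₗ w₁

      u₀τ· : ∀ {g v} → u₁ ·ᵣ g ≡ v → u₀ ·ᵣ (τ ∘ g) ≡ v
      u₀τ· {g} e = trans (act-∘ u₀ τ g) (trans (cong (_·ᵣ g) (sym u₁≡)) e)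

      monomial : ∀ {g} → g ∈ G → twist g u₀ u₁ ⊎ twist g u₁ u₀
      monomial {g} g∈ with lines g∈ | lines₁ g∈
      ... | inj₁ (x , e₀) | inj₁ (y , e₁) = ⊥-elim (not-both g∈ e₀ e₁)
      ... | inj₁ (x , e₀) | inj₂ (y , e₁) =
        inj₁ (x , y , InH⇒∈ (g , g∈ , e₀) , InH⇒∈ (untwist (mul∈ τ∈ g∈) (u₀τ· e₁)) , e₀ , e₁)
      ... | inj₂ (x , e₀) | inj₁ (y , e₁) =
        inj₂ (x , y , InH⇒∈ (untwist g∈ e₀) , InH⇒∈ (τ ∘ g , mul∈ τ∈ g∈ , u₀τ· e₁) , e₀ , e₁)
      -- Both rows land in the line of u₁; following g by τ⁻¹ puts them both in the line of u₀, the
      -- case already excluded.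
      ... | inj₂ (x , e₀) | inj₂ (y , e₁) with inv∈ τ∈
      ... | σ , σ∈ , τσ , _ = ⊥-elim (not-both (mul∈ g∈ σ∈) (act-σ τσ e₀) (act-σ τσ e₁))

      -- The rows whose u₀-coordinate lies in W form a rational subspace containing u₀ g for every g
      -- in G: the coordinate is in H or zero. By irreducibility it contains u₀ m for every matrix
      -- m, in particular for one with u₀ m = d u₀.
      H-spans : Spans 𝔻 H
      H-spans W subspace H⊆W d = conclude (irreducible W₀ W₀-subspace u₀ generators (proj₁ m))
        where
        open IsRationalSubspace subspace
        W₀ : Row → Set
        W₀ v = Σ Carrier λ x → Σ Carrier λ y → v ≡ comb u₀ u₁ x y × W x
        W₀-subspace : IsRowSubspace 𝔻 W₀
        W₀-subspace = record
          { zero∈  = 0# , 0# , sym comb-zero , zero∈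
          ; add∈   = λ { (x , y , refl , Wx) (x' , y' , refl , Wx') →
              x ⊕ x' , y ⊕ y' , comb-⊕ u₀ u₁ x y x' y' , add∈ Wx Wx' }
          ; scale∈ = λ { c (x , y , refl , Wx) → c · x , c · y ,
              trans (·ᵠ-⊕ 𝔻 c (x ·ₗ u₀) (y ·ₗ u₁)) (cong₂ _⊕ᵣ_ (·ᵠ-·ₗ 𝔻 c x u₀) (·ᵠ-·ₗ 𝔻 c y u₁)) , scale∈ c Wx }
          }
        generators : ∀ {g} → g ∈ G → W₀ (u₀ ·ᵣ g)
        generators {g} g∈ with lines g∈
        ... | inj₁ (x , e) = x , 0# , trans e (sym (comb-fst u₀ u₁ x)) , H⊆W (InH⇒∈ (g , g∈ , e))
        ... | inj₂ (y , e) = 0# , y , trans e (sym (comb-snd u₀ u₁ y)) , zero∈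
        m = Transform.images 𝔻 𝕄 u₀ u₁ ind (d ·ₗ u₀) u₁
        conclude : W₀ (u₀ ·ᵣ proj₁ m) → W d
        conclude (x , y , e , Wx) = subst W (proj₁ (unique (trans (sym e)
          (trans (proj₁ (proj₂ m)) (sym (comb-fst u₀ u₁ d)))))) Wx

2ℚ : ℚ
2ℚ = 1ℚ + 1ℚ

-- Integrality of reduced traces

-- Cancelling the factor p twice gives q ∣ d. Dividing the equation by q leaves one of the same
-- shape for the quotient j, and cancelling twice again gives q ∣ j.
square-divides : ∀ p q d .{{_ : ℕ.NonZero q}} → Coprime q p → q ℕ.* q ∣ (p ℕ.* p) ℕ.* d → q ℕ.* q ∣ d
square-divides p q d c (divides k e)
  with coprime-divisor c (coprime-divisor c (divides (k ℕ.* q)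
    (trans (sym (ℕP.*-assoc p p d)) (trans e (sym (ℕP.*-assoc k q q))))))
... | divides j refl with coprime-divisor c (coprime-divisor c (divides k step))
  where
  step : p ℕ.* (p ℕ.* j) ≡ k ℕ.* q
  step = ℕP.*-cancelʳ-≡ (p ℕ.* (p ℕ.* j)) (k ℕ.* q) q
    (trans (ℕP.*-assoc p (p ℕ.* j) q) (trans (cong (p ℕ.*_) (ℕP.*-assoc p j q))
    (trans (sym (ℕP.*-assoc p p (j ℕ.* q))) (trans e (sym (ℕP.*-assoc k q q))))))
... | divides i refl = divides i (ℕP.*-assoc i q q)

-- With t = p/q in lowest terms and s = u/d, clearing denominators gives p² d = (u + 2d) q², to
-- which `square-divides` applies.
square-denominator : ∀ t s → t * t ≡ s + 2ℚ → ↧ₙ t ℕ.* ↧ₙ t ∣ ↧ₙ s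
square-denominator t@(mkℚ p q-1 c) s@(mkℚ u d-1 _) e =
  square-divides ∣ p ∣ q d (Coprimality.sym (Coprimality.recompute c)) (divides (∣ r ∣) cross)
  where
  q d : ℕ
  q = suc q-1
  d = suc d-1
  r : ℤ
  r = u ℤ.* ℤ.+ 1 ℤ.+ ℤ.+ 2 ℤ.* ℤ.+ d
  unnormalised : toℚᵘ t ℚᵘ.* toℚᵘ t ℚᵘ.≃ toℚᵘ s ℚᵘ.+ toℚᵘ 2ℚ
  unnormalised = ℚᵘP.≃-trans (ℚᵘP.≃-sym (QP.toℚᵘ-homo-* t t)) (ℚᵘP.≃-trans (QP.toℚᵘ-cong e) (QP.toℚᵘ-homo-+ s 2ℚ))
  cross : ∣ p ∣ ℕ.* ∣ p ∣ ℕ.* d ≡ ∣ r ∣ ℕ.* (q ℕ.* q)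
  cross with unnormalised
  ... | ℚᵘ.*≡* eq = begin
    ∣ p ∣ ℕ.* ∣ p ∣ ℕ.* d              ≡⟨ cong₂ ℕ._*_ (sym (ℤP.abs-* p p)) (sym (ℕP.*-identityʳ d)) ⟩
    ∣ p ℤ.* p ∣ ℕ.* (d ℕ.* 1)          ≡⟨ sym (ℤP.abs-* (p ℤ.* p) (ℤ.+ (d ℕ.* 1))) ⟩
    ∣ p ℤ.* p ℤ.* ℤ.+ (d ℕ.* 1) ∣        ≡⟨ cong ∣_∣ eq ⟩
    ∣ r ℤ.* ℤ.+ (q ℕ.* q) ∣              ≡⟨ ℤP.abs-* r (ℤ.+ (q ℕ.* q)) ⟩
    ∣ r ∣ ℕ.* (q ℕ.* q)                ∎
    where open ≡-Reasoning

self-square≤⇒1 : ∀ n .{{_ : ℕ.NonZero n}} → n ℕ.* n ℕ.≤ n → n ≡ 1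
self-square≤⇒1 1 _ = refl
self-square≤⇒1 (suc (suc n)) le = ⊥-elim (ℕP.<⇒≱ (ℕP.m<m*n (suc (suc n)) (suc (suc n)) (s≤s (s≤s z≤n))) le)

small : Fin 5 → ℚ
small 0F = 0ℚ
small 1F = 1ℚ
small 2F = - 1ℚ
small 3F = 2ℚ
small 4F = - 2ℚ

-- The index in `Fin 5` allows quadruples of traces to be enumerated later.
Small : ℚ → Set
Small t = Σ (Fin 5) λ i → t ≡ small i

private
  large-square : ∀ t → 2ℚ < t → t * t ≤ 2ℚ * 2ℚ → ⊥
  large-square t 2<t le = QP.<-irrefl refl (QP.<-≤-trans (QP.<-≤-trans (QP.*-monoʳ-<-pos 2ℚ 2<t)
    (QP.*-monoʳ-≤-nonNeg t {{Q.nonNegative (QP.≤-trans (QP.nonNegative⁻¹ 2ℚ) (QP.<⇒≤ 2<t))}} (QP.<⇒≤ 2<t))) le)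

integer⇒small : ∀ t → ↧ₙ t ≡ 1 → t * t ≤ 2ℚ * 2ℚ → Small t
integer⇒small (mkℚ (ℤ.+ 0) 0 _) refl _ = 0F , refl
integer⇒small (mkℚ (ℤ.+ 1) 0 _) refl _ = 1F , refl
integer⇒small (mkℚ (ℤ.+ 2) 0 _) refl _ = 3F , refl
integer⇒small (mkℚ -[1+ 0 ] 0 _) refl _ = 2F , refl
integer⇒small (mkℚ -[1+ 1 ] 0 _) refl _ = 4F , refl
integer⇒small t@(mkℚ (ℤ.+ suc (suc (suc n))) 0 _) refl le =
  ⊥-elim (large-square t (Q.*<* (ℤ.+<+ (s≤s (s≤s (s≤s z≤n))))) le)
integer⇒small t@(mkℚ -[1+ suc (suc n) ] 0 c) refl le =
  ⊥-elim (large-square (- t) (Q.*<* (ℤ.+<+ (s≤s (s≤s (s≤s z≤n))))) (subst (_≤ 2ℚ * 2ℚ) negs le))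
  where
  negs : t * t ≡ (- t) * (- t)
  negs = trans (sym (Group.⁻¹-involutive QP.+-0-group (t * t))) (trans (cong -_ (QP.neg-distribˡ-* t t)) (QP.neg-distribʳ-* (- t) t))

maximum : (O : TotalOrder 0ℓ 0ℓ 0ℓ) {X : Set} (f : X → TotalOrder.Carrier O) {xs : List X} {e : X} → e ∈ xs →
  Σ X λ m → m ∈ xs × (∀ {x} → x ∈ xs → TotalOrder._≤_ O (f x) (f m))
maximum O f {xs} {e} e∈ with argmax-sel O f e xs
... | inj₁ eq = e , e∈ , λ x∈ → subst (λ m → TotalOrder._≤_ O _ (f m)) eq (All.lookup (f[xs]≤f[argmax] O e xs) x∈)
... | inj₂ m∈ = argmax O f e xs , m∈ , All.lookup (f[xs]≤f[argmax] O e xs)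

+-shift : ∀ x y z → x + y ≡ z → x ≡ z - y
+-shift x y z refl = sym (trans (QP.+-assoc x y (- y)) (trans (cong (x +_) (QP.+-inverseʳ y)) (QP.+-identityʳ x)))

module _ (𝔻 : DefiniteAlgebra) where
  open DefiniteAlgebra 𝔻
  open Division 𝔻

  module FiniteGroup (H : List Carrier)
    (isGroup : IsGroup _⊗_ 1# H) (spans : Spans 𝔻 H) where
    open IsGroup isGroup

    -- For m of maximal norm, N(h) N(m) = N(hm) ≤ N(m), and N(m) ≥ N(1) = 1 can be cancelled.
    -- Applied to the inverse as well, this forces N(h) = 1.
    N≤1 : ∀ {h} → h ∈ H → N h ≤ 1ℚ
    N≤1 {h} h∈ with maximum (DecTotalOrder.totalOrder QP.≤-decTotalOrder) N one∈
    ... | m , m∈ , max = QP.*-cancelʳ-≤-pos (N m) {{Q.positive N>0}}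
      (subst₂ _≤_ (N-mul h m) (sym (QP.*-identityˡ (N m))) (max (mul∈ h∈ m∈)))
      where
      N>0 : 0ℚ < N m
      N>0 = QP.<-≤-trans (QP.positive⁻¹ 1ℚ) (subst (_≤ N m) N-one (max one∈))

    N≡1 : ∀ {h} → h ∈ H → N h ≡ 1ℚ
    N≡1 {h} h∈ with inv∈ h∈
    ... | y , y∈ , hy , _ = QP.≤-antisym (N≤1 h∈) (subst₂ _≤_
      (trans (sym (N-mul h y)) (trans (cong N hy) N-one)) (QP.*-identityʳ (N h))
      (QP.*-monoˡ-≤-nonNeg (N h) {{Q.nonNegative (N≥0 h)}} (N≤1 y∈)))

    T-square-H : ∀ {h} → h ∈ H → T (h ⊗ h) ≡ T h * T h - 2ℚ
    T-square-H {h} h∈ = trans (T-square h) (cong (λ n → T h * T h - (n + n)) (N≡1 h∈))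

    -- Squaring an element squares the denominator of its trace.
    T-integral : ∀ {h} → h ∈ H → ↧ₙ (T h) ≡ 1
    T-integral {h} h∈ with maximum ℕP.≤-totalOrder (λ x → ↧ₙ (T x)) one∈
    ... | m , m∈ , max = ℕP.≤-antisym (subst (↧ₙ (T h) ℕ.≤_) den≡1 (max h∈)) (ℕ.s≤s ℕ.z≤n)
      where
      square : T m * T m ≡ T (m ⊗ m) + 2ℚ
      square = trans (sym (restore (T m * T m) 2ℚ)) (cong (_+ 2ℚ) (sym (T-square-H m∈)))
        where
        restore : ∀ x y → x - y + y ≡ x
        restore x y = trans (QP.+-assoc x (- y) y) (trans (cong (x +_) (QP.+-inverseˡ y)) (QP.+-identityʳ x))
      den≡1 : ↧ₙ (T m) ≡ 1
      den≡1 = self-square≤⇒1 (↧ₙ (T m))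
        (ℕP.≤-trans (∣⇒≤ (square-denominator (T m) (T (m ⊗ m)) square)) (max (mul∈ m∈ m∈)))

    abstract
      T-small : ∀ {h} → h ∈ H → Small (T h)
      T-small {h} h∈ = integer⇒small (T h) (T-integral h∈)
        (subst (T h * T h ≤_) (cong (4ℚ *_) (N≡1 h∈)) (T-bound h))

    Scalar# : Carrier → Set
    Scalar# x = Σ ℚ λ c → x ≡ c · 1#

    scalar-comm : ∀ {x} → Scalar# x → ∀ y → x ⊗ y ≡ y ⊗ x
    scalar-comm (c , refl) y = trans (·-⊗-assoc c 1# y) (trans (cong (c ·_) (trans (⊗-identityˡ y) (sym (⊗-identityʳ y))))
      (sym (·-⊗-comm c y 1#)))

    abstract
      extreme⇒scalar : ∀ {h} → h ∈ H → T h * T h ≡ 4ℚ → Scalar# h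
      extreme⇒scalar {h} h∈ e = T-extreme⇒ h (trans e (cong (4ℚ *_) (sym (N≡1 h∈))))

    -- For h = c the two equations compare traces in c h = h² and in h = c. Together they give c² =
    -- 1, so only the traces 2 and -2 are compatible with being a scalar.
    scalar-trace : ∀ {h} → h ∈ H → ((c , _) : Scalar# h) → c * T h ≡ T h * T h - 2ℚ × T h ≡ c * 2ℚ
    scalar-trace {h} h∈ (c , e) = trans (sym (T-· c h)) (trans (cong T square) (T-square-H h∈)) ,
      trans (cong T e) (trans (T-· c 1#) (cong (c *_) T-one))
      where
      square : c · h ≡ h ⊗ h
      square = trans (cong (c ·_) (sym (⊗-identityˡ h))) (trans (sym (·-⊗-assoc c 1# h)) (cong (_⊗ h) (sym e)))

    abstract
      nonscalar-0 : ∀ {h} → h ∈ H → T h ≡ 0ℚ → ¬ Scalar# h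
      nonscalar-0 {h} h∈ t s@(c , _) with trans (sym (QP.*-zeroʳ c)) (subst (λ t → c * t ≡ t * t - 2ℚ) t (proj₁ (scalar-trace h∈ s)))
      ... | ()

    abstract
      nonscalar-−1 : ∀ {h} → h ∈ H → T h ≡ - 1ℚ → ¬ Scalar# h
      nonscalar-−1 {h} h∈ t s@(c , _) with trans (sym t) (trans (proj₂ (scalar-trace h∈ s)) (cong (_* 2ℚ) c≡1))
        where
        c≡1 : c ≡ 1ℚ
        c≡1 = *-cancelˡ (- 1ℚ) c 1ℚ (λ ()) (trans (QP.*-comm (- 1ℚ) c)
          (subst (λ t → c * t ≡ t * t - 2ℚ) t (proj₁ (scalar-trace h∈ s))))
      ... | ()

    abstract
      -- The centraliser of x is a rational subspace; if it contained H it would be all of 𝒟, and x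
      -- would be central, hence scalar.
      noncommuting : ∀ x → ¬ Scalar# x → Σ Carrier λ h → h ∈ H × ¬ (h ⊗ x ≡ x ⊗ h)
      noncommuting x nonscalar with search {A = λ h → ¬ (h ⊗ x ≡ x ⊗ h)} {B = λ h → x ⊗ h ≡ h ⊗ x} H decide
        where
        decide : ∀ h → h ∈ H → (¬ (h ⊗ x ≡ x ⊗ h)) ⊎ (x ⊗ h ≡ h ⊗ x)
        decide h _ with (h ⊗ x) ≟ (x ⊗ h)
        ... | yes e = inj₂ (sym e)
        ... | no ne = inj₁ ne
      ... | inj₁ found = found
      ... | inj₂ comm = ⊥-elim (nonscalar (central⇒ x (spans (λ y → x ⊗ y ≡ y ⊗ x) centralizer (λ {h} h∈ → comm h h∈))))
        where
        centralizer : IsRationalSubspace 𝔻 (λ y → x ⊗ y ≡ y ⊗ x)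
        centralizer = record
          { zero∈  = trans (⊗-zeroʳ x) (sym (⊗-zeroˡ x))
          ; add∈   = λ {y} {z} p q → trans (⊗-distribˡ x y z) (trans (cong₂ _⊕_ p q) (sym (⊗-distribʳ x y z)))
          ; scale∈ = λ c {y} p → trans (·-⊗-comm c x y) (trans (cong (c ·_) p) (sym (·-⊗-assoc c y x)))
          }

    conj-inverse : ∀ {h} → h ∈ H → h ⊗ conj h ≡ 1# × conj h ⊗ h ≡ 1#
    conj-inverse {h} h∈ = trans (conj-inverseʳ h) scale , trans (conj-inverseˡ h) scale
      where
      scale : N h · 1# ≡ 1#
      scale = trans (cong (_· 1#) (N≡1 h∈)) (·-identity 1#)

    nonzero : ∀ {h} → h ∈ H → ¬ (h ≡ 0#)
    nonzero h∈ refl = 1≢0 (trans (sym (proj₁ (conj-inverse h∈))) (⊗-zeroˡ (conj 0#)))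

    abstract
      conj∈ : ∀ {h} → h ∈ H → conj h ∈ H
      conj∈ {h} h∈ with inv∈ h∈
      ... | y , y∈ , hy , _ = subst (_∈ H) (⊗-cancelˡ (nonzero h∈) (trans hy (sym (proj₁ (conj-inverse h∈))))) y∈

    -- Traces alone describe both cases. For elements of norm 1, trace 0 means x² = -1 and trace -1
    -- means x² + x + 1 = 0; by `polar` the last condition amounts to ij = -ji in the first case and
    -- to bω = ω̄b in the second.
    data Generators : Set where
      lipschitz : ∀ i j → i ∈ H → j ∈ H → T i ≡ 0ℚ → T j ≡ 0ℚ → T (i ⊗ j) ≡ 0ℚ → Generators
      dicyclic  : ∀ b ω → b ∈ H → ω ∈ H → T b ≡ 0ℚ → T ω ≡ - 1ℚ → T (b ⊗ ω) ≡ 0ℚ → Generators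

    module NoOrderThree (traces : ∀ h → h ∈ H → Scalar# h ⊎ T h ≡ 0ℚ) where

      generators : Generators
      generators with search {A = λ h → T h ≡ 0ℚ} {B = Scalar#} H (λ h h∈ → Sum.swap (traces h h∈))
      -- If H consisted of scalars, its span 𝒟 would be commutative.
      ... | inj₂ scalars = ⊥-elim (noncommutative λ x → scalar-comm (spans Scalar# subspace (λ {h} h∈ → scalars h h∈) x))
        where
        subspace : IsRationalSubspace 𝔻 Scalar#
        subspace = record
          { zero∈  = 0ℚ , sym (·-zeroˡ 1#)
          ; add∈   = λ { (c , refl) (d , refl) → c + d , sym (·-distribʳ c d 1#) }
          ; scale∈ = λ { c (d , refl) → c * d , ·-assoc c d 1# }
          }
      ... | inj₁ (i , i∈ , Ti) with noncommuting i (nonscalar-0 i∈ Ti)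
      ... | j , j∈ , ji≢ij with traces j j∈ | traces (i ⊗ j) (mul∈ i∈ j∈)
      ... | inj₁ s  | _        = ⊥-elim (ji≢ij (scalar-comm s i))
      ... | inj₂ Tj | inj₂ Tij = lipschitz i j i∈ j∈ Ti Tj Tij
      -- A scalar ij commutes with i; cancelling i from i(ji) = i(ij) contradicts the choice of j.
      ... | inj₂ _  | inj₁ s   = ⊥-elim (ji≢ij (⊗-cancelˡ (nonzero i∈)
        (trans (sym (⊗-assoc i j i)) (scalar-comm s i))))

    module OrderThree (ω : Carrier) (ω∈ : ω ∈ H) (Tω : T ω ≡ - 1ℚ) where

      Moved : Carrier → Set
      Moved x = x ∈ H × ¬ (x ⊗ ω ≡ ω ⊗ x)

      moved-ω : ∀ {x} → Moved x → Moved (x ⊗ ω)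
      moved-ω {x} (x∈ , ne) = mul∈ x∈ ω∈ , λ e → ne (⊗-cancelʳ (nonzero ω∈) (trans e (sym (⊗-assoc ω x ω))))

      abstract
        -- Trace 2 or -2 would make x a scalar, which commutes with ω. Moved elements thus have
        -- trace 0, 1 or -1.
        moved-trace : ∀ {x} → Moved x → ¬ (T x * T x ≡ 4ℚ)
        moved-trace (x∈ , ne) e = ne (scalar-comm (extreme⇒scalar x∈ e) ω)

      ω+conj : ω ⊕ conj ω ≡ ⊝ 1#
      ω+conj = trans (conj-T ω) (cong (_· 1#) Tω)

      ω²+1 : ω ⊗ ω ⊕ 1# ≡ ⊝ ω
      ω²+1 = trans (cong (ω ⊗ ω ⊕_) (sym (proj₁ (conj-inverse ω∈)))) (trans (sym (⊗-distribˡ ω ω (conj ω)))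
        (trans (cong (ω ⊗_) ω+conj) (trans (·-⊗-comm (- 1ℚ) ω 1#) (cong ⊝_ (⊗-identityʳ ω)))))

      T-cycle : ∀ x → T (x ⊗ ω ⊗ ω) + T x ≡ - 1ℚ * T (x ⊗ ω)
      T-cycle x = trans (sym (T-⊕ (x ⊗ ω ⊗ ω) x)) (trans (cong T expand) (T-· (- 1ℚ) (x ⊗ ω)))
        where
        expand : x ⊗ ω ⊗ ω ⊕ x ≡ ⊝ (x ⊗ ω)
        expand = trans (cong₂ _⊕_ (⊗-assoc x ω ω) (sym (⊗-identityʳ x))) (trans (sym (⊗-distribˡ x (ω ⊗ ω) 1#))
          (trans (cong (x ⊗_) ω²+1) (·-⊗-comm (- 1ℚ) x ω)))

      T-conj : ∀ x → T (x ⊗ conj ω) + T (x ⊗ ω) ≡ - 1ℚ * T x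
      T-conj x = trans (sym (T-⊕ (x ⊗ conj ω) (x ⊗ ω))) (trans (cong T expand) (T-· (- 1ℚ) x))
        where
        expand : x ⊗ conj ω ⊕ x ⊗ ω ≡ ⊝ x
        expand = trans (sym (⊗-distribˡ x (conj ω) ω)) (trans (cong (x ⊗_) (trans (⊕-comm (conj ω) ω) ω+conj))
          (trans (·-⊗-comm (- 1ℚ) x 1#) (cong ⊝_ (⊗-identityʳ x))))

      third-trace : ∀ {x s t} → T x ≡ s → T (x ⊗ ω) ≡ t → T (x ⊗ ω ⊗ ω) ≡ - 1ℚ * t - s
      third-trace {x} refl refl = +-shift (T (x ⊗ ω ⊗ ω)) (T x) (- 1ℚ * T (x ⊗ ω)) (T-cycle x)

      -- The traces of g, g ω and g ω² add up to zero and none of them is ± 2, so one of them is zero.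
      abstract
        traceless : ∀ {g} → Moved g → Σ Carrier λ b → Moved b × T b ≡ 0ℚ
        traceless {g} mg with T-small (proj₁ mg) | T-small (proj₁ (moved-ω mg))
        ... | 0F , s | _      = g , mg , s
        ... | 3F , s | _      = ⊥-elim (moved-trace mg (cong (λ t → t * t) s))
        ... | 4F , s | _      = ⊥-elim (moved-trace mg (cong (λ t → t * t) s))
        ... | _      | 0F , t = g ⊗ ω , moved-ω mg , t
        ... | _      | 3F , t = ⊥-elim (moved-trace (moved-ω mg) (cong (λ t → t * t) t))
        ... | _      | 4F , t = ⊥-elim (moved-trace (moved-ω mg) (cong (λ t → t * t) t))
        ... | 1F , s | 1F , t = ⊥-elim (moved-trace (moved-ω (moved-ω mg)) (cong (λ t → t * t) (third-trace s t)))
        ... | 2F , s | 2F , t = ⊥-elim (moved-trace (moved-ω (moved-ω mg)) (cong (λ t → t * t) (third-trace s t)))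
        ... | 1F , s | 2F , t = g ⊗ ω ⊗ ω , moved-ω (moved-ω mg) , third-trace s t
        ... | 2F , s | 1F , t = g ⊗ ω ⊗ ω , moved-ω (moved-ω mg) , third-trace s t

      -- As in the binary tetrahedral group, conjugation by an element of order three rotates i to
      -- another of the units i, j, k up to sign, so j = ωbω̄ is the candidate. With y = bωb one has
      -- T(y) = T(b²ω) = -T(ω) = 1 and T(yω) = T(bω)² - 2 = -1, hence T(bj) = T(yω̄) = -T(y) - T(yω)
      -- = 0.
      rotate : ∀ b → b ∈ H → T b ≡ 0ℚ → T (b ⊗ ω) * T (b ⊗ ω) ≡ 1ℚ → Generators
      rotate b b∈ Tb e = lipschitz b (ω ⊗ b ⊗ conj ω) b∈ (mul∈ (mul∈ ω∈ b∈) (conj∈ ω∈)) Tb Tj Tbj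
        where
        Tj : T (ω ⊗ b ⊗ conj ω) ≡ 0ℚ
        Tj = trans (T-comm (ω ⊗ b) (conj ω)) (trans (cong T
          (⊗-inverse-cancelˡ b (proj₂ (conj-inverse ω∈)))) Tb)
        b²+1 : b ⊗ b ⊕ 1# ≡ 0#
        b²+1 = trans (cong (b ⊗ b ⊕_) (sym (proj₁ (conj-inverse b∈)))) (trans (sym (⊗-distribˡ b b (conj b)))
          (trans (cong (b ⊗_) (trans (conj-T b) (trans (cong (_· 1#) Tb) (·-zeroˡ 1#)))) (⊗-zeroʳ b)))
        T-0 : T 0# ≡ 0ℚ
        T-0 = trans (cong T (sym (·-zeroˡ 0#))) (trans (T-· 0ℚ 0#) (QP.*-zeroˡ (T 0#)))
        Tbωb : T (b ⊗ ω ⊗ b) ≡ 1ℚ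
        Tbωb = trans (T-comm (b ⊗ ω) b) (trans (cong T (sym (⊗-assoc b b ω)))
          (trans (+-shift (T (b ⊗ b ⊗ ω)) (T ω) 0ℚ
            (trans (cong (λ t → T (b ⊗ b ⊗ ω) + t) (cong T (sym (⊗-identityˡ ω))))
            (trans (sym (T-⊕ (b ⊗ b ⊗ ω) (1# ⊗ ω)))
            (trans (cong T (trans (sym (⊗-distribʳ ω (b ⊗ b) 1#)) (trans (cong (_⊗ ω) b²+1) (⊗-zeroˡ ω)))) T-0))))
            (cong (λ t → 0ℚ - t) Tω)))
        Tbωbω : T (b ⊗ ω ⊗ b ⊗ ω) ≡ - 1ℚ
        Tbωbω = trans (cong T (⊗-assoc (b ⊗ ω) b ω)) (trans (T-square-H (mul∈ b∈ ω∈)) (cong (_- 2ℚ) e))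
        Tbj : T (b ⊗ (ω ⊗ b ⊗ conj ω)) ≡ 0ℚ
        Tbj = trans (cong T (trans (sym (⊗-assoc b (ω ⊗ b) (conj ω))) (cong (_⊗ conj ω) (sym (⊗-assoc b ω b)))))
          (trans (+-shift (T (b ⊗ ω ⊗ b ⊗ conj ω)) (T (b ⊗ ω ⊗ b ⊗ ω)) (- 1ℚ * T (b ⊗ ω ⊗ b)) (T-conj (b ⊗ ω ⊗ b)))
            (cong₂ (λ s t → - 1ℚ * s - t) Tbωb Tbωbω))

      generators : Generators
      generators with noncommuting ω (nonscalar-−1 ω∈ Tω)
      ... | g , mg with traceless {g} mg
      ... | b , mb , Tb with T-small (proj₁ (moved-ω mb))
      ... | 0F , t = dicyclic b ω (proj₁ mb) ω∈ Tb Tω t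
      ... | 1F , t = rotate b (proj₁ mb) Tb (cong (λ t → t * t) t)
      ... | 2F , t = rotate b (proj₁ mb) Tb (cong (λ t → t * t) t)
      ... | 3F , t = ⊥-elim (moved-trace (moved-ω mb) (cong (λ t → t * t) t))
      ... | 4F , t = ⊥-elim (moved-trace (moved-ω mb) (cong (λ t → t * t) t))

    generators : Generators
    generators with search {A = λ _ → Σ Carrier λ ω → ω ∈ H × T ω ≡ - 1ℚ} {B = λ h → Scalar# h ⊎ T h ≡ 0ℚ} H decide
      where
      decide : ∀ h → h ∈ H → (Σ Carrier λ ω → ω ∈ H × T ω ≡ - 1ℚ) ⊎ (Scalar# h ⊎ T h ≡ 0ℚ)
      decide h h∈ with T-small h∈
      ... | 0F , t = inj₂ (inj₂ t)
      -- An element of norm 1 and trace 1 has order six; its square has trace 1 - 2 = -1.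
      ... | 1F , t = inj₁ (h ⊗ h , mul∈ h∈ h∈ , trans (T-square-H h∈) (cong (λ t → t * t - 2ℚ) t))
      ... | 2F , t = inj₁ (h , h∈ , t)
      ... | 3F , t = inj₂ (inj₁ (extreme⇒scalar h∈ (cong (λ t → t * t) t)))
      ... | 4F , t = inj₂ (inj₁ (extreme⇒scalar h∈ (cong (λ t → t * t) t)))
    ... | inj₁ (_ , _ , ω , ω∈ , Tω) = OrderThree.generators ω ω∈ Tω
    ... | inj₂ traces = NoOrderThree.generators traces

-- Embedding (a,b) along an anticommuting pair

module _ (a b : ℚ) where
  open QA a b
  open QuaternionSolver

  -- Left multiplication by i and by j. The factors are ordered as `·-assoc` produces them, so that
  -- `I-ι` and `J-ι` need no rearrangement of rationals.
  i· j· : Quat → Quat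
  i· (quat x0 x1 x2 x3) = quat (x1 * a) x0 (x3 * a) x2
  j· (quat x0 x1 x2 x3) = quat (x2 * b) (x3 * (- 1ℚ * b)) x0 (x1 * - 1ℚ)

  -- Reduces multiplicativity of `ι` to its compatibility with left multiplication by i and by j.
  ⊗-expand : ∀ x y → x ⊗ y ≡ q0 x ·ₛ y ⊕ q1 x ·ₛ i· y ⊕ q2 x ·ₛ j· y ⊕ q3 x ·ₛ i· (j· y)
  ⊗-expand x y = solve (X ⊗ᴱ Y)
    (QuatE.e0 X ·ᴱ Y ⊕ᴱ QuatE.e1 X ·ᴱ iᴱ Y ⊕ᴱ QuatE.e2 X ·ᴱ jᴱ Y ⊕ᴱ QuatE.e3 X ·ᴱ iᴱ (jᴱ Y)) refl (env a b 0ℚ 0ℚ x y zeroQ)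
    where
    iᴱ jᴱ : QuatE → QuatE
    iᴱ (quatE x0 x1 x2 x3) = quatE (x1 *ᴱ A) x0 (x3 *ᴱ A) x2
    jᴱ (quatE x0 x1 x2 x3) = quatE (x2 *ᴱ B) (x3 *ᴱ (Κ (- 1ℚ) *ᴱ B)) x0 (x1 *ᴱ Κ (- 1ℚ))

module _ (𝔻 : DefiniteAlgebra) where
  open DefiniteAlgebra 𝔻
  open Division 𝔻

  module Embedding (a b : ℚ) (a<0 : a < 0ℚ) (b<0 : b < 0ℚ)
    (I J : Carrier) (I² : I ⊗ I ≡ a · 1#) (J² : J ⊗ J ≡ b · 1#)
    (T-I : T I ≡ 0ℚ) (T-J : T J ≡ 0ℚ) (T-IJ : T (I ⊗ J) ≡ 0ℚ) where
    module 𝔸 = DefiniteAlgebra (quaternions a b a<0 b<0)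

    K : Carrier
    K = I ⊗ J

    lin : Carrier → Carrier → Carrier → Carrier → Quat → Carrier
    lin A B C D x = q0 x · A ⊕ q1 x · B ⊕ q2 x · C ⊕ q3 x · D

    ι : Quat → Carrier
    ι = lin 1# I J K

    ι-⊕ : ∀ x y → ι (x 𝔸.⊕ y) ≡ ι x ⊕ ι y
    ι-⊕ (quat x0 x1 x2 x3) (quat y0 y1 y2 y3) = trans
      (cong₂ _⊕_ (cong₂ _⊕_ (cong₂ _⊕_ (·-distribʳ x0 y0 1#) (·-distribʳ x1 y1 I)) (·-distribʳ x2 y2 J)) (·-distribʳ x3 y3 K))
      (trans (cong (_⊕ (x3 · K ⊕ y3 · K)) (trans (cong (_⊕ (x2 · J ⊕ y2 · J)) (interchange (x0 · 1#) (y0 · 1#) (x1 · I) (y1 · I)))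
        (interchange (x0 · 1# ⊕ x1 · I) (y0 · 1# ⊕ y1 · I) (x2 · J) (y2 · J))))
        (interchange (x0 · 1# ⊕ x1 · I ⊕ x2 · J) (y0 · 1# ⊕ y1 · I ⊕ y2 · J) (x3 · K) (y3 · K)))

    ι-· : ∀ c x → ι (c 𝔸.· x) ≡ c · ι x
    ι-· c (quat x0 x1 x2 x3) = sym (trans (·-distribˡ c (x0 · 1# ⊕ x1 · I ⊕ x2 · J) (x3 · K))
      (cong₂ _⊕_ (trans (·-distribˡ c (x0 · 1# ⊕ x1 · I) (x2 · J))
        (cong₂ _⊕_ (trans (·-distribˡ c (x0 · 1#) (x1 · I)) (cong₂ _⊕_ (·-assoc c x0 1#) (·-assoc c x1 I)))
          (·-assoc c x2 J))) (·-assoc c x3 K)))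

    ι-one : ι 𝔸.1# ≡ 1#
    ι-one = trans (cong₂ _⊕_ (cong₂ _⊕_ (cong₂ _⊕_ (·-identity 1#) (·-zeroˡ I)) (·-zeroˡ J)) (·-zeroˡ K))
      (trans (⊕-identityʳ (1# ⊕ 0# ⊕ 0#)) (trans (⊕-identityʳ (1# ⊕ 0#)) (⊕-identityʳ 1#)))

    ⊗-lin : ∀ u A B C D x → u ⊗ lin A B C D x ≡ lin (u ⊗ A) (u ⊗ B) (u ⊗ C) (u ⊗ D) x
    ⊗-lin u A B C D (quat x0 x1 x2 x3) = trans (⊗-distribˡ u (x0 · A ⊕ x1 · B ⊕ x2 · C) (x3 · D))
      (cong₂ _⊕_ (trans (⊗-distribˡ u (x0 · A ⊕ x1 · B) (x2 · C))
        (cong₂ _⊕_ (trans (⊗-distribˡ u (x0 · A) (x1 · B)) (cong₂ _⊕_ (·-⊗-comm x0 u A) (·-⊗-comm x1 u B)))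
          (·-⊗-comm x2 u C))) (·-⊗-comm x3 u D))

    anticommute : ∀ {x y} → T x ≡ 0ℚ → T y ≡ 0ℚ → T (x ⊗ y) ≡ 0ℚ → x ⊗ y ⊕ y ⊗ x ≡ 0#
    anticommute {x} {y} Tx Ty Txy = trans (polar x y) (trans
      (cong₂ _⊕_ (trans (cong₂ _⊕_ (trans (cong (_· y) Tx) (·-zeroˡ y)) (trans (cong (_· x) Ty) (·-zeroˡ x))) (⊕-identityˡ 0#))
        (trans (cong (_· 1#) (trans (cong₂ _-_ Txy (trans (cong (_* T y) Tx) (QP.*-zeroˡ (T y)))) refl)) (·-zeroˡ 1#)))
      (⊕-identityˡ 0#))

    JI : J ⊗ I ≡ - 1ℚ · K
    JI = ⊕-zero⇒ (anticommute T-I T-J T-IJ)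

    IK : I ⊗ K ≡ a · J
    IK = trans (sym (⊗-assoc I I J)) (trans (cong (_⊗ J) I²) (trans (·-⊗-assoc a 1# J) (cong (a ·_) (⊗-identityˡ J))))

    JK : J ⊗ K ≡ (- 1ℚ * b) · I
    JK = trans (sym (⊗-assoc J I J)) (trans (cong (_⊗ J) JI) (trans (·-⊗-assoc (- 1ℚ) K J)
      (trans (cong ((- 1ℚ) ·_) (trans (⊗-assoc I J J) (trans (cong (I ⊗_) J²) (trans (·-⊗-comm b I 1#) (cong (b ·_) (⊗-identityʳ I))))))
        (·-assoc (- 1ℚ) b I))))

    lin-cong : ∀ {A B C D A' B' C' D'} → A ≡ A' → B ≡ B' → C ≡ C' → D ≡ D' → ∀ x → lin A B C D x ≡ lin A' B' C' D' x
    lin-cong refl refl refl refl x = refl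

    I-ι : ∀ x → I ⊗ ι x ≡ ι (i· a b x)
    I-ι x@(quat x0 x1 x2 x3) = trans (⊗-lin I 1# I J K x) (trans (lin-cong (⊗-identityʳ I) I² refl IK x)
      (trans (cong₂ (λ u v → x0 · I ⊕ u ⊕ x2 · K ⊕ v) (·-assoc x1 a 1#) (·-assoc x3 a J))
        (permute (x0 · I) ((x1 * a) · 1#) (x2 · K) ((x3 * a) · J))))
      where
      permute : ∀ w x y z → w ⊕ x ⊕ y ⊕ z ≡ x ⊕ w ⊕ z ⊕ y
      permute w x y z = trans (⊕-assoc (w ⊕ x) y z) (trans (cong₂ _⊕_ (⊕-comm w x) (⊕-comm y z)) (sym (⊕-assoc (x ⊕ w) z y)))

    J-ι : ∀ x → J ⊗ ι x ≡ ι (j· a b x)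
    J-ι x@(quat x0 x1 x2 x3) = trans (⊗-lin J 1# I J K x) (trans (lin-cong (⊗-identityʳ J) JI J² JK x)
      (trans (cong₂ _⊕_ (cong₂ (λ u v → x0 · J ⊕ u ⊕ v) (·-assoc x1 (- 1ℚ) K) (·-assoc x2 b 1#)) (·-assoc x3 (- 1ℚ * b) I))
        (permute (x0 · J) ((x1 * - 1ℚ) · K) ((x2 * b) · 1#) ((x3 * (- 1ℚ * b)) · I))))
      where
      permute : ∀ w x y z → w ⊕ x ⊕ y ⊕ z ≡ y ⊕ z ⊕ w ⊕ x
      permute w x y z = trans (⊕-assoc (w ⊕ x) y z) (trans (⊕-comm (w ⊕ x) (y ⊕ z)) (sym (⊕-assoc (y ⊕ z) w x)))

    K-ι : ∀ x → K ⊗ ι x ≡ ι (i· a b (j· a b x))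
    K-ι x = trans (⊗-assoc I J (ι x)) (trans (cong (I ⊗_) (J-ι x)) (I-ι (j· a b x)))

    ι-⊗ : ∀ x y → ι (x 𝔸.⊗ y) ≡ ι x ⊗ ι y
    ι-⊗ x y = trans (cong ι (⊗-expand a b x y)) (trans split (sym product))
      where
      t0 t1 t2 t3 : Quat
      t0 = q0 x 𝔸.· y
      t1 = q1 x 𝔸.· i· a b y
      t2 = q2 x 𝔸.· j· a b y
      t3 = q3 x 𝔸.· i· a b (j· a b y)
      split : ι (t0 𝔸.⊕ t1 𝔸.⊕ t2 𝔸.⊕ t3) ≡ q0 x · ι y ⊕ q1 x · ι (i· a b y) ⊕ q2 x · ι (j· a b y) ⊕ q3 x · ι (i· a b (j· a b y))
      split = trans (ι-⊕ (t0 𝔸.⊕ t1 𝔸.⊕ t2) t3) (cong₂ _⊕_ (trans (ι-⊕ (t0 𝔸.⊕ t1) t2)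
        (cong₂ _⊕_ (trans (ι-⊕ t0 t1) (cong₂ _⊕_ (ι-· (q0 x) y) (ι-· (q1 x) (i· a b y)))) (ι-· (q2 x) (j· a b y))))
        (ι-· (q3 x) (i· a b (j· a b y))))
      term : ∀ c u {v w} → u ⊗ v ≡ w → (c · u) ⊗ v ≡ c · w
      term c u {v} e = trans (·-⊗-assoc c u v) (cong (c ·_) e)
      product : ι x ⊗ ι y ≡ q0 x · ι y ⊕ q1 x · ι (i· a b y) ⊕ q2 x · ι (j· a b y) ⊕ q3 x · ι (i· a b (j· a b y))
      product = trans (⊗-distribʳ (ι y) (q0 x · 1# ⊕ q1 x · I ⊕ q2 x · J) (q3 x · K))
        (cong₂ _⊕_ (trans (⊗-distribʳ (ι y) (q0 x · 1# ⊕ q1 x · I) (q2 x · J))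
          (cong₂ _⊕_ (trans (⊗-distribʳ (ι y) (q0 x · 1#) (q1 x · I))
            (cong₂ _⊕_ (term (q0 x) 1# (⊗-identityˡ (ι y))) (term (q1 x) I (I-ι y)))) (term (q2 x) J (J-ι y))))
          (term (q3 x) K (K-ι y)))

    T-ι : ∀ x → T (ι x) ≡ q0 x * 2ℚ
    T-ι (quat x0 x1 x2 x3) = trans (T-⊕ (x0 · 1# ⊕ x1 · I ⊕ x2 · J) (x3 · K))
      (trans (cong₂ _+_ (trans (T-⊕ (x0 · 1# ⊕ x1 · I) (x2 · J))
        (trans (cong₂ _+_ (trans (T-⊕ (x0 · 1#) (x1 · I))
          (trans (cong₂ _+_ (trans (T-· x0 1#) (cong (x0 *_) T-one)) (vanish x1 I T-I)) (QP.+-identityʳ (x0 * 2ℚ))))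
          (vanish x2 J T-J)) (QP.+-identityʳ (x0 * 2ℚ)))) (vanish x3 K T-IJ)) (QP.+-identityʳ (x0 * 2ℚ)))
      where
      vanish : ∀ c u → T u ≡ 0ℚ → T (c · u) ≡ 0ℚ
      vanish c u e = trans (T-· c u) (trans (cong (c *_) e) (QP.*-zeroʳ c))

    conj-ι : ∀ x → conj (ι x) ≡ ι (conjugate x)
    conj-ι x = ⊕-cancelˡ (ι x) (conj (ι x)) (ι (conjugate x)) (trans (conj-T (ι x)) (trans
      (cong₂ _·_ (trans (T-ι x) (double (q0 x))) (sym ι-one))
      (sym (trans (sym (ι-⊕ x (conjugate x))) (trans (cong ι (𝔸.conj-T x)) (ι-· (trace x) 𝔸.1#))))))
      where
      double : ∀ t → t * 2ℚ ≡ t + t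
      double t = trans (QP.*-distribˡ-+ t 1ℚ 1ℚ) (cong₂ _+_ (QP.*-identityʳ t) (QP.*-identityʳ t))

    ·1-injective : ∀ s t → s · 1# ≡ t · 1# → s ≡ t
    ·1-injective s t e = *-cancelˡ 2ℚ s t (λ ()) (trans (QP.*-comm 2ℚ s) (trans (trans (sym (T-·1 s)) (trans (cong T e) (T-·1 t))) (QP.*-comm t 2ℚ)))
      where
      T-·1 : ∀ s → T (s · 1#) ≡ s * 2ℚ
      T-·1 s = trans (T-· s 1#) (cong (s *_) T-one)

    N-ι : ∀ x → N (ι x) ≡ 𝔸.N x
    N-ι x = ·1-injective (N (ι x)) (𝔸.N x) (trans (sym (conj-inverseʳ (ι x))) (trans (cong (ι x ⊗_) (conj-ι x))
      (trans (sym (ι-⊗ x (conjugate x))) (trans (cong ι (𝔸.conj-inverseʳ x)) (trans (ι-· (𝔸.N x) 𝔸.1#) (cong (𝔸.N x ·_) ι-one))))))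

    -- `ι` preserves the norm, and the norm of (a,b) is anisotropic.
    ι-injective : ∀ {x y} → ι x ≡ ι y → x ≡ y
    ι-injective {x} {y} e = Division.⊖≡0⇒≡ (quaternions a b a<0 b<0) x y
      (𝔸.N-zero⇒ (x 𝔸.⊖ y) (trans (sym (N-ι (x 𝔸.⊖ y))) (trans (cong N ι-diff) N-0)))
      where
      ι-diff : ι (x 𝔸.⊖ y) ≡ 0#
      ι-diff = trans (ι-⊕ x (𝔸.⊝ y)) (trans (cong₂ _⊕_ e (ι-· (- 1ℚ) y)) (⊖-inverse (ι y)))
      N-0 : N 0# ≡ 0ℚ
      N-0 = ·1-injective (N 0#) 0ℚ (trans (sym (conj-inverseʳ 0#)) (trans (⊗-zeroˡ (conj 0#)) (sym (·-zeroˡ 1#))))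

    T-I-ι : ∀ x → T (ι x ⊗ I) ≡ q1 x * a * 2ℚ
    T-I-ι x = trans (T-comm (ι x) I) (trans (cong T (I-ι x)) (T-ι (i· a b x)))

    T-J-ι : ∀ x → T (ι x ⊗ J) ≡ q2 x * b * 2ℚ
    T-J-ι x = trans (T-comm (ι x) J) (trans (cong T (J-ι x)) (T-ι (j· a b x)))

    T-K-ι : ∀ x → T (ι x ⊗ K) ≡ q3 x * (- 1ℚ * b) * a * 2ℚ
    T-K-ι x = trans (T-comm (ι x) K) (trans (cong T (K-ι x)) (T-ι (i· a b (j· a b x))))

    -- An element orthogonal to 1, I, J anticommutes with I and J, hence commutes with K = I J;
    -- being orthogonal to K as well, it also anticommutes with K, so it vanishes.
    orthogonal⇒0 : ∀ r → ¬ (K ≡ 0#) → T r ≡ 0ℚ → T (r ⊗ I) ≡ 0ℚ → T (r ⊗ J) ≡ 0ℚ → T (r ⊗ K) ≡ 0ℚ → r ≡ 0#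
    orthogonal⇒0 r K≢0 Tr TrI TrJ TrK = ⊗-zero⇒ʳ K≢0 Kr≡0
      where
      Ir : I ⊗ r ≡ ⊝ (r ⊗ I)
      Ir = ⊕-zero⇒ (anticommute Tr T-I TrI)
      Jr : J ⊗ r ≡ ⊝ (r ⊗ J)
      Jr = ⊕-zero⇒ (anticommute Tr T-J TrJ)
      Kr≡rK : K ⊗ r ≡ r ⊗ K
      Kr≡rK = trans (⊗-assoc I J r) (trans (cong (I ⊗_) Jr) (trans (sym (-‿distribʳ-* I (r ⊗ J)))
        (trans (cong ⊝_ (trans (sym (⊗-assoc I r J)) (trans (cong (_⊗ J) Ir) (trans (sym (-‿distribˡ-* (r ⊗ I) J)) (cong ⊝_ (⊗-assoc r I J))))))
          (-‿involutive (r ⊗ K)))))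
      doubled : 2ℚ · (K ⊗ r) ≡ 0#
      doubled = trans (·-distribʳ 1ℚ 1ℚ (K ⊗ r)) (trans (cong₂ _⊕_ (trans (·-identity (K ⊗ r)) Kr≡rK) (·-identity (K ⊗ r)))
        (anticommute Tr T-IJ TrK))
      Kr≡0 : K ⊗ r ≡ 0#
      Kr≡0 = trans (sym (·-identity (K ⊗ r))) (trans (sym (·-assoc (Q.½) 2ℚ (K ⊗ r))) (trans (cong (Q.½ ·_) doubled) (·-zeroʳ Q.½)))

    module _ (u v w : ℚ) (u-inv : u * (a * 2ℚ) ≡ 1ℚ) (v-inv : v * (b * 2ℚ) ≡ 1ℚ) (w-inv : w * ((- 1ℚ * b) * a * 2ℚ) ≡ 1ℚ) where

      -- Orthogonal projection for the trace form: ½, u, v, w are the inverses of the traces 2, 2a,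
      -- 2b, -2ab of the squares of 1, I, J, K.
      coordinates : Carrier → Quat
      coordinates y = quat (T y * Q.½) (T (y ⊗ I) * u) (T (y ⊗ J) * v) (T (y ⊗ K) * w)

      K≢0 : ¬ (K ≡ 0#)
      -- If K were zero, (JK)I = -ab would vanish, but w inverts -2ab.
      K≢0 e with trans (sym w-inv) (trans (cong (λ t → w * (t * 2ℚ)) ba≡0) (QP.*-zeroʳ w))
        where
        ba≡0 : (- 1ℚ * b) * a ≡ 0ℚ
        ba≡0 = ·1-injective ((- 1ℚ * b) * a) 0ℚ (trans (sym (·-assoc (- 1ℚ * b) a 1#)) (trans (cong ((- 1ℚ * b) ·_) (sym I²))
          (trans (sym (·-⊗-assoc (- 1ℚ * b) I I)) (trans (cong (_⊗ I) (sym JK)) (trans (cong (λ t → (J ⊗ t) ⊗ I) e)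
            (trans (cong (_⊗ I) (⊗-zeroʳ J)) (trans (⊗-zeroˡ I) (sym (·-zeroˡ 1#)))))))))
      ... | ()

      -- The coordinates are chosen so that y minus its projection is orthogonal to 1, I, J and K.
      -- Surjectivity of `ι` thus follows without a dimension count.
      ι-coordinates : ∀ y → ι (coordinates y) ≡ y
      ι-coordinates y = sym (⊖≡0⇒≡ y (ι c) (orthogonal⇒0 (y ⊖ ι c) K≢0
        (trans (T-⊖ y (ι c)) (cancel (T y) (T (ι c)) (trans (T-ι c) (undo (T y) Q.½ 2ℚ refl))))
        (component I (trans (T-I-ι c) (trans (QP.*-assoc (q1 c) a 2ℚ) (undo (T (y ⊗ I)) u (a * 2ℚ) u-inv))))
        (component J (trans (T-J-ι c) (trans (QP.*-assoc (q2 c) b 2ℚ) (undo (T (y ⊗ J)) v (b * 2ℚ) v-inv))))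
        (component K (trans (T-K-ι c) (trans (reassoc (q3 c) (- 1ℚ * b) a) (undo (T (y ⊗ K)) w ((- 1ℚ * b) * a * 2ℚ) w-inv))))))
        where
        c : Quat
        c = coordinates y
        T-⊖ : ∀ x z → T (x ⊖ z) ≡ T x + - 1ℚ * T z
        T-⊖ x z = trans (T-⊕ x (⊝ z)) (cong (T x +_) (T-· (- 1ℚ) z))
        cancel : ∀ s t → t ≡ s → s + - 1ℚ * t ≡ 0ℚ
        cancel s t refl = trans (cong (s +_) (sym (QP.neg-distribˡ-* 1ℚ s))) (trans (cong (λ t → s - t) (QP.*-identityˡ s)) (QP.+-inverseʳ s))
        undo : ∀ t r d → r * d ≡ 1ℚ → t * r * d ≡ t
        undo t r d e = trans (QP.*-assoc t r d) (trans (cong (t *_) e) (QP.*-identityʳ t))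
        reassoc : ∀ t r s → t * r * s * 2ℚ ≡ t * (r * s * 2ℚ)
        reassoc t r s = trans (cong (_* 2ℚ) (QP.*-assoc t r s)) (QP.*-assoc t (r * s) 2ℚ)
        component : ∀ z → T (ι c ⊗ z) ≡ T (y ⊗ z) → T ((y ⊖ ι c) ⊗ z) ≡ 0ℚ
        component z e = trans (cong T (⊗-distribʳ-⊖ z y (ι c))) (trans (T-⊖ (y ⊗ z) (ι c ⊗ z)) (cancel (T (y ⊗ z)) (T (ι c ⊗ z)) e))

-- The groups SL₂(𝔽₃) and Dic₁₂ inside the quaternion algebras

-- The laws quantify over lists, which makes each of them decidable and provable by evaluation.
record Enumeration (H : FinGrp) : Set where
  open FinGrp H
  field
    elems      : List Car
    sound      : ∀ {x} → x ∈ elems → Elem x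
    complete   : ∀ {x} → Elem x → x ∈ elems
    unit       : Car
    unit∈      : unit ∈ elems
    ∙-closed   : All (λ { (x , y) → (x ∙ y) ∈ elems }) (cartesianProduct elems elems)
    ∙-inverse  : All (λ x → Any (λ y → x ∙ y ≡ unit × y ∙ x ≡ unit) elems) elems

record Realisation {H : FinGrp} (E : Enumeration H) (a b : ℚ) : Set where
  open FinGrp H
  open Enumeration E
  field
    ψ        : Car → Quat
    ψ-unit   : ψ unit ≡ QA.oneQ a b
    ψ-hom    : All (λ { (x , y) → ψ (x ∙ y) ≡ QA._⊗_ a b (ψ x) (ψ y) }) (cartesianProduct elems elems)
    ψ-inj    : All (λ { (x , y) → ψ x ≡ ψ y → x ≡ y }) (cartesianProduct elems elems)

SL2F3-≟ : DecidableEquality (FinGrp.Car SL2F3)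
SL2F3-≟ = ≡-dec ℕ._≟_ (≡-dec ℕ._≟_ (≡-dec ℕ._≟_ ℕ._≟_))

Dic12-≟ : DecidableEquality (FinGrp.Car Dic12)
Dic12-≟ = ≡-dec ℕ._≟_ BoolP._≟_

SL2F3-enumeration : Enumeration SL2F3
SL2F3-enumeration = record
  { elems     = elems
  ; sound     = λ x∈ → let q∈ , det = ∈-filter⁻ det≟1 {xs = quadruples} x∈
                           p , qrt = ∈-cartesianProduct⁻ (upTo 3) _ q∈
                           q , rt = ∈-cartesianProduct⁻ (upTo 3) _ qrt
                           r , t = ∈-cartesianProduct⁻ (upTo 3) _ rt
                       in ∈-upTo⁻ p , ∈-upTo⁻ q , ∈-upTo⁻ r , ∈-upTo⁻ t , det
  ; complete  = λ { (p , q , r , t , det) → ∈-filter⁺ det≟1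
      (∈-cartesianProduct⁺ (∈-upTo⁺ p) (∈-cartesianProduct⁺ (∈-upTo⁺ q) (∈-cartesianProduct⁺ (∈-upTo⁺ r) (∈-upTo⁺ t)))) det }
  ; unit      = 1 , 0 , 0 , 1
  ; unit∈     = from-yes ((1 , 0 , 0 , 1) ∈? elems)
  ; ∙-closed  = from-yes (all? (λ { (x , y) → (x ∙ y) ∈? elems }) (cartesianProduct elems elems))
  ; ∙-inverse = from-yes (all? (λ x → any? (λ y → SL2F3-≟ (x ∙ y) (1 , 0 , 0 , 1) ×-dec SL2F3-≟ (y ∙ x) (1 , 0 , 0 , 1)) elems) elems)
  }
  where
  open FinGrp SL2F3
  open DecMembership SL2F3-≟ using (_∈?_)
  quadruples elems : List Car
  quadruples = cartesianProduct (upTo 3) (cartesianProduct (upTo 3) (cartesianProduct (upTo 3) (upTo 3)))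
  det≟1 : (x : Car) → Dec ((proj₁ x ℕ.* proj₂ (proj₂ (proj₂ x)) ℕ.+ 2 ℕ.* (proj₁ (proj₂ x) ℕ.* proj₁ (proj₂ (proj₂ x)))) % 3 ≡ 1)
  det≟1 (p , q , r , t) = _ ℕ.≟ 1
  elems = filter det≟1 quadruples

Dic12-enumeration : Enumeration Dic12
Dic12-enumeration = record
  { elems     = elems
  ; sound     = λ x∈ → ∈-upTo⁻ (proj₁ (∈-cartesianProduct⁻ (upTo 6) (false ∷ true ∷ []) x∈))
  ; complete  = λ { {_ , e} n → ∈-cartesianProduct⁺ {xs = upTo 6} {ys = false ∷ true ∷ []} (∈-upTo⁺ n) (∈-bool e) }
  ; unit      = 0 , false
  ; unit∈     = here refl
  ; ∙-closed  = from-yes (all? (λ { (x , y) → (x ∙ y) ∈? elems }) (cartesianProduct elems elems))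
  ; ∙-inverse = from-yes (all? (λ x → any? (λ y → Dic12-≟ (x ∙ y) (0 , false) ×-dec Dic12-≟ (y ∙ x) (0 , false)) elems) elems)
  }
  where
  open FinGrp Dic12
  open DecMembership Dic12-≟ using (_∈?_)
  elems : List Car
  elems = cartesianProduct (upTo 6) (false ∷ true ∷ [])
  ∈-bool : ∀ e → e ∈ (false ∷ true ∷ [])
  ∈-bool false = here refl
  ∈-bool true  = there (here refl)

-- Reduction modulo 3 of the Hurwitz order sends i, j to the matrices (0 -1 ; 1 0), (1 1 ; 1 -1);
-- the coordinates x₀ … x₃ below solve (p q ; r t) = x₀ + x₁ i + x₂ j + x₃ ij over 𝔽₃.
-- As ½ = -1 in 𝔽₃, the units with four nonzero coordinates are lifted to halves of the negated signs.
hurwitz : ℕ × ℕ × ℕ × ℕ → Quat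
hurwitz (p , q , r , t) = lift (2 ℕ.* (p ℕ.+ t) % 3) ((q ℕ.+ 2 ℕ.* r) % 3)
    ((q ℕ.+ r ℕ.+ 2 ℕ.* t ℕ.+ p) % 3) ((q ℕ.+ r ℕ.+ t ℕ.+ 2 ℕ.* p) % 3)
  where
  sign : ℕ → ℚ
  sign 0 = 0ℚ
  sign 1 = 1ℚ
  sign _ = - 1ℚ
  lift : ℕ → ℕ → ℕ → ℕ → Quat
  lift x₀@(suc _) x₁@(suc _) x₂@(suc _) x₃@(suc _) =
    quat (- ½ * sign x₀) (- ½ * sign x₁) (- ½ * sign x₂) (- ½ * sign x₃)
  lift x₀ x₁ x₂ x₃ = quat (sign x₀) (sign x₁) (sign x₂) (sign x₃)

SL2F3-realisation : Realisation SL2F3-enumeration D2∞-a D2∞-b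
SL2F3-realisation = record
  { ψ      = hurwitz
  ; ψ-unit = refl
  ; ψ-hom  = from-yes (all? (λ { (x , y) → hurwitz (x ∙ y) ≟ᵠ QA._⊗_ D2∞-a D2∞-b (hurwitz x) (hurwitz y) }) (cartesianProduct elems elems))
  ; ψ-inj  = from-yes (all? (λ { (x , y) → (hurwitz x ≟ᵠ hurwitz y) →-dec SL2F3-≟ x y }) (cartesianProduct elems elems))
  }
  where
  open FinGrp SL2F3
  open Enumeration SL2F3-enumeration

-- a = ½ (1 + j) with j² = -3, and b = i.
eisenstein : ℕ × Bool → Quat
eisenstein (n , e) = times (re n) (im n) e
  where
  re im : ℕ → ℚ
  re 0 = 1ℚ
  re 1 = ½
  re 2 = - ½
  re 3 = - 1ℚ
  re 4 = - ½
  re _ = ½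
  im 0 = 0ℚ
  im 1 = ½
  im 2 = ½
  im 3 = 0ℚ
  im _ = - ½
  times : ℚ → ℚ → Bool → Quat
  times x y false = quat x 0ℚ y 0ℚ
  -- Since ji = -k, the product (x + yj)i has k-coordinate -y.
  times x y true  = quat 0ℚ x 0ℚ (- y)

Dic12-realisation : Realisation Dic12-enumeration D3∞-a D3∞-b
Dic12-realisation = record
  { ψ      = eisenstein
  ; ψ-unit = refl
  ; ψ-hom  = from-yes (all? (λ { (x , y) → eisenstein (x ∙ y) ≟ᵠ QA._⊗_ D3∞-a D3∞-b (eisenstein x) (eisenstein y) }) (cartesianProduct elems elems))
  ; ψ-inj  = from-yes (all? (λ { (x , y) → (eisenstein x ≟ᵠ eisenstein y) →-dec Dic12-≟ x y }) (cartesianProduct elems elems))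
  }
  where
  open FinGrp Dic12
  open Enumeration Dic12-enumeration

-- Search over the possible traces

small⁴ : List (Fin 5 × Fin 5 × Fin 5 × Fin 5)
small⁴ = cartesianProduct (allFin 5) (cartesianProduct (allFin 5) (cartesianProduct (allFin 5) (allFin 5)))

∈-small⁴ : ∀ n₀ n₁ n₂ n₃ → (n₀ , n₁ , n₂ , n₃) ∈ small⁴
∈-small⁴ n₀ n₁ n₂ n₃ = ∈-cartesianProduct⁺ (∈-allFin n₀) (∈-cartesianProduct⁺ (∈-allFin n₁) (∈-cartesianProduct⁺ (∈-allFin n₂) (∈-allFin n₃)))

module _ {H : FinGrp} {E : Enumeration H} {a b : ℚ} (R : Realisation E a b) (candidate : ℚ → ℚ → ℚ → ℚ → Quat) where
  open Realisation R
  open Enumeration E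

  -- Most quadruples are not the traces of any group element; the norm condition discards them, and
  -- whatever survives must be in the image of the group.
  CoversAt : Fin 5 × Fin 5 × Fin 5 × Fin 5 → Set
  CoversAt (n₀ , n₁ , n₂ , n₃) = let c = candidate (small n₀) (small n₁) (small n₂) (small n₃) in
    Laws.N a b c ≡ 1ℚ → Any (λ x → ψ x ≡ c) elems

  coversAt? : ∀ n → Dec (CoversAt n)
  coversAt? (n₀ , n₁ , n₂ , n₃) = let c = candidate (small n₀) (small n₁) (small n₂) (small n₃) in
    (Laws.N a b c QP.≟ 1ℚ) →-dec any? (λ x → ψ x ≟ᵠ c) elems

  Covers : Set
  Covers = All CoversAt small⁴

-- In (-1,-1) the traces of I², J², K² are all -2, whence the factors -½. In (-1,-3) they are -2,
-- -6, -6. There J = 2ω + 1 and K = bJ, so the traces against J and K are 2T(hω) + T(h) and 2T(hbω)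
-- + T(hb), with t₀, t₁, t₂, t₃ the traces of h, hb, hω, hbω.
lipschitz-candidate dicyclic-candidate : ℚ → ℚ → ℚ → ℚ → Quat
lipschitz-candidate t₀ t₁ t₂ t₃ = quat (t₀ * ½) (t₁ * - ½) (t₂ * - ½) (t₃ * - ½)
dicyclic-candidate t₀ t₁ t₂ t₃ =
  quat (t₀ * ½) (t₁ * - ½) ((t₂ + t₂ + t₀) * (-[1+ 0 ] / 6)) ((t₃ + t₃ + t₁) * (-[1+ 0 ] / 6))

abstract
  -- Opaque, so that the search is not evaluated again where its result is applied.
  SL2F3-covers : Covers SL2F3-realisation lipschitz-candidate
  SL2F3-covers = from-yes (all? (coversAt? SL2F3-realisation lipschitz-candidate) small⁴)

  Dic12-covers : Covers Dic12-realisation dicyclic-candidate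
  Dic12-covers = from-yes (all? (coversAt? Dic12-realisation dicyclic-candidate) small⁴)

module _ (𝔻 : DefiniteAlgebra) where
  open DefiniteAlgebra 𝔻

  -- The laws are restricted to `elems` because the carrier also contains tuples outside the group.
  record Representation {H : FinGrp} (E : Enumeration H) : Set where
    open FinGrp H
    open Enumeration E
    field
      Ψ      : Car → Carrier
      Ψ-unit : Ψ unit ≡ 1#
      Ψ-hom  : ∀ {x y} → x ∈ elems → y ∈ elems → Ψ (x ∙ y) ≡ Ψ x ⊗ Ψ y
      Ψ-inj  : ∀ {x y} → x ∈ elems → y ∈ elems → Ψ x ≡ Ψ y → x ≡ y

-- Wreath products as groups of monomial matrices

module _ (𝔻 : DefiniteAlgebra) (𝕄 : MatrixAlgebra 𝔻) where
  open DefiniteAlgebra 𝔻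
  open Division 𝔻
  open MatrixAlgebra 𝕄

  module Wreath (u₀ u₁ : Row) (ind : Independent u₀ u₁) {H : FinGrp} {E : Enumeration H} (P : Representation 𝔻 E) where
    open FinGrp H
    open Enumeration E
    open Representation P
    open Basis 𝔻 u₀ u₁ ind
    open Transform 𝔻 𝕄 u₀ u₁ ind
    module W = FinGrp (Wr2 H)

    -- Indexing the basis by `Bool` lets the swap act by `xor`, so that one computation serves both
    -- rows.
    row : Bool → Row
    row false = u₀
    row true  = u₁

    pick : Bool → W.Car → Car
    pick false (x , _ , _) = x
    pick true  (_ , y , _) = y

    swaps : W.Car → Bool
    swaps (_ , _ , f) = f

    monomial : W.Car → M
    monomial (x , y , f) = proj₁ (images (Ψ x ·ₗ row f) (Ψ y ·ₗ row (not f)))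

    row-monomial : ∀ b w → row b ·ᵣ monomial w ≡ Ψ (pick b w) ·ₗ row (b xor swaps w)
    row-monomial false (x , y , f) = proj₁ (proj₂ (images (Ψ x ·ₗ row f) (Ψ y ·ₗ row (not f))))
    row-monomial true  (x , y , f) = proj₂ (proj₂ (images (Ψ x ·ₗ row f) (Ψ y ·ₗ row (not f))))

    elemsᵂ : List W.Car
    elemsᵂ = cartesianProduct elems (cartesianProduct elems (false ∷ true ∷ []))

    ∈-elemsᵂ : ∀ {x y} f → x ∈ elems → y ∈ elems → (x , y , f) ∈ elemsᵂ
    ∈-elemsᵂ f x∈ y∈ = ∈-cartesianProduct⁺ x∈ (∈-cartesianProduct⁺ y∈ (flag f))
      where
      flag : ∀ f → f ∈ (false ∷ true ∷ [])
      flag false = here refl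
      flag true  = there (here refl)

    elemsᵂ-∈ : ∀ {w} → w ∈ elemsᵂ → ∀ b → pick b w ∈ elems
    elemsᵂ-∈ w∈ b with ∈-cartesianProduct⁻ elems (cartesianProduct elems (false ∷ true ∷ [])) w∈
    elemsᵂ-∈ w∈ false | x∈ , _ = x∈
    elemsᵂ-∈ w∈ true  | _ , yf∈ = proj₁ (∈-cartesianProduct⁻ elems (false ∷ true ∷ []) yf∈)

    row-product : ∀ b {v w} → v ∈ elemsᵂ → w ∈ elemsᵂ → row b ·ᵣ (monomial v ∘ monomial w)
      ≡ Ψ (pick b v ∙ pick (b xor swaps v) w) ·ₗ row ((b xor swaps v) xor swaps w)
    row-product b {v} {w} v∈ w∈ = trans (act-∘ (row b) (monomial v) (monomial w))
      (trans (cong (_·ᵣ monomial w) (row-monomial b v))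
      (trans (act-· (Ψ (pick b v)) (row c) (monomial w))
      (trans (cong (Ψ (pick b v) ·ₗ_) (row-monomial c w))
      (trans (sym (·ₗ-assoc (Ψ (pick b v)) (Ψ (pick c w)) (row (c xor swaps w))))
      (cong (_·ₗ row (c xor swaps w)) (sym (Ψ-hom (elemsᵂ-∈ v∈ b) (elemsᵂ-∈ w∈ c))))))))
      where
      c = b xor swaps v

    -- The product in `Wr2` computes by cases on the left flag. When that flag is `true`, the second
    -- one must be known as well before the two row indices, bracketed differently, reduce to the
    -- same value.
    monomial-hom : ∀ {v w} → v ∈ elemsᵂ → w ∈ elemsᵂ → monomial (v W.∙ w) ≡ monomial v ∘ monomial w
    monomial-hom {v@(_ , _ , false)} {w} v∈ w∈ = matrix-ext
      (trans (row-monomial false (v W.∙ w)) (sym (row-product false v∈ w∈)))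
      (trans (row-monomial true (v W.∙ w)) (sym (row-product true v∈ w∈)))
    monomial-hom {v@(_ , _ , true)} {w@(_ , _ , false)} v∈ w∈ = matrix-ext
      (trans (row-monomial false (v W.∙ w)) (sym (row-product false v∈ w∈)))
      (trans (row-monomial true (v W.∙ w)) (sym (row-product true v∈ w∈)))
    monomial-hom {v@(_ , _ , true)} {w@(_ , _ , true)} v∈ w∈ = matrix-ext
      (trans (row-monomial false (v W.∙ w)) (sym (row-product false v∈ w∈)))
      (trans (row-monomial true (v W.∙ w)) (sym (row-product true v∈ w∈)))

    monomial-unit : monomial (unit , unit , false) ≡ 1ₘ
    monomial-unit = matrix-ext (trivial false) (trivial true)
      where
      unit-row : ∀ v → Ψ unit ·ₗ v ≡ v ·ᵣ 1ₘ
      unit-row v = trans (cong (_·ₗ v) Ψ-unit) (trans (·ₗ-identity v) (sym (act-1 v)))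
      trivial : ∀ b → row b ·ᵣ monomial (unit , unit , false) ≡ row b ·ᵣ 1ₘ
      trivial false = trans (row-monomial false (unit , unit , false)) (unit-row u₀)
      trivial true  = trans (row-monomial true (unit , unit , false)) (unit-row u₁)

    ∙-closed′ : ∀ {x y} → x ∈ elems → y ∈ elems → (x ∙ y) ∈ elems
    ∙-closed′ x∈ y∈ = All.lookup ∙-closed (∈-cartesianProduct⁺ x∈ y∈)

    ∙-inverse′ : ∀ {x} → x ∈ elems → Σ Car λ y → y ∈ elems × x ∙ y ≡ unit × y ∙ x ≡ unit
    ∙-inverse′ x∈ = find (All.lookup ∙-inverse x∈)

    W-closed : ∀ {v w} → v ∈ elemsᵂ → w ∈ elemsᵂ → (v W.∙ w) ∈ elemsᵂ
    W-closed {_ , _ , false} {_ , _ , t} v∈ w∈ = ∈-elemsᵂ t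
      (∙-closed′ (elemsᵂ-∈ v∈ false) (elemsᵂ-∈ w∈ false)) (∙-closed′ (elemsᵂ-∈ v∈ true) (elemsᵂ-∈ w∈ true))
    W-closed {_ , _ , true} {_ , _ , t} v∈ w∈ = ∈-elemsᵂ (true xor t)
      (∙-closed′ (elemsᵂ-∈ v∈ false) (elemsᵂ-∈ w∈ true)) (∙-closed′ (elemsᵂ-∈ v∈ true) (elemsᵂ-∈ w∈ false))

    W-inverse : ∀ {v} → v ∈ elemsᵂ → Σ W.Car λ w → w ∈ elemsᵂ × v W.∙ w ≡ (unit , unit , false) × w W.∙ v ≡ (unit , unit , false)
    W-inverse {v} v∈ with swaps v in eq | ∙-inverse′ (elemsᵂ-∈ v∈ false) | ∙-inverse′ (elemsᵂ-∈ v∈ true)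
    W-inverse {_ , _ , false} v∈ | false | x , x∈ , vx , xv | y , y∈ , vy , yv =
      (x , y , false) , ∈-elemsᵂ false x∈ y∈ , cong₂ (λ p q → p , q , false) vx vy , cong₂ (λ p q → p , q , false) xv yv
    -- A swap exchanges the positions, so the inverses of the two entries appear in the opposite
    -- order.
    W-inverse {_ , _ , true} v∈ | true | x , x∈ , vx , xv | y , y∈ , vy , yv =
      (y , x , true) , ∈-elemsᵂ true y∈ x∈ , cong₂ (λ p q → p , q , false) vx vy , cong₂ (λ p q → p , q , false) yv xv

    wreath : List M
    wreath = map monomial elemsᵂ

    wreath-isGroup : IsGroup _∘_ 1ₘ wreath
    wreath-isGroup = record
      { one∈ = subst (_∈ wreath) monomial-unit (∈-map⁺ monomial (∈-elemsᵂ false unit∈ unit∈))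
      ; mul∈ = product
      ; inv∈ = inverted
      }
      where
      product : ∀ {g h} → g ∈ wreath → h ∈ wreath → (g ∘ h) ∈ wreath
      product g∈ h∈ with ∈-map⁻ monomial g∈ | ∈-map⁻ monomial h∈
      ... | v , v∈ , refl | w , w∈ , refl = subst (_∈ wreath) (monomial-hom v∈ w∈) (∈-map⁺ monomial (W-closed v∈ w∈))
      inverted : ∀ {g} → g ∈ wreath → Σ M λ h → h ∈ wreath × (g ∘ h ≡ 1ₘ) × (h ∘ g ≡ 1ₘ)
      inverted g∈ with ∈-map⁻ monomial g∈
      ... | v , v∈ , refl with W-inverse v∈
      ... | w , w∈ , vw , wv = monomial w , ∈-map⁺ monomial w∈ ,
        trans (sym (monomial-hom v∈ w∈)) (trans (cong monomial vw) monomial-unit) ,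
        trans (sym (monomial-hom w∈ v∈)) (trans (cong monomial wv) monomial-unit)

    Ψ≢0 : ∀ {x} → x ∈ elems → ¬ (Ψ x ≡ 0#)
    Ψ≢0 {x} x∈ e with ∙-inverse′ x∈
    ... | y , y∈ , xy , _ = 1≢0 (trans (sym Ψ-unit) (trans (cong Ψ (sym xy)) (trans (Ψ-hom x∈ y∈)
      (trans (cong (_⊗ Ψ y) e) (⊗-zeroˡ (Ψ y))))))

    row-injective : ∀ {d e} b c → ¬ (d ≡ 0#) → d ·ₗ row b ≡ e ·ₗ row c → d ≡ e × b ≡ c
    row-injective {d} {e} false false _ eq = proj₁ (unique (trans (comb-fst u₀ u₁ d) (trans eq (sym (comb-fst u₀ u₁ e))))) , refl
    row-injective {d} {e} true true _ eq = proj₂ (unique (trans (comb-snd u₀ u₁ d) (trans eq (sym (comb-snd u₀ u₁ e))))) , refl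
    row-injective {d} {e} false true d≢0 eq = ⊥-elim (d≢0 (proj₁ (unique (trans (comb-fst u₀ u₁ d) (trans eq (sym (comb-snd u₀ u₁ e)))))))
    row-injective {d} {e} true false d≢0 eq = ⊥-elim (d≢0 (proj₂ (unique (trans (comb-snd u₀ u₁ d) (trans eq (sym (comb-fst u₀ u₁ e)))))))

    monomial-inj : ∀ {v w} → v ∈ elemsᵂ → w ∈ elemsᵂ → monomial v ≡ monomial w → v ≡ w
    monomial-inj {v@(_ , _ , f)} {w@(_ , _ , g)} v∈ w∈ e = cong₂ _,_ (entry false) (cong₂ _,_ (entry true) (proj₂ (compare false)))
      where
      compare : ∀ b → Ψ (pick b v) ≡ Ψ (pick b w) × (b xor f) ≡ (b xor g)
      compare b = row-injective (b xor f) (b xor g) (Ψ≢0 (elemsᵂ-∈ v∈ b))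
        (trans (sym (row-monomial b v)) (trans (cong (row b ·ᵣ_) e) (row-monomial b w)))
      entry : ∀ b → pick b v ≡ pick b w
      entry b = Ψ-inj (elemsᵂ-∈ v∈ b) (elemsᵂ-∈ w∈ b) (proj₁ (compare b))

    monomial-onto : ∀ {g x y} f → x ∈ elems → y ∈ elems →
      u₀ ·ᵣ g ≡ Ψ x ·ₗ row f → u₁ ·ᵣ g ≡ Ψ y ·ₗ row (not f) → g ∈ wreath
    monomial-onto {g} {x} {y} f x∈ y∈ e₀ e₁ = subst (_∈ wreath)
      (matrix-ext (trans (row-monomial false (x , y , f)) (sym e₀)) (trans (row-monomial true (x , y , f)) (sym e₁)))
      (∈-map⁺ monomial (∈-elemsᵂ f x∈ y∈))

    Elem⇒∈ : ∀ {w} → W.Elem w → w ∈ elemsᵂ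
    Elem⇒∈ {_ , _ , f} (x , y) = ∈-elemsᵂ f (complete x) (complete y)

    ∈⇒Elem : ∀ {w} → w ∈ elemsᵂ → W.Elem w
    ∈⇒Elem {_ , _ , _} w∈ = sound (elemsᵂ-∈ w∈ false) , sound (elemsᵂ-∈ w∈ true)

-- Classification of the coefficient group

module _ (𝔻 : DefiniteAlgebra) where
  open DefiniteAlgebra 𝔻
  open Division 𝔻

  module Models (H : List Carrier)
    (isGroup : IsGroup _⊗_ 1# H) (spans : Spans 𝔻 H) where
    open FiniteGroup 𝔻 H isGroup spans
    open IsGroup isGroup

    -- `covered` is an inclusion only: H may be a proper subgroup, such as the quaternion group of
    -- order eight among the Hurwitz units. The algebra is determined nevertheless, and the group is
    -- completed by maximality of G.
    record Model {F : FinGrp} {E : Enumeration F} {a b : ℚ} (R : Realisation E a b) : Set where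
      open Realisation R
      open Enumeration E
      field
        ι            : Quat → Carrier
        ι-⊕          : ∀ x y → ι (QA._⊕_ a b x y) ≡ ι x ⊕ ι y
        ι-·          : ∀ c x → ι (QA._·ₛ_ a b c x) ≡ c · ι x
        ι-⊗          : ∀ x y → ι (QA._⊗_ a b x y) ≡ ι x ⊗ ι y
        ι-one        : ι (QA.oneQ a b) ≡ 1#
        ι-injective  : ∀ {x y} → ι x ≡ ι y → x ≡ y
        ι-surjective : ∀ y → Σ Quat λ x → ι x ≡ y
        covered      : ∀ {h} → h ∈ H → Σ (FinGrp.Car F) λ x → x ∈ elems × ι (ψ x) ≡ h

    -- Trace zero means that the conjugate of x is -x, so x² = -N(x) is a scalar and its trace
    -- determines it.
    traceless-square : ∀ x c → T x ≡ 0ℚ → T (x ⊗ x) ≡ c * 2ℚ → x ⊗ x ≡ c · 1#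
    traceless-square x c Tx Txx = trans xx (cong (_· 1#) n≡c)
      where
      sum : N x · 1# ⊕ x ⊗ x ≡ 0#
      sum = trans (⊕-comm (N x · 1#) (x ⊗ x)) (trans (cong (x ⊗ x ⊕_) (sym (conj-inverseʳ x)))
        (trans (sym (⊗-distribˡ x x (conj x))) (trans (cong (x ⊗_) (trans (conj-T x) (trans (cong (_· 1#) Tx) (·-zeroˡ 1#)))) (⊗-zeroʳ x))))
      xx : x ⊗ x ≡ (- 1ℚ * N x) · 1#
      xx = trans (⊕-zero⇒ sum) (·-assoc (- 1ℚ) (N x) 1#)
      n≡c : - 1ℚ * N x ≡ c
      n≡c = *-cancelˡ 2ℚ (- 1ℚ * N x) c (λ ()) (trans (QP.*-comm 2ℚ (- 1ℚ * N x))
        (trans (sym (trans (cong T xx) (trans (T-· (- 1ℚ * N x) 1#) (cong ((- 1ℚ * N x) *_) T-one)))) (trans Txx (QP.*-comm c 2ℚ))))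

    square-of-traceless : ∀ {h} → h ∈ H → T h ≡ 0ℚ → h ⊗ h ≡ - 1ℚ · 1#
    square-of-traceless {h} h∈ Th = traceless-square h (- 1ℚ) Th (trans (T-square-H h∈) (cong (λ t → t * t - 2ℚ) Th))

    module _ {a b : ℚ} (a<0 : a < 0ℚ) (b<0 : b < 0ℚ) (I J : Carrier) (I² : I ⊗ I ≡ a · 1#) (J² : J ⊗ J ≡ b · 1#)
      (T-I : T I ≡ 0ℚ) (T-J : T J ≡ 0ℚ) (T-IJ : T (I ⊗ J) ≡ 0ℚ)
      (u v w : ℚ) (u-inv : u * (a * 2ℚ) ≡ 1ℚ) (v-inv : v * (b * 2ℚ) ≡ 1ℚ) (w-inv : w * ((- 1ℚ * b) * a * 2ℚ) ≡ 1ℚ)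
      {F : FinGrp} {E : Enumeration F} (R : Realisation E a b) (candidate : ℚ → ℚ → ℚ → ℚ → Quat) (covers : Covers R candidate) where
      open Embedding 𝔻 a b a<0 b<0 I J I² J² T-I T-J T-IJ

      model : (∀ {h} → h ∈ H → Σ ℚ λ t₀ → Σ ℚ λ t₁ → Σ ℚ λ t₂ → Σ ℚ λ t₃ →
        (Small t₀ × Small t₁ × Small t₂ × Small t₃) × coordinates u v w u-inv v-inv w-inv h ≡ candidate t₀ t₁ t₂ t₃) → Model R
      model traces = record
        { ι = ι ; ι-⊕ = ι-⊕ ; ι-· = ι-· ; ι-⊗ = ι-⊗ ; ι-one = ι-one
        ; ι-injective = ι-injective
        ; ι-surjective = λ y → coordinates u v w u-inv v-inv w-inv y , ι-coordinates u v w u-inv v-inv w-inv y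
        ; covered = covered
        }
        where
        coords : Carrier → Quat
        coords = coordinates u v w u-inv v-inv w-inv
        norm : ∀ {h c} → h ∈ H → coords h ≡ c → 𝔸.N c ≡ 1ℚ
        norm {h} h∈ refl = trans (sym (N-ι (coords h))) (trans (cong N (ι-coordinates u v w u-inv v-inv w-inv h)) (N≡1 h∈))
        lift : ∀ {h c} → coords h ≡ c → (Σ (FinGrp.Car F) λ x → x ∈ Enumeration.elems E × Realisation.ψ R x ≡ c) →
          Σ (FinGrp.Car F) λ x → x ∈ Enumeration.elems E × ι (Realisation.ψ R x) ≡ h
        lift {h} e (x , x∈ , ψx) = x , x∈ , trans (cong ι (trans ψx (sym e))) (ι-coordinates u v w u-inv v-inv w-inv h)
        covered : ∀ {h} → h ∈ H → Σ (FinGrp.Car F) λ x → x ∈ Enumeration.elems E × ι (Realisation.ψ R x) ≡ h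
        covered {h} h∈ with traces h∈
        ... | _ , _ , _ , _ , ((n₀ , refl) , (n₁ , refl) , (n₂ , refl) , (n₃ , refl)) , e =
          lift e (find (All.lookup covers (∈-small⁴ n₀ n₁ n₂ n₃) (norm h∈ e)))

    lipschitz-model : ∀ i j → i ∈ H → j ∈ H → T i ≡ 0ℚ → T j ≡ 0ℚ → T (i ⊗ j) ≡ 0ℚ → Model SL2F3-realisation
    lipschitz-model i j i∈ j∈ Ti Tj Tij = model (QP.negative⁻¹ D2∞-a) (QP.negative⁻¹ D2∞-b) i j
      (square-of-traceless i∈ Ti) (square-of-traceless j∈ Tj) Ti Tj Tij
      (- ½) (- ½) (- ½) refl refl refl SL2F3-realisation lipschitz-candidate SL2F3-covers
      λ {h} h∈ → T h , T (h ⊗ i) , T (h ⊗ j) , T (h ⊗ (i ⊗ j)) ,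
        (T-small h∈ , T-small (mul∈ h∈ i∈) , T-small (mul∈ h∈ j∈) , T-small (mul∈ h∈ (mul∈ i∈ j∈))) , refl

    dicyclic-model : ∀ b ω → b ∈ H → ω ∈ H → T b ≡ 0ℚ → T ω ≡ - 1ℚ → T (b ⊗ ω) ≡ 0ℚ → Model Dic12-realisation
    dicyclic-model b ω b∈ ω∈ Tb Tω Tbω = model (QP.negative⁻¹ D3∞-a) (QP.negative⁻¹ D3∞-b) b J
      (square-of-traceless b∈ Tb) J² Tb TJ TbJ
      (- ½) (-[1+ 0 ] / 6) (-[1+ 0 ] / 6) refl refl refl Dic12-realisation dicyclic-candidate Dic12-covers
      -- J has norm 3 and lies outside H, so the small traces are taken against ω and bω, and `T-⊗J`
      -- converts them to traces against J and bJ.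
      λ {h} h∈ → T h , T (h ⊗ b) , T (h ⊗ ω) , T (h ⊗ b ⊗ ω) ,
        (T-small h∈ , T-small (mul∈ h∈ b∈) , T-small (mul∈ h∈ ω∈) , T-small (mul∈ (mul∈ h∈ b∈) ω∈)) ,
        cong₂ (λ s t → quat (T h * ½) (T (h ⊗ b) * - ½) (s * (-[1+ 0 ] / 6)) (t * (-[1+ 0 ] / 6)))
          (T-⊗J h) (trans (cong T (sym (⊗-assoc h b J))) (T-⊗J (h ⊗ b)))
      where
      J : Carrier
      -- The difference of ω and its conjugate: a traceless square root of -3.
      J = ω ⊕ ω ⊕ 1#
      T-⊗J : ∀ x → T (x ⊗ J) ≡ T (x ⊗ ω) + T (x ⊗ ω) + T x
      T-⊗J x = trans (cong T (trans (⊗-distribˡ x (ω ⊕ ω) 1#) (cong₂ _⊕_ (⊗-distribˡ x ω ω) (⊗-identityʳ x))))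
        (trans (T-⊕ (x ⊗ ω ⊕ x ⊗ ω) x) (cong (_+ T x) (T-⊕ (x ⊗ ω) (x ⊗ ω))))
      TJ : T J ≡ 0ℚ
      TJ = trans (T-⊕ (ω ⊕ ω) 1#) (trans (cong (_+ T 1#) (T-⊕ ω ω)) (cong₂ (λ s t → s + s + t) Tω T-one))
      TbJ : T (b ⊗ J) ≡ 0ℚ
      TbJ = trans (T-⊗J b) (cong₂ (λ s t → s + s + t) Tbω Tb)
      TJω : T (J ⊗ ω) ≡ - (ℤ.+ 3 / 1)
      TJω = trans (T-comm J ω) (trans (T-⊗J ω) (cong₂ (λ s t → s + s + t) (trans (T-square-H ω∈) (cong (λ t → t * t - 2ℚ) Tω)) Tω))
      J² : J ⊗ J ≡ D3∞-b · 1#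
      J² = traceless-square J D3∞-b TJ (trans (T-⊗J J) (cong₂ (λ s t → s + s + t) TJω TJ))

    classification : Model SL2F3-realisation ⊎ Model Dic12-realisation
    classification with generators
    ... | lipschitz i j i∈ j∈ Ti Tj Tij = inj₁ (lipschitz-model i j i∈ j∈ Ti Tj Tij)
    ... | dicyclic b ω b∈ ω∈ Tb Tω Tbω = inj₂ (dicyclic-model b ω b∈ ω∈ Tb Tω Tbω)

-- Lines from a direct sum decomposition

module _ (𝔻 : DefiniteAlgebra) where
  open DefiniteAlgebra 𝔻
  open Division 𝔻

  module Decomposition
    (sum : ∀ n → (Fin n → Row) → Row) (sum-zero : ∀ w → sum 0 w ≡ 0ᵣ)
    (sum-suc : ∀ n w → sum (suc n) w ≡ w zero ⊕ᵣ sum n (λ i → w (suc i)))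
    (s : ℕ) (V : Fin (suc (suc s)) → Row → Set)
    (zero∈ : ∀ i → V i 0ᵣ) (smul∈ : ∀ i d {v} → V i v → V i (d ·ₗ v))
    (unique : ∀ w w' → (∀ i → V i (w i)) → (∀ i → V i (w' i)) → sum (suc (suc s)) w ≡ sum (suc (suc s)) w' → ∀ i → w i ≡ w' i)
    (v₀ v₁ : Row) (v₀∈ : V zero v₀) (v₁∈ : V (suc zero) v₁) (v₀≢0 : ¬ (v₀ ≡ 0ᵣ)) (v₁≢0 : ¬ (v₁ ≡ 0ᵣ)) where

    sum-zeros : ∀ n → sum n (λ _ → 0ᵣ) ≡ 0ᵣ
    sum-zeros zero    = sum-zero (λ _ → 0ᵣ)
    sum-zeros (suc n) = trans (sum-suc n (λ _ → 0ᵣ)) (trans (⊕ᵣ-identityˡ (sum n (λ _ → 0ᵣ))) (sum-zeros n))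

    single : ∀ {n} → Fin n → Row → Fin n → Row
    single zero    v zero    = v
    single zero    v (suc i) = 0ᵣ
    single (suc k) v zero    = 0ᵣ
    single (suc k) v (suc i) = single k v i

    single-diagonal : ∀ {n} (k : Fin n) v → single k v k ≡ v
    single-diagonal zero    v = refl
    single-diagonal (suc k) v = single-diagonal k v

    sum-single : ∀ {n} (k : Fin n) v → sum n (single k v) ≡ v
    sum-single {suc n} zero v = trans (sum-suc n (single zero v)) (trans (cong (v ⊕ᵣ_) (sum-zeros n)) (⊕ᵣ-identityʳ v))
    sum-single {suc n} (suc k) v = trans (sum-suc n (single (suc k) v)) (trans (⊕ᵣ-identityˡ (sum n (single k v))) (sum-single k v))

    single∈ : ∀ {n} (U : Fin n → Row → Set) → (∀ i → U i 0ᵣ) → ∀ k {v} → U k v → ∀ i → U i (single k v i)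
    single∈ U z zero    v∈ zero    = v∈
    single∈ U z zero    v∈ (suc i) = z (suc i)
    single∈ U z (suc k) v∈ zero    = z zero
    single∈ U z (suc k) v∈ (suc i) = single∈ (λ i → U (suc i)) (λ i → z (suc i)) k v∈ i

    pair : Row → Row → Fin (suc (suc s)) → Row
    pair p q zero          = p
    pair p q (suc zero)    = q
    pair p q (suc (suc i)) = 0ᵣ

    sum-pair : ∀ p q → sum (suc (suc s)) (pair p q) ≡ p ⊕ᵣ q
    sum-pair p q = trans (sum-suc (suc s) (pair p q)) (cong (p ⊕ᵣ_)
      (trans (sum-suc s (λ i → pair p q (suc i))) (trans (cong (q ⊕ᵣ_) (sum-zeros s)) (⊕ᵣ-identityʳ q))))

    pair∈ : ∀ {p q} → V zero p → V (suc zero) q → ∀ i → V i (pair p q i)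
    pair∈ p∈ q∈ zero          = p∈
    pair∈ p∈ q∈ (suc zero)    = q∈
    pair∈ p∈ q∈ (suc (suc i)) = zero∈ (suc (suc i))

    independent : Independent v₀ v₁
    independent x y e = nonzero-row v₀≢0 (components zero) , nonzero-row v₁≢0 (components (suc zero))
      where
      components : ∀ i → pair (x ·ₗ v₀) (y ·ₗ v₁) i ≡ pair 0ᵣ 0ᵣ i
      components = unique (pair (x ·ₗ v₀) (y ·ₗ v₁)) (pair 0ᵣ 0ᵣ)
        (pair∈ (smul∈ zero x v₀∈) (smul∈ (suc zero) y v₁∈)) (pair∈ (zero∈ zero) (zero∈ (suc zero)))
        (trans (sum-pair (x ·ₗ v₀) (y ·ₗ v₁)) (trans e (sym (trans (sum-pair 0ᵣ 0ᵣ) (⊕ᵣ-identityˡ 0ᵣ)))))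

    -- Write w = x v₀ + y v₁ and compare, by directness, the family concentrated at k with (x v₀, y
    -- v₁, 0, ...). This shows at once that the first two summands are lines and that any further
    -- summand contains no nonzero row.
    lines : ∀ k w → V k w → ¬ (w ≡ 0ᵣ) → (Σ Carrier λ d → w ≡ d ·ₗ v₀) ⊎ (Σ Carrier λ d → w ≡ d ·ₗ v₁)
    lines k w w∈ w≢0 with independent⇒spanning v₀ v₁ independent w
    ... | x , y , e = locate k w∈ components
      where
      components : ∀ i → single k w i ≡ pair (x ·ₗ v₀) (y ·ₗ v₁) i
      components = unique (single k w) (pair (x ·ₗ v₀) (y ·ₗ v₁)) (single∈ V zero∈ k w∈)
        (pair∈ (smul∈ zero x v₀∈) (smul∈ (suc zero) y v₁∈))
        (trans (sum-single k w) (trans e (sym (sum-pair (x ·ₗ v₀) (y ·ₗ v₁)))))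
      locate : ∀ k → V k w → (∀ i → single k w i ≡ pair (x ·ₗ v₀) (y ·ₗ v₁) i) →
        (Σ Carrier λ d → w ≡ d ·ₗ v₀) ⊎ (Σ Carrier λ d → w ≡ d ·ₗ v₁)
      locate zero          _ c = inj₁ (x , c zero)
      locate (suc zero)    _ c = inj₂ (y , c (suc zero))
      locate (suc (suc k)) _ c = ⊥-elim (w≢0 (trans (sym (single-diagonal k w)) (c (suc (suc k)))))

-- Inclusion of G in a wreath product

module _ (𝔻 : DefiniteAlgebra) (𝕄 : MatrixAlgebra 𝔻) where
  open DefiniteAlgebra 𝔻
  open Division 𝔻
  open MatrixAlgebra 𝕄

  module Main
    (G : List M) (isGroup : IsGroup _∘_ 1ₘ G)
    (irreducible : ∀ W → IsRowSubspace 𝔻 W → ∀ v → (∀ {g} → g ∈ G → W (v ·ᵣ g)) → ∀ m → W (v ·ᵣ m))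
    (v₀ v₁ : Row) (ind : Independent v₀ v₁)
    (lines : ∀ {g} → g ∈ G → (Σ Carrier λ d → v₀ ·ᵣ g ≡ d ·ₗ v₀) ⊎ (Σ Carrier λ d → v₀ ·ᵣ g ≡ d ·ₗ v₁)) where
    open IsGroup isGroup
    open Monomial 𝔻 𝕄 G isGroup irreducible

    -- Hides the choice of τ, on which the basis and H depend, and lets both cases share the
    -- construction of the final isomorphisms.
    record WreathForm {F : FinGrp} {E : Enumeration F} {a b : ℚ} (R : Realisation E a b) : Set₁ where
      field
        {H}       : List Carrier
        H-isGroup : IsGroup _⊗_ 1# H
        H-spans   : Spans 𝔻 H
        model     : Models.Model 𝔻 H H-isGroup H-spans R
        wreath    : List M
        wreath-isGroup : IsGroup _∘_ 1ₘ wreath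
        G⊆wreath  : ∀ {g} → g ∈ G → g ∈ wreath
        φ         : FinGrp.Car (Wr2 F) → M
        φ-into    : ∀ {w} → FinGrp.Elem (Wr2 F) w → φ w ∈ wreath
        φ-onto    : ∀ {m} → m ∈ wreath → Σ (FinGrp.Car (Wr2 F)) λ w → FinGrp.Elem (Wr2 F) w × φ w ≡ m
        φ-inj     : ∀ {v w} → FinGrp.Elem (Wr2 F) v → FinGrp.Elem (Wr2 F) w → φ v ≡ φ w → v ≡ w
        φ-hom     : ∀ {v w} → FinGrp.Elem (Wr2 F) v → FinGrp.Elem (Wr2 F) w →
                    φ (FinGrp._∙_ (Wr2 F) v w) ≡ φ v ∘ φ w

    module Swapped (τ : M) (τ∈ : τ ∈ G) (d : Carrier) (v₀τ : v₀ ·ᵣ τ ≡ d ·ₗ v₁) where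

      d≢0 : ¬ (d ≡ 0#)
      d≢0 refl with inv∈ τ∈
      ... | σ , _ , τσ , _ = 1≢0 (proj₁ (ind 1# 0# (trans (comb-fst v₀ v₁ 1#) (trans (·ₗ-identity v₀)
        (trans (sym (act-1 v₀)) (trans (cong (v₀ ·ᵣ_) (sym τσ)) (trans (act-∘ v₀ τ σ)
        (trans (cong (_·ᵣ σ) v₀τ) (trans (act-· 0# v₁ σ) (·ₗ-zeroˡ (v₁ ·ᵣ σ)))))))))))

      u₁ : Row
      u₁ = d ·ₗ v₁

      u-ind : Independent v₀ u₁
      u-ind = scaled d≢0 ind

      u-lines : ∀ {g} → g ∈ G → (Σ Carrier λ e → v₀ ·ᵣ g ≡ e ·ₗ v₀) ⊎ (Σ Carrier λ e → v₀ ·ᵣ g ≡ e ·ₗ u₁)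
      u-lines g∈ = Sum.map₂ rescale (lines g∈)
        where
        rescale : ∀ {w} → (Σ Carrier λ e → w ≡ e ·ₗ v₁) → Σ Carrier λ e → w ≡ e ·ₗ u₁
        rescale (e , w≡) = let δ , _ , δd = inverse d≢0 in e ⊗ δ ,
          trans w≡ (trans (cong (_·ₗ v₁) (sym (⊗-inverse-cancelʳ e δd))) (·ₗ-assoc (e ⊗ δ) d v₁))

      open Coefficients v₀ u₁ u-ind τ τ∈ (sym v₀τ) u-lines

      module _ {F : FinGrp} {E : Enumeration F} {a b : ℚ} (R : Realisation E a b) (model : Models.Model 𝔻 H H-isGroup H-spans R) where
        open Models.Model model
        open Realisation R
        open Enumeration E
        representation : Representation 𝔻 E
        representation = record
          { Ψ      = λ x → ι (ψ x)
          ; Ψ-unit = trans (cong ι ψ-unit) ι-one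
          ; Ψ-hom  = λ {x} {y} x∈ y∈ → trans (cong ι (All.lookup ψ-hom (∈-cartesianProduct⁺ x∈ y∈))) (ι-⊗ (ψ x) (ψ y))
          ; Ψ-inj  = λ x∈ y∈ e → All.lookup ψ-inj (∈-cartesianProduct⁺ x∈ y∈) (ι-injective e)
          }

        open Wreath 𝔻 𝕄 v₀ u₁ u-ind representation
          using (wreath; wreath-isGroup; elemsᵂ; monomial-onto; monomial-inj; monomial-hom; Elem⇒∈; ∈⇒Elem)
          renaming (monomial to φ)

        included : ∀ {g} → g ∈ G → g ∈ wreath
        included {g} g∈ = Sum.[ diagonal , antidiagonal ]′ (monomial g∈)
          where
          diagonal : twist g v₀ u₁ → g ∈ wreath
          diagonal (x , y , x∈ , y∈ , e₀ , e₁) = let p , p∈ , ιp = covered x∈ ; q , q∈ , ιq = covered y∈ in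
            monomial-onto false p∈ q∈ (trans e₀ (cong (_·ₗ v₀) (sym ιp))) (trans e₁ (cong (_·ₗ u₁) (sym ιq)))
          antidiagonal : twist g u₁ v₀ → g ∈ wreath
          antidiagonal (x , y , x∈ , y∈ , e₀ , e₁) = let p , p∈ , ιp = covered x∈ ; q , q∈ , ιq = covered y∈ in
            monomial-onto true p∈ q∈ (trans e₀ (cong (_·ₗ u₁) (sym ιp))) (trans e₁ (cong (_·ₗ v₀) (sym ιq)))

        wreathForm : WreathForm R
        wreathForm = record
          { H-isGroup = H-isGroup ; H-spans = H-spans ; model = model
          ; wreath = wreath ; wreath-isGroup = wreath-isGroup ; G⊆wreath = included
          ; φ = φ
          ; φ-into = λ {w} w-elem → ∈-map⁺ φ {x = w} (Elem⇒∈ {w} w-elem)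
          ; φ-onto = λ m∈ → let w , w∈ , e = ∈-map⁻ φ m∈ in w , ∈⇒Elem {w} w∈ , sym e
          ; φ-inj = λ {v} {w} v-elem w-elem → monomial-inj {v} {w} (Elem⇒∈ {v} v-elem) (Elem⇒∈ {w} w-elem)
          ; φ-hom = λ {v} {w} v-elem w-elem → monomial-hom {v} {w} (Elem⇒∈ {v} v-elem) (Elem⇒∈ {w} w-elem)
          }

      conclusion : WreathForm SL2F3-realisation ⊎ WreathForm Dic12-realisation
      conclusion = Sum.map (wreathForm SL2F3-realisation) (wreathForm Dic12-realisation)
        (Models.classification 𝔻 H H-isGroup H-spans)

    abstract
      theorem : WreathForm SL2F3-realisation ⊎ WreathForm Dic12-realisation
      theorem = let τ , τ∈ , d , e = moving v₀ v₁ ind (λ g g∈ → Sum.swap (lines g∈)) in Swapped.conclusion τ τ∈ d e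

-- Matrices over a concrete quaternion algebra

module Entries (𝔻 : DefiniteAlgebra) where
  open DefiniteAlgebra 𝔻
  open Division 𝔻

  entry-⊕ : ∀ x x' y y' g h → (x ⊕ x') ⊗ g ⊕ (y ⊕ y') ⊗ h ≡ (x ⊗ g ⊕ y ⊗ h) ⊕ (x' ⊗ g ⊕ y' ⊗ h)
  entry-⊕ x x' y y' g h = trans (cong₂ _⊕_ (⊗-distribʳ g x x') (⊗-distribʳ h y y'))
    (interchange (x ⊗ g) (x' ⊗ g) (y ⊗ h) (y' ⊗ h))

  entry-· : ∀ d x y g h → d ⊗ x ⊗ g ⊕ d ⊗ y ⊗ h ≡ d ⊗ (x ⊗ g ⊕ y ⊗ h)
  entry-· d x y g h = trans (cong₂ _⊕_ (⊗-assoc d x g) (⊗-assoc d y h)) (sym (⊗-distribˡ d (x ⊗ g) (y ⊗ h)))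

  entry-∘ : ∀ x y p q p' q' r s →
    x ⊗ (p ⊗ r ⊕ q ⊗ s) ⊕ y ⊗ (p' ⊗ r ⊕ q' ⊗ s) ≡ (x ⊗ p ⊕ y ⊗ p') ⊗ r ⊕ (x ⊗ q ⊕ y ⊗ q') ⊗ s
  entry-∘ x y p q p' q' r s = trans
    (cong₂ _⊕_ (sym (trans (cong₂ _⊕_ (⊗-assoc x p r) (⊗-assoc x q s)) (sym (⊗-distribˡ x (p ⊗ r) (q ⊗ s)))))
      (sym (trans (cong₂ _⊕_ (⊗-assoc y p' r) (⊗-assoc y q' s)) (sym (⊗-distribˡ y (p' ⊗ r) (q' ⊗ s))))))
    (trans (interchange (x ⊗ p ⊗ r) (x ⊗ q ⊗ s) (y ⊗ p' ⊗ r) (y ⊗ q' ⊗ s))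
      (sym (cong₂ _⊕_ (⊗-distribʳ r (x ⊗ p) (y ⊗ p')) (⊗-distribʳ s (x ⊗ q) (y ⊗ q')))))

  entry-fst : ∀ g h → 1# ⊗ g ⊕ 0# ⊗ h ≡ g
  entry-fst g h = trans (cong₂ _⊕_ (⊗-identityˡ g) (⊗-zeroˡ h)) (⊕-identityʳ g)

  entry-snd : ∀ g h → 0# ⊗ g ⊕ 1# ⊗ h ≡ h
  entry-snd g h = trans (cong₂ _⊕_ (⊗-zeroˡ g) (⊗-identityˡ h)) (⊕-identityˡ h)

  entry-1fst : ∀ x y → x ⊗ 1# ⊕ y ⊗ 0# ≡ x
  entry-1fst x y = trans (cong₂ _⊕_ (⊗-identityʳ x) (⊗-zeroʳ y)) (⊕-identityʳ x)

  entry-1snd : ∀ x y → x ⊗ 0# ⊕ y ⊗ 1# ≡ y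
  entry-1snd x y = trans (cong₂ _⊕_ (⊗-zeroʳ x) (⊗-identityʳ y)) (⊕-identityˡ y)

  entry-zero : ∀ x y → x ⊗ 0# ⊕ y ⊗ 0# ≡ 0#
  entry-zero x y = trans (cong₂ _⊕_ (⊗-zeroʳ x) (⊗-zeroʳ y)) (⊕-identityˡ 0#)

  entry-sum : ∀ x y g h g' h' → x ⊗ (g ⊕ g') ⊕ y ⊗ (h ⊕ h') ≡ (x ⊗ g ⊕ y ⊗ h) ⊕ (x ⊗ g' ⊕ y ⊗ h')
  entry-sum x y g h g' h' = trans (cong₂ _⊕_ (⊗-distribˡ x g g') (⊗-distribˡ y h h'))
    (interchange (x ⊗ g) (x ⊗ g') (y ⊗ h) (y ⊗ h'))

  entry-scale : ∀ c x y g h → x ⊗ (c · g) ⊕ y ⊗ (c · h) ≡ c · (x ⊗ g ⊕ y ⊗ h)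
  entry-scale c x y g h = trans (cong₂ _⊕_ (·-⊗-comm c x g) (·-⊗-comm c y h)) (sym (·-distribˡ c (x ⊗ g) (y ⊗ h)))

module Concrete (a b : ℚ) (a<0 : a < 0ℚ) (b<0 : b < 0ℚ) where
  𝔻 : DefiniteAlgebra
  𝔻 = quaternions a b a<0 b<0

  open Entries 𝔻
  module B = QA a b

  matrices : MatrixAlgebra 𝔻
  matrices = record
    { M = B.Mat
    ; 1ₘ = B.oneM
    ; _∘_ = B._⊗ₘ_
    ; _·ᵣ_ = B._·ᵣ_
    ; act-⊕ = λ { (x , y) (x' , y') (B.mat p q r s) → cong₂ _,_ (entry-⊕ x x' y y' p r) (entry-⊕ x x' y y' q s) }
    ; act-· = λ { d (x , y) (B.mat p q r s) → cong₂ _,_ (entry-· d x y p r) (entry-· d x y q s) }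
    ; act-∘ = λ { (x , y) (B.mat p q p' q') (B.mat r r' s s') →
        cong₂ _,_ (entry-∘ x y p q p' q' r s) (entry-∘ x y p q p' q' r' s') }
    ; act-1 = λ { (x , y) → cong₂ _,_ (entry-1fst x y) (entry-1snd x y) }
    ; act-ext = λ { (B.mat p q r s) (B.mat p' q' r' s') e → mat-cong
        (trans (sym (entry-fst p r)) (trans (cong proj₁ (e (B.oneQ , B.zeroQ))) (entry-fst p' r')))
        (trans (sym (entry-fst q s)) (trans (cong proj₂ (e (B.oneQ , B.zeroQ))) (entry-fst q' s')))
        (trans (sym (entry-snd p r)) (trans (cong proj₁ (e (B.zeroQ , B.oneQ))) (entry-snd p' r')))
        (trans (sym (entry-snd q s)) (trans (cong proj₂ (e (B.zeroQ , B.oneQ))) (entry-snd q' s'))) }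
    ; act-rows = λ { (p , q) (r , s) → B.mat p q r s , λ x y → refl }
    }
    where
    mat-cong : ∀ {p q r s p' q' r' s'} → p ≡ p' → q ≡ q' → r ≡ r' → s ≡ s' → B.mat p q r s ≡ B.mat p' q' r' s'
    mat-cong refl refl refl refl = refl

  open DefiniteAlgebra 𝔻
  open Division 𝔻
  open MatrixAlgebra matrices using (_·ᵣ_; act-·; act-∘; act-1)

  module _ (G : List B.Mat) (finite : B.IsFiniteSubgroup G) (spanning : B.IsAbsolutelyIrreducible G) where
    open B.IsFiniteSubgroup finite

    isGroup : IsGroup B._⊗ₘ_ B.oneM G
    isGroup = record { one∈ = one∈ ; mul∈ = mul∈ ; inv∈ = inv∈ }

    -- The row v m is ℚ-linear in m, so writing m as a combination of elements g of G writes v m as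
    -- the same combination of the rows v g.
    irreducible : ∀ W → IsRowSubspace 𝔻 W → ∀ v → (∀ {g} → g ∈ G → W (v ·ᵣ g)) → ∀ m → W (v ·ᵣ m)
    irreducible W subspace v generators m = subst (λ m → W (v ·ᵣ m)) (sym (proj₂ (proj₂ (spanning m))))
      (combination (proj₁ (spanning m)) (proj₁ (proj₂ (spanning m))))
      where
      open IsRowSubspace subspace
      act-zero : ∀ v → v ·ᵣ B.zeroM ≡ 0ᵣ
      act-zero (x , y) = cong₂ _,_ (entry-zero x y) (entry-zero x y)
      act-sum : ∀ v m n → v ·ᵣ (m B.⊕ₘ n) ≡ v ·ᵣ m ⊕ᵣ v ·ᵣ n
      act-sum (x , y) (B.mat p q r s) (B.mat p' q' r' s') = cong₂ _,_ (entry-sum x y p r p' r') (entry-sum x y q s q' s')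
      act-scale : ∀ c v m → v ·ᵣ (c B.·ₘ m) ≡ _·ᵠ_ 𝔻 c (v ·ᵣ m)
      act-scale c (x , y) (B.mat p q r s) = cong₂ _,_ (entry-scale c x y p r) (entry-scale c x y q s)
      combination : ∀ cs → All (λ p → proj₂ p ∈ G) cs → W (v ·ᵣ B.linComb cs)
      combination [] [] = subst W (sym (act-zero v)) zero∈
      combination ((c , g) ∷ cs) (g∈ ∷ cs∈) = subst W (sym (trans (act-sum v (c B.·ₘ g) (B.linComb cs))
        (cong (_⊕ᵣ v ·ᵣ B.linComb cs) (act-scale c v g))))
        (add∈ (scale∈ c (generators g∈)) (combination cs cs∈))

    module _ (imprimitive : B.IsImprimitive G) (maximal : B.IsMaximalFinite G) where
      s : ℕ
      s = proj₁ imprimitive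
      V : Fin (suc (suc s)) → Row → Set
      V = proj₁ (proj₂ imprimitive)
      direct : B.IsDirectSumDecomposition (suc (suc s)) V
      direct = proj₁ (proj₂ (proj₂ imprimitive))
      nonzero-in : ∀ i → Σ Row λ v → V i v × ¬ (v ≡ 0ᵣ)
      nonzero-in = proj₁ (proj₂ (proj₂ (proj₂ imprimitive)))
      permuted : ∀ {g} → g ∈ G → ∀ i → Σ (Fin (suc (suc s))) λ j → B.MapsOnto g (V i) (V j)
      permuted = proj₂ (proj₂ (proj₂ (proj₂ imprimitive)))

      v₀ v₁ : Row
      v₀ = proj₁ (nonzero-in zero)
      v₁ = proj₁ (nonzero-in (suc zero))

      open Decomposition 𝔻 B.sumR (λ _ → refl) (λ _ _ → refl) s V
        (λ i → B.IsLeftSubmodule.zero∈ (proj₁ direct i)) (λ i d → B.IsLeftSubmodule.smul∈ (proj₁ direct i) d)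
        (proj₂ (proj₂ direct)) v₀ v₁
        (proj₁ (proj₂ (nonzero-in zero))) (proj₁ (proj₂ (nonzero-in (suc zero))))
        (proj₂ (proj₂ (nonzero-in zero))) (proj₂ (proj₂ (nonzero-in (suc zero))))
        using (independent; lines)

      image-lines : ∀ {g} → g ∈ G → (Σ Carrier λ d → v₀ ·ᵣ g ≡ d ·ₗ v₀) ⊎ (Σ Carrier λ d → v₀ ·ᵣ g ≡ d ·ₗ v₁)
      image-lines {g} g∈ = lines (proj₁ (permuted g∈ zero)) (v₀ ·ᵣ g)
        (proj₁ (proj₂ (permuted g∈ zero)) (proj₁ (proj₂ (nonzero-in zero)))) v₀g≢0
        where
        v₀g≢0 : ¬ (v₀ ·ᵣ g ≡ 0ᵣ)
        v₀g≢0 e with inv∈ g∈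
        ... | h , _ , gh , _ = proj₂ (proj₂ (nonzero-in zero))
          (trans (sym (act-1 v₀)) (trans (cong (v₀ ·ᵣ_) (sym gh)) (trans (act-∘ v₀ g h)
          (trans (cong (_·ᵣ h) (trans e (sym (·ₗ-zeroˡ v₀)))) (trans (act-· 0# v₀ h) (·ₗ-zeroˡ (v₀ ·ᵣ h)))))))

      open Main 𝔻 matrices G isGroup irreducible v₀ v₁ independent image-lines

      module _ {F : FinGrp} {E : Enumeration F} {a' b' : ℚ} (R : Realisation E a' b') (form : WreathForm R) where
        open WreathForm form
        open Models.Model model

        preimage : Quat → Quat
        preimage y = proj₁ (ι-surjective y)

        ι-preimage : ∀ y → ι (preimage y) ≡ y
        ι-preimage y = proj₂ (ι-surjective y)

        -- `ι` maps into the given algebra while the isomorphism sought leaves it, so its inverse is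
        -- taken; each law is checked after applying the injective `ι`.
        algebra-iso : QAlgIso a b a' b'
        algebra-iso = record
          { f      = preimage
          ; f-add  = λ x y → ι-injective (trans (ι-preimage (x ⊕ y)) (sym (trans (ι-⊕ (preimage x) (preimage y)) (cong₂ _⊕_ (ι-preimage x) (ι-preimage y)))))
          ; f-scal = λ c x → ι-injective (trans (ι-preimage (c · x)) (sym (trans (ι-· c (preimage x)) (cong (c ·_) (ι-preimage x)))))
          ; f-mul  = λ x y → ι-injective (trans (ι-preimage (x ⊗ y)) (sym (trans (ι-⊗ (preimage x) (preimage y)) (cong₂ _⊗_ (ι-preimage x) (ι-preimage y)))))
          ; f-one  = ι-injective (trans (ι-preimage 1#) (sym ι-one))
          ; f-inj  = λ x y e → trans (sym (ι-preimage x)) (trans (cong ι e) (ι-preimage y))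
          ; f-surj = λ y → ι y , ι-injective (ι-preimage (ι y))
          }

        wreath-finite : B.IsFiniteSubgroup wreath
        wreath-finite = record { one∈ = IsGroup.one∈ wreath-isGroup ; mul∈ = IsGroup.mul∈ wreath-isGroup ; inv∈ = IsGroup.inv∈ wreath-isGroup }

        group-iso : GrpIso a b (Wr2 F) G
        group-iso = record
          { φ      = φ
          -- The only appeal to maximality: it turns the inclusion of G in the wreath product into
          -- an equality.
          ; φ-into = λ {w} w-elem → maximal wreath wreath-finite G⊆wreath (φ-into {w} w-elem)
          ; φ-inj  = λ {v} {w} → φ-inj {v} {w}
          ; φ-onto = λ g∈ → φ-onto (G⊆wreath g∈)
          ; φ-hom  = λ {v} {w} → φ-hom {v} {w}
          }

      result : (QAlgIso a b D2∞-a D2∞-b × GrpIso a b (Wr2 SL2F3) G) ⊎ (QAlgIso a b D3∞-a D3∞-b × GrpIso a b (Wr2 Dic12) G)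
      result = Sum.map (λ form → algebra-iso SL2F3-realisation form , group-iso SL2F3-realisation form)
        (λ form → algebra-iso Dic12-realisation form , group-iso Dic12-realisation form) theorem

theorem4p14 : (a b : ℚ) → a < 0ℚ → b < 0ℚ → (G : List (Mat a b)) →
    IsFiniteSubgroup a b G → IsAbsolutelyIrreducible a b G →
    IsMaximalFinite a b G → IsImprimitive a b G →
    (QAlgIso a b D2∞-a D2∞-b × GrpIso a b (Wr2 SL2F3) G)
    ⊎ (QAlgIso a b D3∞-a D3∞-b × GrpIso a b (Wr2 Dic12) G)
theorem4p14 a b a<0 b<0 G finite spanning maximal imprimitive =
  Concrete.result a b a<0 b<0 G finite spanning imprimitive maximal
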